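{- Let $\alpha>0$ and let $\mathcal{P}$ be a polynomial time computable implicit set problem which has a random extension algorithm of time $g(\ell)=\left\lfloor 2^{\alpha\cdot\ell^2}\right\rfloor$. Then $\mathcal{P}$ has a randomized algorithm which runs in time $$2^{|E|-\Omega(\log^2(|E|))}\cdot\mathrm{poly}(|B|),$$ where $E$ is the ground set of the instance and $B$ is the encoding of the instance.
   Context: $\log$ is the logarithm in base $2$. Implicit set problem: a set $\mathcal{P}$ of instances of the form $(E,\mathcal{F},B,\mathsf{oracle})$ where $E$ is a finite set (the ground set), $\mathcal{F}\subseteq 2^E$, $B\in\{0,1\}^*$ is the encoding of the instance, and $\mathsf{oracle}:2^E\times\mathbb{N}\to\{0,1\}$ is the oracle of the instance. The instance is a "yes"-instance if $\mathcal{F}\ne\emptyset$ and a "no"-instance otherwise. An algorithm for $\mathcal{P}$ is given $B$ as input and runs in the model of an oracle Turing machine whose oracle is $\mathsf{oracle}$; its objective is to determine whether $\mathcal{F}\ne\emptyset$. A randomized algorithm returns "yes" with probability at least $\frac12$ on "yes"-instances and returns "no" with probability $1$ on "no"-instances. $\mathcal{P}$ is polynomial time computable if there are oracle Turing machine algorithms (with oracle $\mathsf{oracle}$) which, for every $(E,\mathcal{F},B,\mathsf{oracle})\in\mathcal{P}$, (i) given $B$ compute $E$ in time $\mathrm{poly}(|B|)$, and (ii) given $B$ and $S\subseteq E$ decide whether $S\in\mathcal{F}$ in time $\mathrm{poly}(|B|)$. For an instance $(E,\mathcal{F},B,\mathsf{oracle})$, $X\subseteq E$, $S\subseteq E\setminus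 X$ and an integer $\ell\ge 0$, $S$ is an $\ell$-extension of $X$ if $X\cup S\in\mathcal{F}$ and $|S|=\ell$. A random extension algorithm for $\mathcal{P}$ of time $g$ is an oracle Turing machine algorithm (with oracle $\mathsf{oracle}$) that, given $B$, $X\subseteq E$ and $\ell$, returns either a set $S\subseteq E$ or a special symbol $\perp\notin 2^E$, runs in time $g(\ell)\cdot\mathrm{poly}(|B|)$, and satisfies: if $X$ has an $\ell$-extension then it returns an $\ell$-extension of $X$ with probability at least $1/2$; and whenever it returns a set $S\subseteq E$, $S$ is an $\ell$-extension of $X$. A running time with $\Omega(\cdot)$ in the exponent means: at most $2^{|E|-h(|E|)}\cdot\mathrm{poly}(|B|)$ for some function $h(n)=\Omega(\log^2 n)$. -}

module Defs where

open import Data.Bool.Base using (Bool; true; false; if_then_else_)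
open import Data.Fin.Base using (Fin)
open import Data.Fin.Subset using (Subset; _∪_; _⊆_; ∁; ∣_∣)
open import Data.List.Base as List using (List; []; _∷_; _++_; length; concatMap)
open import Data.List.Relation.Unary.Unique.Propositional using (Unique)
open import Data.Maybe.Base using (Maybe; just; nothing)
open import Data.Nat.Base using (ℕ; zero; suc; _+_; _*_; _^_; _≤_; _<_; _≥_)
open import Data.Product.Base using (Σ; ∃; ∃-syntax; Σ-syntax; _×_; _,_; proj₁; proj₂)
open import Data.Sum.Base using (_⊎_)
open import Data.Vec.Base as Vec using (Vec; []; _∷_; toList)
open import Data.Integer.Base as ℤ using ()
open import Data.Rational.Base as ℚ using (ℚ; ↥_; ↧ₙ_; 0ℚ)
open import Function.Base using (_∘_)
open import Function.Bundles using (_↔_; _⇔_)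
open import Relation.Binary.PropositionalEquality using (_≡_; _≢_)
open import Relation.Nullary.Negation using (¬_)

------------------------------------------------------------------------
-- Real numbers, powers of two and logarithms

-- Two-sided Dedekind cuts: Lower p means p < x, Upper p means x < p.
record ℝ : Set₁ where
  field
    Lower Upper     : ℚ → Set
    lower-inhabited : ∃ Lower
    upper-inhabited : ∃ Upper
    lower-rounded   : ∀ p → Lower p ⇔ (∃[ q ] p ℚ.< q × Lower q)
    upper-rounded   : ∀ q → Upper q ⇔ (∃[ p ] p ℚ.< q × Upper p)
    disjoint        : ∀ p → ¬ (Lower p × Upper p)
    located         : ∀ p q → p ℚ.< q → Lower p ⊎ Upper q

Positiveᴿ : ℝ → Set
Positiveᴿ x = ℝ.Lower x 0ℚ

-- N = ⌊ 2 ^ (α · m) ⌋ for a real α > 0, i.e. N ≤ 2 ^ (α · m) < N + 1.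
-- Since 2 ^ (α · m) is the infimum of 2 ^ (u · m) over the rationals u > α,
-- and u = p / q is positive, N ≤ 2 ^ (α · m) says that N ^ q ≤ 2 ^ (p · m)
-- for all of them and 2 ^ (α · m) < N + 1 that 2 ^ (p · m) < (N + 1) ^ q for
-- some of them.
_≡⌊2^_·_⌋ : ℕ → ℝ → ℕ → Set
N ≡⌊2^ α · m ⌋ =
  (∀ u → ℝ.Upper α u → N ^ ↧ₙ u ≤ 2 ^ (ℤ.∣ ↥ u ∣ * m)) ×
  (∃[ u ] ℝ.Upper α u × 2 ^ (ℤ.∣ ↥ u ∣ * m) < suc N ^ ↧ₙ u)

-- (log₂ n)² ≤ m for n ≥ 1: every rational a / b ≤ log₂ n with a ≥ 0 and
-- b > 0 (that is, 2 ^ a ≤ n ^ b) satisfies (a / b)² ≤ m.  The case b = 0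
-- is harmless, as it forces a = 0.
log²_≤_ : ℕ → ℕ → Set
log² n ≤ m = ∀ a b → 2 ^ a ≤ n ^ b → a * a ≤ m * (b * b)

-- h(n) = Ω(log² n), the implied constant being 1 / k; k = 0 is excluded
-- automatically, because log² n > 0 for n ≥ 2.
IsΩlog² : (ℕ → ℕ) → Set
IsΩlog² h = ∃[ k ] ∃[ n₀ ] ∀ n → n ≥ n₀ → log² n ≤ (k * h n)

-- Up to domination, every polynomial bound has this form.
poly : ℕ → ℕ → ℕ
poly c n = c * suc n ^ c

------------------------------------------------------------------------
-- Binary encodings

-- Binary numerals, least significant bit first.
increment : List Bool → List Bool
increment []          = true ∷ []
increment (false ∷ w) = true ∷ w
increment (true ∷ w)  = false ∷ increment w

toBits : ℕ → List Bool
toBits zero    = []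
toBits (suc n) = increment (toBits n)

fromBits : List Bool → ℕ
fromBits []      = 0
fromBits (b ∷ w) = (if b then 1 else 0) + 2 * fromBits w

-- Self-delimiting: every bit is preceded by a 1, and a 0 ends each string.
encodeStrings : List (List Bool) → List Bool
encodeStrings = concatMap λ w → concatMap (λ b → true ∷ b ∷ []) w ++ (false ∷ [])

------------------------------------------------------------------------
-- Randomised multi-tape oracle Turing machines

-- The tape alphabet {0, 1, blank}.
Symbol : Set
Symbol = Maybe Bool

data Move : Set where
  left stay right : Move

-- A two-way infinite tape.  `before` lists the cells to the left of the
-- head, nearest first; `after` lists the scanned cell and the cells to its
-- right.  Cells not listed are blank.
record Tape : Set where
  constructor tape
  field
    before after : List Symbol

-- Never stores a trailing blank, so equal tapes are propositionally equal.
infixr 5 _∷ᵇ_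
_∷ᵇ_ : Symbol → List Symbol → List Symbol
nothing ∷ᵇ []      = []
nothing ∷ᵇ (s ∷ w) = nothing ∷ s ∷ w
just b  ∷ᵇ w       = just b ∷ w

first : List Symbol → Symbol
first []      = nothing
first (s ∷ _) = s

rest : List Symbol → List Symbol
rest []      = []
rest (_ ∷ w) = w

scan : Tape → Symbol
scan (tape _ r) = first r

write : Symbol → Tape → Tape
write s (tape l r) = tape l (s ∷ᵇ rest r)

move : Move → Tape → Tape
move left  (tape l r) = tape (rest l) (first l ∷ᵇ r)
move stay  t          = t
move right (tape l r) = tape (first r ∷ᵇ l) (rest r)

load : List Bool → Tape
load w = tape [] (List.map just w)

-- The string from the head rightwards up to the first blank.
prefix : List Symbol → List Bool
prefix []            = []
prefix (nothing ∷ _) = []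
prefix (just b ∷ w)  = b ∷ prefix w

contents : Tape → List Bool
contents (tape _ r) = prefix r

-- The instruction attached to a state: halt with a verdict; rewrite the
-- scanned cells and move the heads; enter the state selected by the oracle's
-- answer to the string on the query tape; enter a state selected by a fair
-- coin.
data Instruction (State : Set) (tapes : ℕ) : Set where
  halt : Bool → Instruction State tapes
  act  : (Vec Symbol tapes → State × Vec (Symbol × Move) tapes) → Instruction State tapes
  ask  : (Bool → State) → Instruction State tapes
  flip : (Bool → State) → Instruction State tapes

-- Tape 0 is the query tape and tape 1 the output tape; each of the inputs
-- has a tape of its own, and the work tapes come last.
record Machine (inputs : ℕ) : Set₁ where
  field
    work    : ℕ
    State   : Set
    finite  : ∃[ m ] State ↔ Fin m
    start   : State
    program : State → Instruction State (2 + (inputs + work))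

Deterministic : ∀ {i} → Machine i → Set
Deterministic M = ∀ q f → Machine.program M q ≢ flip f

module Execution {i : ℕ} (M : Machine i) (answer : List Bool → Bool) where
  open Machine M

  Tapes : Set
  Tapes = Vec Tape (2 + (i + work))

  Configuration : Set
  Configuration = State × Tapes

  initial : Vec (List Bool) i → Configuration
  initial inputs = start , load [] ∷ load [] ∷
    (Vec.map load inputs Vec.++ Vec.replicate work (load []))

  applyActions : ∀ {n} → Vec (Symbol × Move) n → Vec Tape n → Vec Tape n
  applyActions = Vec.zipWith λ (s , d) → move d ∘ write s

  execute : Instruction State (2 + (i + work)) → Bool → Configuration → Configuration
  execute (halt _) coin c        = c
  execute (act δ)  coin (q , ts) = let q′ , as = δ (Vec.map scan ts) in q′ , applyActions as ts
  execute (ask f)  coin (q , ts) = f (answer (contents (Vec.head ts))) , ts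
  execute (flip f) coin (q , ts) = f coin , ts

  -- The T coins are the random bits for T steps, one bit per step; it is
  -- ignored by every instruction other than `flip`.
  run : ∀ {T} → Vec Bool T → Configuration → Configuration
  run []            c = c
  run (coin ∷ coins) c = run coins (execute (program (proj₁ c)) coin c)

  haltVerdict : ∀ {n} → Instruction State n → Maybe Bool
  haltVerdict (halt b) = just b
  haltVerdict _        = nothing

  -- `nothing` if the machine has not halted after T steps.
  verdict : ∀ {T} → Vec (List Bool) i → Vec Bool T → Maybe Bool
  verdict inputs coins = haltVerdict (program (proj₁ (run coins (initial inputs))))

  output : ∀ {T} → Vec (List Bool) i → Vec Bool T → List Bool
  output inputs coins = contents (Vec.head (Vec.tail (proj₂ (run coins (initial inputs)))))

------------------------------------------------------------------------
-- Probability over T fair coins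

count : ∀ {T} → (Vec Bool T → Bool) → ℕ
count {zero}  f = if f [] then 1 else 0
count {suc T} f = count (f ∘ (false ∷_)) + count (f ∘ (true ∷_))

-- The event A has probability at least 1/2: at least half of the 2 ^ T coin
-- sequences belong to A.
Pr≥½ : ∀ {T} → (Vec Bool T → Set) → Set
Pr≥½ {T} A = Σ[ f ∈ (Vec Bool T → Bool) ]
  (∀ coins → f coins ≡ true → A coins) × 2 ^ T ≤ 2 * count f

------------------------------------------------------------------------
-- Implicit set problems

-- The elements of the ground set are named by distinct strings, and a
-- subset is represented by its characteristic vector in the listed order.
record Instance : Set₁ where
  field
    ground   : List (List Bool)
    distinct : Unique ground

  size : ℕ
  size = length ground

  field
    𝓕        : Subset size → Set
    encoding : List Bool
    oracle   : Subset size → ℕ → Bool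

-- A query (S , k) is the characteristic vector of S followed by the binary
-- numeral of k.  Strings too short to be a query are answered 0.
answerQuery : ∀ n → (Subset n → ℕ → Bool) → List Bool → Bool
answerQuery zero    o w       = o [] (fromBits w)
answerQuery (suc n) o []      = false
answerQuery (suc n) o (b ∷ w) = answerQuery n (o ∘ (b ∷_)) w

ImplicitSetProblem : Set₁
ImplicitSetProblem = Instance → Set

module On (I : Instance) {i : ℕ} (M : Machine i) =
  Execution M (answerQuery (Instance.size I) (Instance.oracle I))

IsYes IsNo : Instance → Set
IsYes I = ∃[ S ] Instance.𝓕 I S
IsNo I = ¬ IsYes I

module _ (P : ImplicitSetProblem) where
  open Instance

  ComputesGroundSet : Machine 1 → ℕ → Set₁
  ComputesGroundSet M c = ∀ I → P I →
    let open On I M in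
    ∀ (coins : Vec Bool (poly c (length (encoding I)))) →
      verdict (encoding I ∷ []) coins ≡ just true ×
      output (encoding I ∷ []) coins ≡ encodeStrings (ground I)

  DecidesMembership : Machine 2 → ℕ → Set₁
  DecidesMembership M c = ∀ I → P I → ∀ (S : Subset (size I)) →
    let open On I M in
    ∀ (coins : Vec Bool (poly c (length (encoding I)))) →
      (verdict (encoding I ∷ toList S ∷ []) coins ≡ just true × 𝓕 I S) ⊎
      (verdict (encoding I ∷ toList S ∷ []) coins ≡ just false × ¬ 𝓕 I S)

  PolynomialTimeComputable : Set₁
  PolynomialTimeComputable =
    (∃[ M ] Deterministic M × ∃[ c ] ComputesGroundSet M c) ×
    (∃[ M ] Deterministic M × ∃[ c ] DecidesMembership M c)

IsExtension : (I : Instance) (X : Subset (Instance.size I)) (ℓ : ℕ) →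
              Subset (Instance.size I) → Set
IsExtension I X ℓ S = S ⊆ ∁ X × Instance.𝓕 I (X ∪ S) × ∣ S ∣ ≡ ℓ

-- On (B , X , ℓ) the machine either returns the set on its output tape
-- (verdict true) or ⊥ (verdict false).
module Extension (I : Instance) (M : Machine 3) (X : Subset (Instance.size I)) (ℓ : ℕ) where
  open Instance I
  open On I M

  arguments : Vec (List Bool) 3
  arguments = encoding ∷ toList X ∷ toBits ℓ ∷ []

  Returns : ∀ {T} → Subset size → Vec Bool T → Set
  Returns S coins = verdict arguments coins ≡ just true × output arguments coins ≡ toList S

  Returns⊥ : ∀ {T} → Vec Bool T → Set
  Returns⊥ coins = verdict arguments coins ≡ just false

  -- Running time at most T, together with correctness.
  CorrectWithin : ℕ → Set
  CorrectWithin T =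
    (∀ (coins : Vec Bool T) → (∃[ S ] Returns S coins) ⊎ Returns⊥ coins) ×
    (∀ (coins : Vec Bool T) S → Returns S coins → IsExtension I X ℓ S) ×
    (∃ (IsExtension I X ℓ) →
      Pr≥½ λ (coins : Vec Bool T) → ∃[ S ] Returns S coins × IsExtension I X ℓ S)

RandomExtensionAlgorithm : ImplicitSetProblem → (ℕ → ℕ) → Set₁
RandomExtensionAlgorithm P g =
  ∃[ M ] ∃[ c ] ∀ I → P I → ∀ X ℓ →
    Extension.CorrectWithin I M X ℓ (g ℓ * poly c (length (Instance.encoding I)))

-- Whether the machine answers "yes" (verdict true) or "no" (verdict false)
-- correctly, for a running time of at most T.
module Decision (I : Instance) (M : Machine 1) where
  open Instance I
  open On I M

  Answers : ∀ {T} → Bool → Vec Bool T → Set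
  Answers b coins = verdict (encoding ∷ []) coins ≡ just b

  CorrectWithin : ℕ → Set
  CorrectWithin T =
    (∀ (coins : Vec Bool T) → ∃[ b ] Answers b coins) ×
    (IsYes I → Pr≥½ λ (coins : Vec Bool T) → Answers true coins) ×
    (IsNo I → ∀ (coins : Vec Bool T) → Answers false coins)

-- `Bound I T` says that T is an admissible running time on the instance I.
RandomizedAlgorithm : ImplicitSetProblem → (Instance → ℕ → Set) → Set₁
RandomizedAlgorithm P Bound =
  ∃[ M ] ∀ I → P I → ∃[ T ] Bound I T × Decision.CorrectWithin I M T

-- T ≤ 2 ^ (|E| - h(|E|)) · poly(|B|), multiplied by 2 ^ h(|E|).
Savings : (ℕ → ℕ) → ℕ → Instance → ℕ → Set
Savings h c I T = T * 2 ^ h size ≤ 2 ^ size * poly c (length encoding)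
  where open Instance I

{-# OPTIONS --safe #-}

-- Let S ∈ 𝓕 and n = |E|.  A uniformly guessed set X is S without ℓ of its
-- elements with probability C(|S|, ℓ) / 2 ^ n, and the extension algorithm
-- then finds the missing elements with probability 1/2.  For ℓ about
-- log n / (4 a), with an integer a > α, C(|S|, ℓ) exceeds the factor
-- 2 ^ (α ℓ²) in the cost of a trial by 2 ^ Ω(log² n), unless |S| is much
-- smaller than n.  Such an S is itself guessed often enough, namely with
-- probability 3 ^ (n - |S|) / 4 ^ n, if every element is taken with
-- probability 1/4; the extension algorithm with ℓ = 0 recognises it.  So a
-- trial that chooses between the two kinds of guesses by a coin succeeds with
-- probability at least 1/D for some D = 2 ^ (n - Ω(log² n)), and D trials
-- succeed with probability 1 - (1 - 1/D) ^ D ≥ 1/2.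
--
-- The extension machine has to be restarted on blank tapes.  As it may leave
-- blanks between its symbols, the non-blank cells of a tape cannot be found
-- by scanning, so a shadow of each tape records the cells visited.
module Submission where

open import Defs
open import Data.Bool.Base using (Bool; true; false; if_then_else_; _∧_)
open import Data.Empty using (⊥; ⊥-elim)
open import Data.Fin.Base using (Fin; zero; suc; splitAt; join)
open import Data.Fin.Properties as Fin using (+↔⊎; 1↔⊤; 2↔Bool; splitAt-join; join-splitAt)
open import Data.Fin.Subset using (Subset; _∪_; _⊆_; ∁; ∣_∣; inside; outside)
open import Data.Fin.Subset.Properties using (∣p∣≤n)
open import Data.Integer.Base as ℤ using ()
open import Data.List.Base as List using (List; []; _∷_; _++_; _ʳ++_; length; drop; replicate; allFin)
open import Data.List.Membership.Propositional using (_∈_)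
open import Data.List.Membership.Propositional.Properties using (∈-allFin)
open import Data.List.Properties using (length-map; length-drop; length-replicate; length-ʳ++; drop-drop)
open import Data.List.Relation.Unary.Any using (here; there)
open import Data.Maybe.Base as Maybe using (Maybe; just; nothing; maybe′)
open import Data.Maybe.Properties using (just-injective)
open import Data.Nat.Base
open import Data.Nat.DivMod using (_/_; _%_; m≡m%n+[m/n]*n; m%n<n; m≥n⇒m/n>0)
open import Data.Nat.Properties hiding (_≟_)
open import Data.Nat.Tactic.RingSolver using (solve-∀)
open import Data.Product.Base using (∃; ∃-syntax; Σ-syntax; _×_; _,_; proj₁; proj₂; map₁)
open import Data.Rational.Base using (ℚ; ↥_)
open import Data.Sum.Base as Sum using (_⊎_; inj₁; inj₂; [_,_])
open import Data.Sum.Function.Propositional using (_⊎-↔_)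
open import Data.Sum.Properties as Sum using (inj₁-injective; inj₂-injective)
open import Data.Unit.Base using (⊤; tt)
open import Data.Vec.Base as Vec using (Vec; []; _∷_; lookup; tabulate; toList; here; there)
open import Data.Vec.Membership.Propositional.Properties using (∈-lookup)
open import Data.Vec.Properties
  using ( map-++; zipWith-++; tabulate-cong; tabulate∘lookup; length-toList; lookup-map; lookup-zipWith
        ; lookup∘tabulate; lookup-replicate; lookup-splitAt; lookup-++ˡ; lookup-++ʳ)
open import Data.Vec.Relation.Unary.All as All using (All; []; _∷_)
open import Data.Vec.Relation.Unary.AllPairs using (AllPairs; []; _∷_)
open import Function.Base using (_∘_; const; case_of_)
open import Function.Bundles using (_↔_; Inverse; mk↔ₛ′)
open import Function.Properties.Inverse using (↔-refl; ↔-sym; ↔-trans)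
open import Relation.Binary.Definitions using (DecidableEquality)
open import Relation.Binary.PropositionalEquality hiding ([_])
open import Relation.Nullary.Decidable.Core using (does; yes; no)

-- Program fragments

-- The parameters are chosen so that the machine needs no multiplication or division. It removes
-- `q = 4 * a` bits at a time from the binary numeral of n and counts the removals, which gives ℓ,
-- with ρ bits left over. After each removal the counter of the trials, which starts with n + 2
-- zeros, loses as many bits as the numeral still has. These losses form an arithmetic progression,
-- so their sum is quadratic in ℓ. For ℓ = k + 1 the sum is ℓ δ with δ = ρ + 2 a k, which is exactly
-- the exponent in C(|S|, ℓ) ≥ (2 ^ δ) ^ ℓ, valid for |S| ≥ ℓ 2 ^ δ. The search ends when the
-- shortened counter overflows. The two extra zeros pay for the coin that selects the kind of guess
-- and for the success probability 1/2 of the extension algorithm.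
--
-- Probabilities are handled without fractions: a derivation about τ steps carries the numerator of
-- an expected payoff over 2 ^ τ, and the rules for sequencing and iteration combine numerators. As
-- the denominator is tied to the time bound, bounds have to be matched by padding. Soundness is
-- part of the postconditions and holds for every coin sequence.

update : Maybe (Symbol × Move) → Tape → Tape
update nothing        t = t
update (just (s , d)) t = move d (write s t)

-- Only the tapes satisfying Q may be used for oracle queries.
data Instr (k : ℕ) (Q : Fin k → Set) (S : Set) : Set where
  act  : (Vec Symbol k → S × Vec (Maybe (Symbol × Move)) k) → Instr k Q S
  ask  : ∀ p → Q p → (Bool → S) → Instr k Q S
  flip : (Bool → S) → Instr k Q S

mapI : ∀ {k Q} {S S′ : Set} → (S → S′) → Instr k Q S → Instr k Q S′
mapI h (act δ)     = act (map₁ h ∘ δ)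
mapI h (ask p q f) = ask p q (h ∘ f)
mapI h (flip f)    = flip (h ∘ f)

Finite : Set → Set
Finite A = ∃[ m ] A ↔ Fin m

⊤-finite : Finite ⊤
⊤-finite = 1 , ↔-sym 1↔⊤

Bool-finite : Finite Bool
Bool-finite = 2 , ↔-sym 2↔Bool

Fin-finite : ∀ n → Finite (Fin n)
Fin-finite n = n , ↔-refl

⊎-finite : ∀ {A B} → Finite A → Finite B → Finite (A ⊎ B)
⊎-finite (m , e) (n , f) = m + n , ↔-trans (e ⊎-↔ f) (↔-sym +↔⊎)

ΣBool-finite : ∀ {A : Bool → Set} → (∀ b → Finite (A b)) → Finite (Σ[ b ∈ Bool ] A b)
ΣBool-finite {A} fin = let m , e = ⊎-finite (fin true) (fin false) in m , ↔-trans Σ↔⊎ e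
  where
  to : Σ[ b ∈ Bool ] A b → A true ⊎ A false
  to (true , a)  = inj₁ a
  to (false , a) = inj₂ a
  from : A true ⊎ A false → Σ[ b ∈ Bool ] A b
  from (inj₁ a) = true , a
  from (inj₂ a) = false , a
  Σ↔⊎ : (Σ[ b ∈ Bool ] A b) ↔ (A true ⊎ A false)
  Σ↔⊎ = mk↔ₛ′ to from (λ { (inj₁ _) → refl ; (inj₂ _) → refl })
                      (λ { (true , _) → refl ; (false , _) → refl })

-- A state to continue in, or one of two exits.
record Frag (k : ℕ) (Q : Fin k → Set) : Set₁ where
  field
    State  : Set
    finite : Finite State
    start  : State
    code   : State → Instr k Q (State ⊎ Bool)
open Frag public

-- Running times and probabilities

Post : ℕ → Set₁
Post k = Bool → Vec Tape k → ℕ → Set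

-- The number is a payoff. Acceptance earns at most 1 and requires `Yes`, rejection earns nothing,
-- so an expected payoff is a lower bound for the probability of acceptance.
Verdict : ∀ {k} → Set → Post k
Verdict Yes true  ts w = Yes × w ≤ 1
Verdict Yes false ts w = w ≡ 0

module Semantics (answer : List Bool → Bool) where

  step : ∀ {k Q S} → Instr k Q S → Bool → Vec Tape k → S × Vec Tape k
  step (act δ)     _ ts = let q , as = δ (Vec.map scan ts) in q , Vec.zipWith update as ts
  step (ask p _ f) _ ts = f (answer (contents (lookup ts p))) , ts
  step (flip f)    c ts = f c , ts

  step-mapI : ∀ {k Q S S′} (h : S → S′) (i : Instr k Q S) c ts →
              step (mapI h i) c ts ≡ map₁ h (step i c ts)
  step-mapI h (act δ)     c ts = refl
  step-mapI h (ask p q f) c ts = refl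
  step-mapI h (flip f)    c ts = refl

  -- Hit F Φ τ a: whatever the coins, F exits within τ steps, through an exit
  -- b and with tapes ts such that Φ b ts w for some w, the expected value
  -- of w being at least a / 2 ^ τ.
  mutual
    data Hit {k Q} (F : Frag k Q) (Φ : Post k) : ℕ → ℕ → State F → Vec Tape k → Set where
      next : ∀ {τ a s ts} (w : Bool → ℕ) → a ≤ w false + w true →
             (∀ c → After F Φ τ (w c) (step (code F s) c ts)) → Hit F Φ (suc τ) a s ts

    data After {k Q} (F : Frag k Q) (Φ : Post k) : ℕ → ℕ → (State F ⊎ Bool) × Vec Tape k → Set where
      running : ∀ {τ a s ts} → Hit F Φ τ a s ts → After F Φ τ a (inj₁ s , ts)
      exited  : ∀ {τ a b ts} w → Φ b ts w → a ≤ w * 2 ^ τ → After F Φ τ a (inj₂ b , ts)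

  module _ {k Q} {F : Frag k Q} {Φ : Post k} where

    mutual
      Hit-lower : ∀ {τ a a′ s ts} → a′ ≤ a → Hit F Φ τ a s ts → Hit F Φ τ a′ s ts
      Hit-lower le (next w h f) = next w (≤-trans le h) f

      After-lower : ∀ {τ a a′ x} → a′ ≤ a → After F Φ τ a x → After F Φ τ a′ x
      After-lower le (running h)    = running (Hit-lower le h)
      After-lower le (exited w φ h) = exited w φ (≤-trans le h)

    mutual
      -- The additional coins are never looked at, so the numerator grows by the same factor as the
      -- denominator `2 ^ τ`.
      Hit-pad : ∀ {τ a s ts} d → Hit F Φ τ a s ts → Hit F Φ (τ + d) (a * 2 ^ d) s ts
      Hit-pad {a = a} d (next w h f) = next (λ c → w c * 2 ^ d)
        (≤-trans (*-monoˡ-≤ (2 ^ d) h) (≤-reflexive (*-distribʳ-+ (2 ^ d) (w false) (w true))))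
        (λ c → After-pad d (f c))

      After-pad : ∀ {τ a x} d → After F Φ τ a x → After F Φ (τ + d) (a * 2 ^ d) x
      After-pad d (running h)            = running (Hit-pad d h)
      After-pad {τ} {a} d (exited w φ h) = exited w φ (begin
        a * 2 ^ d             ≤⟨ *-monoˡ-≤ (2 ^ d) h ⟩
        w * 2 ^ τ * 2 ^ d     ≡⟨ *-assoc w (2 ^ τ) (2 ^ d) ⟩
        w * (2 ^ τ * 2 ^ d)   ≡⟨ cong (w *_) (^-distribˡ-+-* 2 τ d) ⟨
        w * 2 ^ (τ + d)       ∎)
        where open ≤-Reasoning

    mutual
      Hit-weaken : ∀ {Ψ : Post k} → (∀ b ts w → Φ b ts w → Ψ b ts w) →
                   ∀ {τ a s ts} → Hit F Φ τ a s ts → Hit F Ψ τ a s ts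
      Hit-weaken imp (next w h f) = next w h (λ c → After-weaken imp (f c))

      After-weaken : ∀ {Ψ : Post k} → (∀ b ts w → Φ b ts w → Ψ b ts w) →
                     ∀ {τ a x} → After F Φ τ a x → After F Ψ τ a x
      After-weaken imp (running h)    = running (Hit-weaken imp h)
      After-weaken imp (exited w φ h) = exited w (imp _ _ _ φ) h

    -- If w is the 0/1 payoff of one trial and y the worth of going on after a failure, then w * x +
    -- y values failure at y and success at x + y. With x = 0 it forgets w.
    Affine : ℕ → ℕ → Post k
    Affine x y b ts v = ∃[ w ] Φ b ts w × v ≡ w * x + y

    mutual
      Hit-affine : ∀ x y {τ a s ts} → Hit F Φ τ a s ts → Hit F (Affine x y) τ (a * x + 2 ^ τ * y) s ts
      Hit-affine x y {suc τ} {a} (next w h f) = next (λ c → w c * x + 2 ^ τ * y) (begin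
        a * x + 2 ^ suc τ * y
          ≤⟨ +-monoˡ-≤ _ (*-monoˡ-≤ x h) ⟩
        (w false + w true) * x + 2 ^ suc τ * y
          ≡⟨ cong₂ _+_ (*-distribʳ-+ x (w false) (w true)) (trans (cong (_* y) (2*≡+ (2 ^ τ)))
            (*-distribʳ-+ y (2 ^ τ) (2 ^ τ))) ⟩
        (w false * x + w true * x) + (2 ^ τ * y + 2 ^ τ * y)
          ≡⟨ +-swap (w false * x) (w true * x) (2 ^ τ * y) (2 ^ τ * y) ⟩
        (w false * x + 2 ^ τ * y) + (w true * x + 2 ^ τ * y) ∎)
        (λ c → After-affine x y (f c))
        where
        open ≤-Reasoning
        2*≡+ : ∀ n → 2 * n ≡ n + n
        2*≡+ n = cong (n +_) (+-identityʳ n)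
        +-swap : ∀ p q r s → (p + q) + (r + s) ≡ (p + r) + (q + s)
        +-swap p q r s = trans (+-assoc p q _) (trans (cong (p +_) (trans (sym (+-assoc q r s))
          (trans (cong (_+ s) (+-comm q r)) (+-assoc r q s)))) (sym (+-assoc p r _)))

      After-affine : ∀ x y {τ a z} → After F Φ τ a z → After F (Affine x y) τ (a * x + 2 ^ τ * y) z
      After-affine x y (running h)                = running (Hit-affine x y h)
      After-affine x y {τ} {a} (exited w φ h) = exited (w * x + y) (w , φ , refl) (begin
        a * x + 2 ^ τ * y           ≤⟨ +-monoˡ-≤ _ (*-monoˡ-≤ x h) ⟩
        w * 2 ^ τ * x + 2 ^ τ * y   ≡⟨ cong₂ _+_ (trans (*-assoc w _ x)
          (trans (cong (w *_) (*-comm (2 ^ τ) x)) (sym (*-assoc w x _)))) (*-comm (2 ^ τ) y) ⟩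
        w * x * 2 ^ τ + y * 2 ^ τ   ≡⟨ *-distribʳ-+ (2 ^ τ) (w * x) y ⟨
        (w * x + y) * 2 ^ τ         ∎)
        where open ≤-Reasoning

  module _ {k Q} {F : Frag k Q} {Φ : Post k} where
    mutual
      -- Follows the run in which every coin is `false`. It extracts tapes satisfying the
      -- postcondition, for arguments that need some state in which an invariant holds.
      exit-exists : ∀ {τ a s ts} → Hit F Φ τ a s ts → ∃[ b ] ∃[ ts′ ] ∃[ w ] Φ b ts′ w
      exit-exists (next _ _ f) = exit-exists′ (f false)

      exit-exists′ : ∀ {τ a x} → After F Φ τ a x → ∃[ b ] ∃[ ts′ ] ∃[ w ] Φ b ts′ w
      exit-exists′ (running h)    = exit-exists h
      exit-exists′ (exited w φ _) = _ , _ , w , φ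

  -- A fragment F occurring inside G, its exits being connected by `route`.
  module Glue {k Q} {F G : Frag k Q} (emb : State F → State G) (route : Bool → State G ⊎ Bool)
              (agree : ∀ s → code G (emb s) ≡ mapI [ inj₁ ∘ emb , route ] (code F s))
              {Φ Ψ : Post k} {ρ : ℕ}
              (continue : ∀ b ts w → Φ b ts w → After G Ψ ρ w (route b , ts)) where
    mutual
      glue : ∀ {τ a s ts} → Hit F Φ τ a s ts → Hit G Ψ (τ + ρ) a (emb s) ts
      glue {s = s} {ts} (next w h f) = next w h λ c →
        subst (After G Ψ _ _)
          (sym (trans (cong (λ i → step i c ts) (agree s)) (step-mapI _ (code F s) c ts)))
          (glueA (f c))

      glueA : ∀ {τ a x} → After F Φ τ a x → After G Ψ (τ + ρ) a (map₁ [ inj₁ ∘ emb , route ] x)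
      glueA (running h)                   = running (glue h)
      glueA {τ} (exited {b = b} {ts} w φ h) = After-lower h
        (subst (λ t → After G Ψ t (w * 2 ^ τ) (route b , ts)) (+-comm ρ τ) (After-pad τ (continue b ts w φ)))

  Surely : ∀ {k} → (Bool → Vec Tape k → Set) → Post k
  Surely Φ b ts _ = Φ b ts

  -- With expected payoff 0 the inequalities are void, and what remains of `Hit` is that every run
  -- exits in time with Φ.
  Reach : ∀ {k Q} (F : Frag k Q) → (Bool → Vec Tape k → Set) → ℕ → Vec Tape k → Set
  Reach F Φ τ ts = Hit F (Surely Φ) τ 0 (start F) ts

  Const : ∀ {k} → (Bool → Vec Tape k → Set) → ℕ → Post k
  Const Φ y b ts w = Φ b ts × w ≡ y

  -- A sure exit can be assigned any payoff, in particular the worth of whatever is run next; this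
  -- is how deterministic fragments precede probabilistic ones.
  Reach-const : ∀ {k Q} {F : Frag k Q} {Φ τ s ts} y → Hit F (Surely Φ) τ 0 s ts →
                Hit F (Const Φ y) τ (2 ^ τ * y) s ts
  Reach-const {F = F} {Φ} y h =
    Hit-weaken (λ { b ts v (w , φ , eq) → φ , trans eq (cong (_+ y) (*-zeroʳ w)) }) (Hit-affine 0 y h)

  Runs : ∀ {k Q} (F : Frag k Q) → Vec Tape k → ℕ → Bool → Vec Tape k → Set
  Runs F ts τ b ts′ = Reach F (λ b′ ts″ → b′ ≡ b × ts″ ≡ ts′) τ ts

  still : ∀ {k Q} {F : Frag k Q} {Φ τ s ts} →
          (∀ c → After F Φ τ 0 (step (code F s) c ts)) → Hit F Φ (suc τ) 0 s ts
  still = next (const 0) z≤n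

  done : ∀ {k Q} {F : Frag k Q} {Φ τ b ts} → Φ b ts → After F (Surely Φ) τ 0 (inj₂ b , ts)
  done φ = exited 0 φ z≤n

-- Sequencing and iteration

module _ {k} {Q : Fin k → Set} where

  branch : Frag k Q → (Bool → Frag k Q) → Frag k Q
  branch F K = record
    { State  = State F ⊎ (Σ[ b ∈ Bool ] State (K b))
    ; finite = ⊎-finite (finite F) (ΣBool-finite (finite ∘ K))
    ; start  = inj₁ (start F)
    ; code   = [ (λ s → mapI [ inj₁ ∘ inj₁ , (λ b → inj₁ (inj₂ (b , start (K b)))) ] (code F s))
               , (λ (b , s) → mapI [ (λ s′ → inj₁ (inj₂ (b , s′))) , inj₂ ] (code (K b) s)) ]
    }

  infixr 4 _⨾_
  _⨾_ : Frag k Q → Frag k Q → Frag k Q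
  F ⨾ G = branch F (const G)

  -- Run F and G alternately until F exits through true or G through false.
  loop : Frag k Q → Frag k Q → Frag k Q
  loop F G = record
    { State  = State F ⊎ State G
    ; finite = ⊎-finite (finite F) (finite G)
    ; start  = inj₁ (start F)
    ; code   = [ (λ s → mapI [ inj₁ ∘ inj₁ , (λ b → if b then inj₂ true else inj₁
      (inj₂ (start G))) ] (code F s))
               , (λ s → mapI [ inj₁ ∘ inj₂ , (λ b → if b then inj₁ (inj₁ (start F)) else inj₂ false) ]
                 (code G s)) ]
    }

module Rules (answer : List Bool → Bool) where
  open Semantics answer public

  module _ {k Q} {F : Frag k Q} where

    branch-hit : ∀ {K Φ Ψ τ ρ a ts} → Hit F Φ τ a (start F) ts →
                 (∀ b ts′ w → Φ b ts′ w → Hit (K b) Ψ ρ w (start (K b)) ts′) →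
                 Hit (branch F K) Ψ (τ + ρ) a (inj₁ (start F)) ts
    branch-hit {K} h k = Glue.glue inj₁ _ (λ _ → refl)
      (λ b ts w φ → running (subst (λ t → Hit (branch F K) _ t _ _ _) (+-identityʳ _)
        (Glue.glue (λ s → inj₂ (b , s)) inj₂ (λ _ → refl) {ρ = 0}
          (λ b′ ts′ w′ ψ → exited w′ ψ (≤-reflexive (sym (*-identityʳ w′)))) (k b ts w φ)))) h

    branch-reach : ∀ {K Φ Ψ τ ρ a ts} → Reach F Φ τ ts →
                   (∀ b ts′ → Φ b ts′ → Hit (K b) Ψ ρ a (start (K b)) ts′) →
                   Hit (branch F K) Ψ (τ + ρ) (2 ^ τ * a) (inj₁ (start F)) ts
    branch-reach h k = branch-hit (Reach-const _ h) λ { b ts w (φ , refl) → k b ts φ }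

    branch-surely : ∀ {K Φ Ψ τ ρ ts} → Reach F Φ τ ts →
                    (∀ b ts′ → Φ b ts′ → Reach (K b) Ψ ρ ts′) →
                    Reach (branch F K) Ψ (τ + ρ) ts
    branch-surely {τ = τ} h k = Hit-lower z≤n (branch-reach h k)

    ⨾-surely : ∀ {G : Frag k Q} {Φ Ψ τ ρ ts} → Reach F Φ τ ts → (∀ b ts′ → Φ b ts′ → Reach G Ψ ρ ts′) →
               Reach (F ⨾ G) Ψ (τ + ρ) ts
    ⨾-surely {G} h k = branch-surely {K = const G} h k

    module _ {G : Frag k Q} where

      loop-first : ∀ {Φ Ψ τ ρ a ts} → Hit F Φ τ a (start F) ts →
        (∀ b ts′ w → Φ b ts′ w → After (loop F G) Ψ ρ w ((if b then inj₂ true else inj₁ (inj₂ (start G))) ,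
          ts′)) →
        Hit (loop F G) Ψ (τ + ρ) a (inj₁ (start F)) ts
      loop-first h k = Glue.glue inj₁ _ (λ _ → refl) k h

      loop-second : ∀ {Φ Ψ τ ρ a ts} → Hit G Φ τ a (start G) ts →
        (∀ b ts′ w → Φ b ts′ w → After (loop F G) Ψ ρ w ((if b then inj₁ (inj₁ (start F)) else inj₂ false) ,
          ts′)) →
        Hit (loop F G) Ψ (τ + ρ) a (inj₂ (start G)) ts
      loop-second h k = Glue.glue inj₂ _ (λ _ → refl) k h

      loop-first-surely : ∀ {Φ Ψ τ ρ ts} → Reach F Φ τ ts →
        (∀ b ts′ → Φ b ts′ → After (loop F G) Ψ ρ 0 ((if b then inj₂ true else inj₁ (inj₂ (start G))) ,
          ts′)) →
        Hit (loop F G) Ψ (τ + ρ) 0 (inj₁ (start F)) ts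
      loop-first-surely h k = Hit-lower z≤n (loop-first (Reach-const 0 h) λ { b ts w (φ , refl) → k b ts φ })

      loop-second-surely : ∀ {Φ Ψ τ ρ ts} → Reach G Φ τ ts →
        (∀ b ts′ → Φ b ts′ → After (loop F G) Ψ ρ 0 ((if b then inj₁ (inj₁ (start F)) else inj₂ false) ,
          ts′)) →
        Hit (loop F G) Ψ (τ + ρ) 0 (inj₂ (start G)) ts
      loop-second-surely h k = Hit-lower z≤n (loop-second (Reach-const 0 h) λ { b ts w (φ , refl) →
        k b ts φ })

  Reach-≤ : ∀ {k Q} {F : Frag k Q} {Φ τ τ′ s ts} → τ ≤ τ′ →
            Hit F (Surely Φ) τ 0 s ts → Hit F (Surely Φ) τ′ 0 s ts
  Reach-≤ {τ = τ} le h with m≤n⇒∃[o]m+o≡n le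
  ... | d , refl = Hit-pad d h

Silent : ∀ {k} → Fin k → Set
Silent _ = ⊥

-- Fragments on a few of the tapes of a machine whose tapes have names.
module Named {K : ℕ} {Ix : Set} (pos : Ix → Fin K) (name : Fin K → Ix)
             (name-pos : ∀ i → name (pos i) ≡ i) (_≟_ : DecidableEquality Ix) where

  record Focus (k : ℕ) : Set where
    field
      ι       : Fin k → Ix
      ι⁻¹     : Ix → Maybe (Fin k)
      retract : ∀ j → ι⁻¹ (ι j) ≡ just j
      section : ∀ i j → ι⁻¹ i ≡ just j → i ≡ ι j
  open Focus public

  find : ∀ {k} → Vec Ix k → Ix → Maybe (Fin k)
  find []       i = nothing
  find (n ∷ ns) i = if does (n ≟ i) then just zero else Maybe.map suc (find ns i)

  -- A boolean equation instead of a negation, so that `refl` proves it for concrete names.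
  Apart : Ix → Ix → Set
  Apart m n = does (m ≟ n) ≡ false

  find-lookup : ∀ {k} {ns : Vec Ix k} → AllPairs Apart ns → ∀ j → find ns (lookup ns j) ≡ just j
  find-lookup {ns = n ∷ ns} (a ∷ as) zero with n ≟ n
  ... | yes _  = refl
  ... | no n≢n with () ← n≢n refl
  find-lookup {ns = n ∷ ns} (a ∷ as) (suc j)
    rewrite All.lookup a (∈-lookup j ns) | find-lookup as j = refl

  lookup-find : ∀ {k} (ns : Vec Ix k) i j → find ns i ≡ just j → i ≡ lookup ns j
  lookup-find (n ∷ ns) i j eq with n ≟ i
  lookup-find (n ∷ ns) i .zero refl | yes n≡i = sym n≡i
  ... | no _ with find ns i in eq′
  lookup-find (n ∷ ns) i .(suc k) refl | no _ | just k = lookup-find ns i k eq′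

  names : ∀ {k} (ns : Vec Ix k) → AllPairs Apart ns → Focus k
  names ns apart = record
    { ι = lookup ns ; ι⁻¹ = find ns ; retract = find-lookup apart ; section = lookup-find ns }

  Agrees : Vec Tape K → (Ix → Tape) → Set
  Agrees T S = ∀ i → lookup T (pos i) ≡ S i

  module _ {k : ℕ} (Fo : Focus k) where

    override : Vec Tape k → (Ix → Tape) → Ix → Tape
    override ts S i = maybe′ (lookup ts) (S i) (ι⁻¹ Fo i)

    override-ι : ∀ ts S j → override ts S (ι Fo j) ≡ lookup ts j
    override-ι ts S j = cong (maybe′ (lookup ts) (S (ι Fo j))) (retract Fo j)

    override-self : ∀ {ts S} → (∀ j → S (ι Fo j) ≡ lookup ts j) → ∀ i → S i ≡ override ts S i
    override-self eq i with ι⁻¹ Fo i in e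
    ... | nothing = refl
    ... | just j  = trans (cong _ (section Fo i j e)) (eq j)

    module _ {Q : Fin k → Set} {Q′ : Fin K → Set} (allow : ∀ j → Q j → Q′ (pos (ι Fo j))) where

      liftI : ∀ {S} → Instr k Q S → Instr K Q′ S
      liftI (act δ)     = act λ ss →
        let q , as = δ (tabulate λ j → lookup ss (pos (ι Fo j)))
        in q , tabulate λ p → maybe′ (lookup as) nothing (ι⁻¹ Fo (name p))
      liftI (ask j q f) = ask (pos (ι Fo j)) (allow j q) f
      liftI (flip f)    = flip f

      lift : Frag k Q → Frag K Q′
      lift F = record { State = State F ; finite = finite F ; start = start F ; code = liftI ∘ code F }

      module _ (answer : List Bool → Bool) where
        open Semantics answer

        private
          scans : ∀ {T ts S} → Agrees T (override ts S) →
                  tabulate (λ j → lookup (Vec.map scan T) (pos (ι Fo j))) ≡ Vec.map scan ts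
          scans {T} {ts} {S} ag = trans (tabulate-cong λ j → trans (lookup-map (pos (ι Fo j)) scan T)
            (trans (cong scan (trans (ag (ι Fo j)) (override-ι ts S j))) (sym (lookup-map j scan ts))))
            (tabulate∘lookup (Vec.map scan ts))

          spread : Vec (Maybe (Symbol × Move)) k → Fin K → Maybe (Symbol × Move)
          spread as p = maybe′ (lookup as) nothing (ι⁻¹ Fo (name p))

          acts : ∀ as {T ts S} → Agrees T (override ts S) →
                 Agrees (Vec.zipWith update (tabulate (spread as)) T) (override (Vec.zipWith update as ts) S)
          acts as {T} {ts} ag i
            rewrite lookup-zipWith update (pos i) (tabulate (spread as)) T
                  | lookup∘tabulate (spread as) (pos i) | name-pos i | ag i with ι⁻¹ Fo i
          ... | nothing = refl
          ... | just j  = sym (lookup-zipWith update j as ts)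

        step-lift : ∀ {A} (i : Instr k Q A) c {T ts S} → Agrees T (override ts S) →
          proj₁ (step (liftI i) c T) ≡ proj₁ (step i c ts) ×
          Agrees (proj₂ (step (liftI i) c T)) (override (proj₂ (step i c ts)) S)
        step-lift (act δ) c {T} {ts} {S} ag rewrite scans {T} {ts} {S} ag =
          refl , acts (proj₂ (δ (Vec.map scan ts))) ag
        step-lift (ask j q f) c {T} {ts} {S} ag =
          cong (f ∘ answer ∘ contents) (trans (ag (ι Fo j)) (override-ι ts S j)) , ag
        step-lift (flip f) c ag = refl , ag

        -- The frame condition: outside the focus every tape is still as in S.
        Framed : Post k → (Ix → Tape) → Post K
        Framed Φ S b T w = ∃[ ts ] Φ b ts w × Agrees T (override ts S)

        module _ {F : Frag k Q} {Φ : Post k} {S : Ix → Tape} where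
          mutual
            lift-hit′ : ∀ {τ a s ts T} → Hit F Φ τ a s ts → Agrees T (override ts S) →
                        Hit (lift F) (Framed Φ S) τ a s T
            lift-hit′ {s = s} (next w le f) ag = next w le λ c →
              let eq , ag′ = step-lift (code F s) c ag in
              lift-after (f c) eq ag′

            lift-after : ∀ {τ a x y} → After F Φ τ a x → proj₁ y ≡ proj₁ x →
                         Agrees (proj₂ y) (override (proj₂ x) S) → After (lift F) (Framed Φ S) τ a y
            lift-after (running h)     refl ag = running (lift-hit′ h ag)
            lift-after (exited w φ le) refl ag = exited w (_ , φ , ag) le

          lift-hit : ∀ {τ a s ts T} → Hit F Φ τ a s ts → Agrees T S →
                     (∀ j → S (ι Fo j) ≡ lookup ts j) → Hit (lift F) (Framed Φ S) τ a s T
          lift-hit {ts = ts} h ag eq = lift-hit′ h (λ i → trans (ag i) (override-self {ts} eq i))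

-- Counting accepting coin sequences

accepts : Maybe Bool → Bool
accepts (just true) = true
accepts _           = false

count-const : ∀ T b → count {T} (const b) ≡ (if b then 1 else 0) * 2 ^ T
count-const zero    true  = refl
count-const zero    false = refl
count-const (suc T) true  rewrite count-const T true | +-identityʳ (2 ^ T) = sym (+-identityʳ _)
count-const (suc T) false = cong₂ _+_ (count-const T false) (count-const T false)

count-cong : ∀ {T} {f g : Vec Bool T → Bool} → (∀ c → f c ≡ g c) → count f ≡ count g
count-cong {zero}  eq rewrite eq [] = refl
count-cong {suc T} eq = cong₂ _+_ (count-cong (eq ∘ (false ∷_))) (count-cong (eq ∘ (true ∷_)))

module Verdicts {i} (M : Machine i) (answer : List Bool → Bool) where
  open Machine M using (program)
  open Execution M answer

  verdictAt : Configuration → Maybe Bool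
  verdictAt c = haltVerdict (program (proj₁ c))

  run-halted : ∀ {T q v} ts → program q ≡ halt v → (coins : Vec Bool T) → run coins (q , ts) ≡ (q , ts)
  run-halted ts eq []                     = refl
  run-halted ts eq (c ∷ coins) rewrite eq = run-halted ts eq coins

-- Compilation to Turing machines

-- A machine cannot leave a tape alone; it can only rewrite the scanned symbol and stay. On the
-- representation by lists this is the identity only if no list ends with a blank: otherwise `_∷ᵇ_`
-- might shorten it. Hence normality has to be carried through compiled runs.
data NoTrailingBlank : List Symbol → Set where
  []   : NoTrailingBlank []
  bit  : ∀ {b w} → NoTrailingBlank w → NoTrailingBlank (just b ∷ w)
  skip : ∀ {s w} → NoTrailingBlank (s ∷ w) → NoTrailingBlank (nothing ∷ s ∷ w)

Normal : Tape → Set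
Normal (tape l r) = NoTrailingBlank l × NoTrailingBlank r

∷ᵇ-normal : ∀ s {w} → NoTrailingBlank w → NoTrailingBlank (s ∷ᵇ w)
∷ᵇ-normal (just b) n            = bit n
∷ᵇ-normal nothing  {[]}    n    = []
∷ᵇ-normal nothing  {s ∷ w} n    = skip n

rest-normal : ∀ {w} → NoTrailingBlank w → NoTrailingBlank (rest w)
rest-normal []       = []
rest-normal (bit n)  = n
rest-normal (skip n) = n

first-rest : ∀ {w} → NoTrailingBlank w → first w ∷ᵇ rest w ≡ w
first-rest []       = refl
first-rest (bit n)  = refl
first-rest (skip n) = refl

write-scan : ∀ {t} → Normal t → write (scan t) t ≡ t
write-scan {tape l r} (_ , n) = cong (tape l) (first-rest n)

write-normal : ∀ s {t} → Normal t → Normal (write s t)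
write-normal s (m , n) = m , ∷ᵇ-normal s (rest-normal n)

move-normal : ∀ d {t} → Normal t → Normal (move d t)
move-normal left  {tape l r} (m , n) = rest-normal m , ∷ᵇ-normal (first l) n
move-normal stay             n       = n
move-normal right {tape l r} (m , n) = ∷ᵇ-normal (first r) m , rest-normal n

update-normal : ∀ a {t} → Normal t → Normal (update a t)
update-normal nothing        n = n
update-normal (just (s , d)) n = move-normal d (write-normal s n)

bits-normal : ∀ w → NoTrailingBlank (List.map just w)
bits-normal []      = []
bits-normal (b ∷ w) = bit (bits-normal w)

fill : Maybe (Symbol × Move) → Symbol → Symbol × Move
fill nothing  s = s , stay
fill (just a) s = a

updates-normal : ∀ {k} (as : Vec _ k) {ts} → All Normal ts → All Normal (Vec.zipWith update as ts)
updates-normal []       []       = []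
updates-normal (a ∷ as) (n ∷ ns) = update-normal a n ∷ updates-normal as ns

IsQuery : ∀ {k} → Fin (suc k) → Set
IsQuery p = p ≡ zero

module _ {i work : ℕ} where

  translate : ∀ {S} → Instr (2 + (i + work)) IsQuery S → Instruction S (2 + (i + work))
  translate (act δ)     = act λ ss → let q , as = δ ss in q , Vec.zipWith fill as ss
  translate (ask _ _ f) = ask f
  translate (flip f)    = flip f

  compile : Frag (2 + (i + work)) IsQuery → Machine i
  compile F = record
    { work    = work
    ; State   = State F ⊎ Bool
    ; finite  = ⊎-finite (finite F) Bool-finite
    ; start   = inj₁ (start F)
    ; program = [ translate ∘ code F , halt ]
    }

  module _ (F : Frag (2 + (i + work)) IsQuery) (answer : List Bool → Bool) where
    open Semantics answer
    open Execution (compile F) answer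
    open Verdicts (compile F) answer

    fill-update : ∀ {k} (as : Vec _ k) {ts} → All Normal ts →
      applyActions (Vec.zipWith fill as (Vec.map scan ts)) ts ≡ Vec.zipWith update as ts
    fill-update []              []       = refl
    fill-update (nothing ∷ as)  (n ∷ ns) = cong₂ _∷_ (write-scan n) (fill-update as ns)
    fill-update (just a ∷ as)   (n ∷ ns) = cong₂ _∷_ refl (fill-update as ns)

    execute-translate : ∀ (i : Instr _ IsQuery _) c q {ts} → All Normal ts →
      execute (translate i) c (q , ts) ≡ step i c ts × All Normal (proj₂ (step i c ts))
    execute-translate (act δ) c q {ts} n =
      let as = proj₂ (δ (Vec.map scan ts)) in
      cong (proj₁ (δ (Vec.map scan ts)) ,_) (fill-update as n) , updates-normal as n
    execute-translate (ask .zero refl f) c q {t ∷ ts} n = refl , n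
    execute-translate (flip f) c q n = refl , n

    Halts : Set → Configuration → ℕ → ℕ → Set
    Halts Yes x τ a =
      (∀ (coins : Vec Bool τ) → ∃[ b ] verdictAt (run coins x) ≡ just b × (b ≡ true → Yes)) ×
      a ≤ count (λ (coins : Vec Bool τ) → accepts (verdictAt (run coins x)))

    module _ {Yes : Set} where
      mutual
        -- `count` sums over the first coin just as `next` does, and a halted configuration no
        -- longer changes, so that at an exit all remaining coin sequences give the same verdict.
        hit-halts : ∀ {τ a s ts} → Hit F (Verdict Yes) τ a s ts → All Normal ts →
                    Halts Yes (inj₁ s , ts) τ a
        hit-halts {s = s} {ts} (next w le f) n =
          (λ { (c ∷ coins) → proj₁ (sub c) coins })
          , ≤-trans le (+-mono-≤ (proj₂ (sub false)) (proj₂ (sub true)))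
          where
          sub : ∀ c → Halts Yes (execute (translate (code F s)) c (inj₁ s , ts)) _ (w c)
          sub c with execute-translate (code F s) c (inj₁ s) n
          ... | eq , n′ = subst (λ x → Halts Yes x _ (w c)) (sym eq) (after-halts (f c) n′)

        after-halts : ∀ {τ a x} → After F (Verdict Yes) τ a x → All Normal (proj₂ x) →
                      Halts Yes x τ a
        after-halts (running h) n = hit-halts h n
        after-halts {τ} {a} (exited {b = b} {ts = ts} w φ le) n =
          (λ coins → b , cong verdictAt (run-halted {q = inj₂ b} ts refl coins) , sound b φ)
          , (begin
               a ≤⟨ le ⟩
               w * 2 ^ τ ≤⟨ bound b φ ⟩
               count {τ} (const (accepts (just b))) ≡⟨ count-cong {τ} (λ coins → cong (accepts ∘ verdictAt)
                 (sym (run-halted {q = inj₂ b} ts refl coins))) ⟩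
               count {τ} (λ coins → accepts (verdictAt (run coins (inj₂ b , ts)))) ∎)
          where
          open ≤-Reasoning
          sound : ∀ b → Verdict Yes b ts w → b ≡ true → Yes
          sound true (y , _) _ = y
          bound : ∀ b → Verdict Yes b ts w → w * 2 ^ τ ≤ count {τ} (const (accepts (just b)))
          bound true (_ , w≤1) = ≤-trans (*-monoˡ-≤ (2 ^ τ) w≤1) (≤-reflexive (sym (count-const τ true)))
          bound false refl = z≤n

module _ {work : ℕ} (F : Frag (2 + (1 + work)) IsQuery) (I : Instance) where
  open Instance I
  open Semantics (answerQuery size oracle)

  initialTapes : Vec Tape (2 + (1 + work))
  initialTapes = load [] ∷ load [] ∷ load encoding ∷ Vec.replicate work (load [])

  initialTapes-normal : All Normal initialTapes
  initialTapes-normal = ([] , []) ∷ ([] , []) ∷ ([] , bits-normal encoding) ∷ blanks-normal work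
    where
    blanks-normal : ∀ n → All Normal (Vec.replicate n (load []))
    blanks-normal zero    = []
    blanks-normal (suc n) = ([] , []) ∷ blanks-normal n

  -- Halting and soundness follow from a derivation with any numerator, so the first hypothesis
  -- leaves it open; a large numerator is only demanded of yes-instances.
  compile-decides : ∀ {T} → (∃[ a ] Hit F (Verdict (IsYes I)) T a (start F) initialTapes) →
    (IsYes I → ∃[ a ] Hit F (Verdict (IsYes I)) T a (start F) initialTapes × 2 ^ T ≤ 2 * a) →
    Decision.CorrectWithin I (compile {1} {work} F) T
  compile-decides {T} (_ , hit) likely = always , yes-case , no-case
    where
    open Decision I (compile {1} {work} F)
    open On I (compile {1} {work} F)
    halts : ∀ {a} → Hit F (Verdict (IsYes I)) T a (start F) initialTapes → Halts {1} {work} F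
      (answerQuery size oracle) (IsYes I) (inj₁ (start F) , initialTapes) T a
    halts h = hit-halts {1} {work} F (answerQuery size oracle) h initialTapes-normal
    always : ∀ (coins : Vec Bool T) → ∃[ b ] Answers b coins
    always coins = let b , eq , _ = proj₁ (halts hit) coins in b , eq
    no-case : IsNo I → ∀ (coins : Vec Bool T) → Answers false coins
    no-case absent coins with proj₁ (halts hit) coins
    ... | false , eq , _   = eq
    ... | true  , eq , found = ⊥-elim (absent (found refl))
    accepts-just : ∀ v → accepts v ≡ true → v ≡ just true
    accepts-just (just true) _ = refl
    yes-case : IsYes I → Pr≥½ λ (coins : Vec Bool T) → Answers true coins
    yes-case y = let a , h , le = likely y in
      (λ coins → accepts (verdict (encoding ∷ []) coins)) , (λ coins → accepts-just _) ,
      ≤-trans le (*-monoʳ-≤ 2 (proj₂ (halts h)))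

-- Tapes of bits and shadows of tapes

bits : List Bool → List Bool → Tape
bits l r = tape (List.map just l) (List.map just r)

tail : List Bool → List Bool
tail []      = []
tail (_ ∷ w) = w

rest-bits : ∀ w → rest (List.map just w) ≡ List.map just (tail w)
rest-bits []      = refl
rest-bits (b ∷ w) = refl

rest-∷ᵇ : ∀ s w → rest (s ∷ᵇ w) ≡ w
rest-∷ᵇ (just b) w       = refl
rest-∷ᵇ nothing  []      = refl
rest-∷ᵇ nothing  (s ∷ w) = refl

length-∷ᵇ : ∀ s w → length (s ∷ᵇ w) ≤ suc (length w)
length-∷ᵇ (just b) w       = ≤-refl
length-∷ᵇ nothing  []      = z≤n
length-∷ᵇ nothing  (s ∷ w) = ≤-refl

length-rest : ∀ (u : List Symbol) (w : List Bool) → length u ≤ length w → length (rest u) ≤ length (tail w)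
length-rest []      w       le       = z≤n
length-rest (_ ∷ u) (_ ∷ w) (s≤s le) = le

length-tail : ∀ (w : List Bool) → length (tail w) ≤ length w
length-tail []      = z≤n
length-tail (_ ∷ w) = n≤1+n _

length≤rest : ∀ (u : List Symbol) → length u ≤ suc (length (rest u))
length≤rest []      = z≤n
length≤rest (_ ∷ u) = ≤-refl

-- The second tape, a shadow of the first one, has marked all the cells the
-- head of the first one has ever scanned, except perhaps the current one.
record Shadowed (n : ℕ) (t t′ : Tape) : Set where
  field
    l r     : List Bool
    before≡ : Tape.before t′ ≡ List.map just l
    after≡  : rest (Tape.after t′) ≡ List.map just r
    before≤ : length (Tape.before t) ≤ length l
    after≤  : length (rest (Tape.after t)) ≤ length r
    total≤  : length l + length r ≤ n

-- The marks form one block without gaps that contains the head and covers all listed cells of t,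
-- whatever blanks occur among them. So scanning the shadow finds both ends, and n bounds the work
-- of cleaning.
record Marked (n : ℕ) (t t′ : Tape) : Set where
  field
    l r     : List Bool
    shadow≡ : t′ ≡ bits l r
    before≤ : length (Tape.before t) ≤ length l
    after≤  : length (Tape.after t) ≤ length r
    total≤  : length l + length r ≤ n

-- The cells of an input are not blank although no head has visited them, so the shadow has to start
-- as a copy of the input.
shadowed-load : ∀ {n} w → length w ≤ n → Shadowed n (load w) (load w)
shadowed-load w le = record
  { l = [] ; r = tail w ; before≡ = refl ; after≡ = rest-bits w ; before≤ = z≤n
  ; after≤ = ≤-reflexive (trans (cong length (rest-bits w)) (length-map just (tail w)))
  ; total≤ = ≤-trans (length-tail w) le }

shadowed-≤ : ∀ {m n t t′} → m ≤ n → Shadowed m t t′ → Shadowed n t t′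
shadowed-≤ le s = record { Shadowed s ; total≤ = ≤-trans (Shadowed.total≤ s) le }

-- Marks the cell under the head, the only one about which `Shadowed` says nothing; a called machine
-- does this on halting.
mark : ∀ {n t t′} → Shadowed n t t′ → Marked (suc n) t (write (just true) t′)
mark {t = tape _ u} {tape _ _} s = record
  { l = l ; r = true ∷ r ; shadow≡ = cong₂ tape before≡ (cong (just true ∷_) after≡)
  ; before≤ = before≤ ; after≤ = ≤-trans (length≤rest u) (s≤s after≤)
  ; total≤ = ≤-trans (≤-reflexive (+-suc (length l) (length r))) (s≤s total≤) }
  where open Shadowed s

-- The mark is written before the two heads move alike, so the block of marks stays contiguous and
-- gains at most one cell.
shadow-act : ∀ {n t t′} s d → Shadowed n t t′ →
             Shadowed (suc n) (move d (write s t)) (move d (write (just true) t′))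
shadow-act {n} {tape u v} {tape u′ v′} s stay sh = record
  { l = l ; r = r ; before≡ = before≡ ; after≡ = after≡ ; before≤ = before≤
  ; after≤ = ≤-trans (≤-reflexive (cong length (rest-∷ᵇ s (rest v)))) after≤
  ; total≤ = m≤n⇒m≤1+n total≤ }
  where open Shadowed sh
shadow-act {n} {tape u v} {tape u′ v′} s right sh = record
  { l = true ∷ l ; r = tail r ; before≡ = cong (just true ∷_) before≡
  ; after≡ = trans (cong rest after≡) (rest-bits r)
  ; before≤ = ≤-trans (length-∷ᵇ (first (s ∷ᵇ rest v)) u) (s≤s before≤)
  ; after≤ = ≤-trans (≤-reflexive (cong (length ∘ rest) (rest-∷ᵇ s (rest v)))) (length-rest (rest v) r after≤)
  ; total≤ = s≤s (≤-trans (+-monoʳ-≤ (length l) (length-tail r)) total≤) }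
  where open Shadowed sh
shadow-act {n} {tape u v} {tape u′ v′} s left sh = record
  { l = tail l ; r = true ∷ r ; before≡ = trans (cong rest before≡) (rest-bits l)
  ; after≡ = trans (rest-∷ᵇ (first u′) (just true ∷ rest v′)) (cong (just true ∷_) after≡)
  ; before≤ = length-rest u l before≤
  ; after≤ = ≤-trans (≤-reflexive (cong length (rest-∷ᵇ (first u) (s ∷ᵇ rest v))))
               (≤-trans (length-∷ᵇ s (rest v)) (s≤s after≤))
  ; total≤ = ≤-trans (≤-reflexive (+-suc (length (tail l)) (length r)))
               (s≤s (≤-trans (+-monoˡ-≤ (length r) (length-tail l)) total≤)) }
  where open Shadowed sh

-- Calling a machine

module Calling {i : ℕ} (M : Machine i) where
  open Machine M renaming (State to StateM; finite to finiteM; start to startM)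

  k : ℕ
  k = 2 + (i + work)

  trace : Symbol × Move → Maybe (Symbol × Move)
  trace (_ , d) = just (just true , d)

  module _ {Q : Fin (k + k) → Set} (allow : Q zero) where

    -- Runs M on the first k tapes and marks the visited cells on the last k.
    callI : Instruction StateM k → Instr (k + k) Q (StateM ⊎ Bool)
    callI (halt b) = act λ _ → inj₂ b , Vec.replicate k nothing Vec.++ Vec.replicate k (just (just true ,
      stay))
    callI (act δ)  = act λ ss → let q , as = δ (Vec.take k ss) in
                       inj₁ q , Vec.map just as Vec.++ Vec.map trace as
    callI (ask f)  = ask zero allow (inj₁ ∘ f)
    callI (flip f) = flip (inj₁ ∘ f)

    call : Frag (k + k) Q
    call = record { State = StateM ; finite = finiteM ; start = startM ; code = callI ∘ program }

    module _ (answer : List Bool → Bool) where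
      open Semantics answer
      open Verdicts M answer
      private module E = Execution M answer

      Covered : ℕ → Vec Tape k → Vec Tape k → Set
      Covered n a b = ∀ j → Shadowed n (lookup a j) (lookup b j)

      take-scan : ∀ {m} (a b : Vec Tape m) → Vec.take m (Vec.map scan (a Vec.++ b)) ≡ Vec.map scan a
      take-scan {m} a b = trans (cong (Vec.take m) (map-++ scan a b)) (take-++ a)
        where
        take-++ : ∀ {m n} (a : Vec Tape m) {b : Vec Symbol n} → Vec.take m (Vec.map scan a Vec.++ b)
          ≡ Vec.map scan a
        take-++ []      = refl
        take-++ (x ∷ a) = cong (_ ∷_) (take-++ a)

      apply-just : ∀ {m} (as : Vec _ m) a → Vec.zipWith update (Vec.map just as) a ≡ E.applyActions as a
      apply-just []       []      = refl
      apply-just (x ∷ as) (t ∷ a) = cong (_ ∷_) (apply-just as a)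

      apply-nothing : ∀ {m} (a : Vec Tape m) → Vec.zipWith update (Vec.replicate m nothing) a ≡ a
      apply-nothing []      = refl
      apply-nothing (t ∷ a) = cong (t ∷_) (apply-nothing a)

      shadow-acts : ∀ {n m} (as : Vec _ m) {a b} → (∀ j → Shadowed n (lookup a j) (lookup b j)) →
        ∀ j → Shadowed (suc n) (lookup (E.applyActions as a) j)
          (lookup (Vec.zipWith update (Vec.map trace as) b) j)
      shadow-acts ((s , d) ∷ as) {t ∷ a} {t′ ∷ b} cov zero    = shadow-act s d (cov zero)
      shadow-acts (_ ∷ as)       {t ∷ a} {t′ ∷ b} cov (suc j) = shadow-acts as {a} {b} (cov ∘ suc) j

      marks : ∀ {n m} (a b : Vec Tape m) → (∀ j → Shadowed n (lookup a j) (lookup b j)) →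
        ∀ j → Marked (suc n) (lookup a j) (lookup (Vec.zipWith update (Vec.replicate m (just (just true ,
          stay))) b) j)
      marks (t ∷ a) (t′ ∷ b) cov zero    = mark (cov zero)
      marks (t ∷ a) (t′ ∷ b) cov (suc j) = marks a b (cov ∘ suc) j

      Called : (Bool → Vec Tape k → Set) → ℕ → Post (k + k)
      Called Final n v ts w = ∃[ a ] ∃[ b ] ts ≡ a Vec.++ b × Final v a ×
        (∀ j → Marked n (lookup a j) (lookup b j)) × w ≡ (if v then 1 else 0)

      Succeeds : (Bool → Vec Tape k → Set) → ℕ → E.Configuration → Set
      Succeeds Final T x = ∀ (coins : Vec Bool T) → ∃[ v ] verdictAt (E.run coins x) ≡ just v × Final v
        (proj₂ (E.run coins x))

      successes : ℕ → E.Configuration → ℕ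
      successes T x = count {T} (λ coins → accepts (verdictAt (E.run coins x)))

      -- Leaving the fragment costs one step more than halting does. This doubles the number of coin
      -- sequences, hence the factor 2 of the successes.
      call-hit : ∀ {Final} T {q a b n} → Covered n a b → Succeeds Final T (q , a) →
        Hit call (Called Final (suc (T + n))) (suc T) (2 * successes T (q , a)) q (a Vec.++ b)
      call-hit {Final} T {q} {a} {b} {n} cov ok = cases T cov ok (program q) refl
        where
        Goal : ℕ → ℕ → Vec Tape k → Set
        Goal T n b = Hit call (Called Final (suc (T + n))) (suc T) (2 * successes T (q , a)) q (a Vec.++ b)

        continue : ∀ {T n b} i → program q ≡ i →
          (∀ c → let q′ , a′ = E.execute i c (q , a) in
             ∃[ b′ ] step (callI i) c (a Vec.++ b) ≡ (inj₁ q′ , a′ Vec.++ b′) × Covered (suc n) a′ b′) →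
          Succeeds Final (suc T) (q , a) → Goal (suc T) n b
        continue {T} {n} {b} .(program q) refl st ok = next (λ c → 2 * successes T (E.execute (program q) c
          (q , a)))
          (≤-reflexive (*-distribˡ-+ 2 (successes T (E.execute (program q) false (q , a))) _)) rec
          where
          rec : ∀ c → After call (Called Final (suc (suc T + n))) (suc T) (2 * successes T
            (E.execute (program q) c (q , a)))
                        (step (callI (program q)) c (a Vec.++ b))
          rec c with st c
          ... | b′ , eq , cov = subst (After call _ _ _) (sym eq) (running
            (subst (λ m → Hit call (Called Final (suc m)) (suc T) (2 * successes T x) (proj₁ x)
              (proj₂ x Vec.++ b′)) (+-suc T n)
              (call-hit T {proj₁ x} {proj₂ x} {b′} cov (λ coins → ok (c ∷ coins)))))
            where x = E.execute (program q) c (q , a)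

        cases : ∀ T {n b} → Covered n a b → Succeeds Final T (q , a) → ∀ i → program q ≡ i → Goal T n b
        -- The machine has already halted, so an arbitrary coin sequence reveals the verdict and the
        -- final tapes.
        cases T {n} {b} cov ok (halt v) eq with ok (Vec.replicate T false)
        ... | v′ , eq′ , fin rewrite run-halted a eq (Vec.replicate T false) | eq with refl ← eq′ =
          next (const (successes T (q , a))) (≤-reflexive (cong (successes T (q , a) +_) (+-identityʳ _)))
            λ c →
            subst (λ i → After call _ T (successes T (q , a)) (step (callI i) c (a Vec.++ b))) (sym eq)
              (exited (if v then 1 else 0)
                (a , _ , trans (zipWith-++ update (Vec.replicate k nothing) _ a b) (cong (Vec._++ _)
                  (apply-nothing a)) , fin
                , (λ j → marked (marks a b cov j)) , refl)
                (≤-reflexive (trans (count-cong {T} λ coins → trans (cong (accepts ∘ verdictAt)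
                  (run-halted a eq coins)) (cong (accepts ∘ E.haltVerdict) eq))
                   (trans (count-const T (accepts (just v))) (cong (λ z → (if z then 1 else 0) * 2 ^ T)
                     (acc v))))))
          where
          acc : ∀ v → accepts (just v) ≡ v
          acc true  = refl
          acc false = refl
          marked : ∀ {t t′} → Marked (suc n) t t′ → Marked (suc (T + n)) t t′
          marked m = record { Marked m ; total≤ = ≤-trans (Marked.total≤ m) (s≤s (m≤n+m n T)) }
        cases zero cov ok (act δ) eq with ok []
        ... | v , eq′ , _ rewrite eq with () ← eq′
        cases zero cov ok (ask f) eq with ok []
        ... | v , eq′ , _ rewrite eq with () ← eq′
        cases zero cov ok (flip f) eq with ok []
        ... | v , eq′ , _ rewrite eq with () ← eq′
        cases (suc T) {n} {b} cov ok (act δ) eq = continue {b = b} (act δ) eq st ok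
          where
          as = proj₂ (δ (Vec.map scan a))
          st : ∀ c → _
          st c = Vec.zipWith update (Vec.map trace as) b , eq′ , shadow-acts as {a} {b} cov
            where
            eq′ : step (callI (act δ)) c (a Vec.++ b) ≡ _
            eq′ rewrite take-scan a b = cong (_ ,_) (trans (zipWith-++ update (Vec.map just as) _ a b)
                                          (cong (Vec._++ Vec.zipWith update (Vec.map trace as) b)
                                            (apply-just as a)))
        cases (suc T) {n} {b} cov ok (ask f) eq = continue {b = b} (ask f) eq
          (λ c → b , cong (λ t → inj₁ (f (answer (contents t))) , a Vec.++ b) (head-++ a) , λ j → shadowed-≤
            (n≤1+n n) (cov j)) ok
          where
          head-++ : (a : Vec Tape k) → lookup (a Vec.++ b) zero ≡ Vec.head a
          head-++ (t ∷ a) = refl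
        cases (suc T) {n} {b} cov ok (flip f) eq = continue {b = b} (flip f) eq
          (λ c → b , refl , λ j → shadowed-≤ (n≤1+n n) (cov j)) ok

-- Tape programs

coin : ∀ {k Q} → Frag k Q
coin = record { State = ⊤ ; finite = ⊤-finite ; start = tt ; code = λ _ → flip inj₂ }

exit : ∀ {k Q} → Bool → Frag k Q
exit b = record { State = ⊤ ; finite = ⊤-finite ; start = tt
                ; code = λ _ → act λ _ → inj₂ b , Vec.replicate _ nothing }

go : Symbol → Move → Maybe (Symbol × Move)
go s d = just (s , d)

-- Two copies are made, one for an input tape of a called machine and one for the shadow of that
-- tape.
copy : Frag 3 Silent
copy = record { State = Bool ; finite = Bool-finite ; start = true ; code = code′ }
  where
  forward backward : Symbol → (Bool ⊎ Bool) × Vec (Maybe (Symbol × Move)) 3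
  forward (just b)  = inj₁ true , go (just b) right ∷ go (just b) right ∷ go (just b) right ∷ []
  forward nothing   = inj₁ false , go nothing left ∷ go nothing left ∷ go nothing left ∷ []
  backward (just b) = inj₁ false , go (just b) left ∷ go (just b) left ∷ go (just b) left ∷ []
  backward nothing  = inj₂ true , go nothing right ∷ go nothing right ∷ go nothing right ∷ []
  code′ : Bool → Instr 3 Silent (Bool ⊎ Bool)
  code′ true  = act (forward ∘ Vec.head)
  code′ false = act (backward ∘ Vec.head)

-- Exits through false if the numeral had to be extended.
increments : Frag 1 Silent
increments = record { State = ⊤ ⊎ Bool ; finite = ⊎-finite ⊤-finite Bool-finite ; start = inj₁ tt ; code =
  code′ }
  where
  forward : Symbol → ((⊤ ⊎ Bool) ⊎ Bool) × Vec (Maybe (Symbol × Move)) 1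
  forward (just true)  = inj₁ (inj₁ tt) , go (just false) right ∷ []
  forward (just false) = inj₁ (inj₂ true) , go (just true) left ∷ []
  forward nothing      = inj₁ (inj₂ false) , go (just true) left ∷ []
  backward : Bool → Symbol → ((⊤ ⊎ Bool) ⊎ Bool) × Vec (Maybe (Symbol × Move)) 1
  backward b (just x) = inj₁ (inj₂ b) , go (just x) left ∷ []
  backward b nothing  = inj₂ b , go nothing right ∷ []
  code′ : ⊤ ⊎ Bool → Instr 1 Silent ((⊤ ⊎ Bool) ⊎ Bool)
  code′ (inj₁ _) = act (forward ∘ Vec.head)
  code′ (inj₂ b) = act (backward b ∘ Vec.head)

-- Only the symbol on the shadow decides what to do: go right to the end of the marks, then erase
-- both tapes leftwards until the marks end.
clean : Frag 2 Silent
clean = record { State = Bool ; finite = Bool-finite ; start = true ; code = code′ }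
  where
  rightmost erase : Symbol → Symbol → (Bool ⊎ Bool) × Vec (Maybe (Symbol × Move)) 2
  rightmost s (just b) = inj₁ true , go s right ∷ go (just b) right ∷ []
  rightmost s nothing  = inj₁ false , go s left ∷ go nothing left ∷ []
  erase s (just b) = inj₁ false , go nothing left ∷ go nothing left ∷ []
  erase s nothing  = inj₂ true , nothing ∷ nothing ∷ []
  code′ : Bool → Instr 2 Silent (Bool ⊎ Bool)
  code′ true  = act λ { (s ∷ s′ ∷ []) → rightmost s s′ }
  code′ false = act λ { (s ∷ s′ ∷ []) → erase s s′ }

-- For each cell of the first tape, writes a random bit to the other two; the
-- bit is 1 with probability 1/2 or 1/4, according to the mode.
bitOf : Bool → Bool → Bool → Bool
bitOf true  b c = b
bitOf false b c = b ∧ c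

pattern reading  = inj₁ tt
pattern tossing  = inj₂ (inj₁ tt)
pattern tossed b = inj₂ (inj₂ (inj₁ b))
pattern put b    = inj₂ (inj₂ (inj₂ (inj₁ b)))
pattern rewind   = inj₂ (inj₂ (inj₂ (inj₂ tt)))

guess : Bool → Frag 3 Silent
guess mode = record
  { State = St ; start = reading ; code = code′
  ; finite = ⊎-finite ⊤-finite (⊎-finite ⊤-finite (⊎-finite Bool-finite (⊎-finite Bool-finite ⊤-finite))) }
  where
  St = ⊤ ⊎ ⊤ ⊎ Bool ⊎ Bool ⊎ ⊤
  test : Symbol → (St ⊎ Bool) × Vec (Maybe (Symbol × Move)) 3
  test (just b) = inj₁ tossing , nothing ∷ nothing ∷ nothing ∷ []
  test nothing  = inj₁ rewind , go nothing left ∷ go nothing left ∷ go nothing left ∷ []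
  backward : Vec Symbol 3 → (St ⊎ Bool) × Vec (Maybe (Symbol × Move)) 3
  backward (just b ∷ s ∷ s′ ∷ [])  = inj₁ rewind , go (just b) left ∷ go s left ∷ go s′ left ∷ []
  backward (nothing ∷ s ∷ s′ ∷ []) = inj₂ true , go nothing right ∷ go s right ∷ go s′ right ∷ []
  code′ : St → Instr 3 Silent (St ⊎ Bool)
  code′ reading    = act (test ∘ Vec.head)
  code′ tossing    = flip λ b → inj₁ (tossed b)
  code′ (tossed b) = flip λ c → inj₁ (put (bitOf mode b c))
  code′ (put b)    = act λ ss → inj₁ reading , go (Vec.head ss) right ∷ go (just b) right ∷ go
    (just b) right ∷ []
  code′ rewind     = act backward

-- Reads one encoded string and appends a bit to each of the other two tapes,
-- or exits through true if there is no string left.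
parse : Frag 3 Silent
parse = record { State = Bool ; finite = Bool-finite ; start = true ; code = code′ }
  where
  marker : Symbol → (Bool ⊎ Bool) × Vec (Maybe (Symbol × Move)) 3
  marker (just true)  = inj₁ false , go (just true) right ∷ nothing ∷ nothing ∷ []
  marker (just false) = inj₂ false , go (just false) right ∷ go (just true) right ∷ go (just false) right ∷ []
  marker nothing      = inj₂ true , nothing ∷ nothing ∷ nothing ∷ []
  code′ : Bool → Instr 3 Silent (Bool ⊎ Bool)
  code′ true  = act (marker ∘ Vec.head)
  code′ false = act λ ss → inj₁ true , go (Vec.head ss) right ∷ nothing ∷ nothing ∷ []

-- Rewinds two tapes and prepends two bits to the contents of the second.
finish : Frag 2 Silent
finish = record { State = Fin 3 ; finite = Fin-finite 3 ; start = zero ; code = code′ }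
  where
  backward : Vec Symbol 2 → (Fin 3 ⊎ Bool) × Vec (Maybe (Symbol × Move)) 2
  backward (just b ∷ s ∷ [])  = inj₁ (suc zero) , go (just b) left ∷ go s left ∷ []
  backward (nothing ∷ s ∷ []) = inj₁ (suc (suc zero)) , go nothing right ∷ go (just false) left ∷ []
  code′ : Fin 3 → Instr 2 Silent (Fin 3 ⊎ Bool)
  code′ zero             = act λ _ → inj₁ (suc zero) , go nothing left ∷ go nothing left ∷ []
  code′ (suc zero)       = act backward
  code′ (suc (suc zero)) = act λ _ → inj₂ true , nothing ∷ go (just false) stay ∷ []

eraseBit : Frag 1 Silent
eraseBit = record { State = ⊤ ; finite = ⊤-finite ; start = tt ; code = λ _ → act (erase ∘ Vec.head) }
  where
  erase : Symbol → (⊤ ⊎ Bool) × Vec (Maybe (Symbol × Move)) 1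
  erase (just _) = inj₂ false , go nothing right ∷ []
  erase nothing  = inj₂ true , nothing ∷ []

-- Exits through true if there are fewer than q bits to erase.
eraseBits : ℕ → Frag 1 Silent
eraseBits zero    = exit false
eraseBits (suc q) = branch eraseBit λ b → if b then exit true else eraseBits q

-- Erases as many cells of the second tape as there are bits on the first.
drain : Frag 2 Silent
drain = record { State = Bool ; finite = Bool-finite ; start = true ; code = code′ }
  where
  forward backward : Symbol → (Bool ⊎ Bool) × Vec (Maybe (Symbol × Move)) 2
  forward (just b)  = inj₁ true , go (just b) right ∷ go nothing right ∷ []
  forward nothing   = inj₁ false , go nothing left ∷ nothing ∷ []
  backward (just b) = inj₁ false , go (just b) left ∷ nothing ∷ []
  backward nothing  = inj₂ true , go nothing right ∷ nothing ∷ []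
  code′ : Bool → Instr 2 Silent (Bool ⊎ Bool)
  code′ true  = act (forward ∘ Vec.head)
  code′ false = act (backward ∘ Vec.head)

-- Correctness of the tape programs

-- The time to read w bits rightwards and return, l bits having been read.
sweep : ℕ → ℕ → ℕ
sweep zero    l = 2 + l
sweep (suc w) l = suc (sweep w (suc l))

sweep≡ : ∀ w l → sweep w l ≡ 2 + (2 * w + l)
sweep≡ zero    l = refl
sweep≡ (suc w) l = trans (cong suc (sweep≡ w (suc l))) (lemma w l)
  where
  lemma : ∀ w l → suc (2 + (2 * w + suc l)) ≡ 2 + (2 * suc w + l)
  lemma = solve-∀

2+≤sweep : ∀ w l → 2 + l ≤ sweep w l
2+≤sweep w l = ≤-trans (+-monoʳ-≤ 2 (m≤n+m l (2 * w))) (≤-reflexive (sym (sweep≡ w l)))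

halve : ∀ y n → y * 2 ^ suc n ≡ y * 2 ^ n + y * 2 ^ n
halve y n = trans (cong (y *_) (cong (2 ^ n +_) (+-identityʳ _))) (*-distribˡ-+ y (2 ^ n) (2 ^ n))

hasZero : List Bool → Bool
hasZero []          = false
hasZero (false ∷ w) = true
hasZero (true ∷ w)  = hasZero w

-- This is 4 ^ n times the expected value of f at a guessed vector: two coins are tossed for each
-- bit, and of their four outcomes 2 and 2, or 3 and 1, yield the bits 0 and 1.
expect : Bool → ∀ n → (Vec Bool n → ℕ) → ℕ
expect mode zero    f = f []
expect true (suc n) f  = 2 * expect true n (f ∘ (false ∷_)) + 2 * expect true n (f ∘ (true ∷_))
expect false (suc n) f = 3 * expect false n (f ∘ (false ∷_)) + expect false n (f ∘ (true ∷_))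

expect-split : ∀ mode n (f : Vec Bool (suc n) → ℕ) x → let e = λ c → expect mode n (f ∘ (c ∷_)) in
  expect mode (suc n) f * x ≡ (e (bitOf mode false false) + e (bitOf mode false true)) * x +
                              (e (bitOf mode true false) + e (bitOf mode true true)) * x
expect-split true n f x  = lemma (expect true n (f ∘ (false ∷_))) (expect true n (f ∘ (true ∷_))) x
  where
  lemma : ∀ a b x → (2 * a + 2 * b) * x ≡ (a + a) * x + (b + b) * x
  lemma = solve-∀
expect-split false n f x = lemma (expect false n (f ∘ (false ∷_))) (expect false n (f ∘ (true ∷_))) x
  where
  lemma : ∀ a b x → (3 * a + b) * x ≡ (a + a) * x + (a + b) * x
  lemma = solve-∀

back : List Bool → List Bool → Tape
back l r = move left (bits l r)

guessTime : ℕ → ℕ → ℕ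
guessTime zero    l = 2 + l
guessTime (suc w) l = 4 + guessTime w (suc l)

-- The steps of a guess that toss no coin: two for each bit, and those for turning round and
-- rewinding.
guessSlack : ℕ → ℕ → ℕ
guessSlack zero    l = 2 + l
guessSlack (suc w) l = 2 + guessSlack w (suc l)

erase-load : ∀ w → update (go nothing right) (load w) ≡ load (drop 1 w)
erase-load []          = refl
erase-load (_ ∷ [])    = refl
erase-load (_ ∷ _ ∷ w) = refl

drop-drop₁ : ∀ n (w : List Bool) → drop n (drop 1 w) ≡ drop (suc n) w
drop-drop₁ zero    w       = refl
drop-drop₁ (suc n) []      = refl
drop-drop₁ (suc n) (b ∷ w) = refl

prefix-∷ : ∀ {v b w} → prefix v ≡ b ∷ w → ∃[ v′ ] v ≡ just b ∷ v′ × prefix v′ ≡ w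
prefix-∷ {just b ∷ v} refl = v , refl , refl

module Behaviour (answer : List Bool → Bool) where
  open Rules answer

  coin-hit : ∀ {k Q} {Φ : Post k} {ts} a b → Φ false ts a → Φ true ts b →
             Hit (coin {k} {Q}) Φ 1 (a + b) tt ts
  coin-hit {ts = ts} a b φ ψ = next (λ c → if c then b else a) ≤-refl
    λ { true  → exited b ψ (≤-reflexive (sym (*-identityʳ b)))
      ; false → exited a φ (≤-reflexive (sym (*-identityʳ a))) }

  exit-runs : ∀ {k Q} b (ts : Vec Tape k) → Runs (exit {k} {Q} b) ts 1 b ts
  exit-runs b ts = still λ _ → done (refl , idle ts)
    where
    idle : ∀ {k} (ts : Vec Tape k) → Vec.zipWith update (Vec.replicate _ nothing) ts ≡ ts
    idle []       = refl
    idle (t ∷ ts) = cong (t ∷_) (idle ts)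

  copy-runs : ∀ w → Runs copy (load w ∷ load [] ∷ load [] ∷ []) (sweep (length w) 0) true
                              (load w ∷ load w ∷ load w ∷ [])
  copy-runs w = forward w []
    where
    Copied : List Bool → Bool → Vec Tape 3 → Set
    Copied w b ts = b ≡ true × ts ≡ load w ∷ load w ∷ load w ∷ []
    backward : ∀ l r → Hit copy (Surely (Copied (l ʳ++ r))) (suc (length l)) 0 false
                           (back l r ∷ back l r ∷ back l r ∷ [])
    backward []      []      = still λ _ → done (refl , refl)
    backward []      (_ ∷ _) = still λ _ → done (refl , refl)
    backward (x ∷ l) r       = still λ _ → running (backward l (x ∷ r))
    forward : ∀ r l → Hit copy (Surely (Copied (l ʳ++ r))) (sweep (length r) (length l)) 0 true
                          (bits l r ∷ bits l [] ∷ bits l [] ∷ [])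
    forward []      l = still λ _ → running (backward l [])
    forward (b ∷ r) l = still λ _ → running (forward r (b ∷ l))

  increments-runs : ∀ w → Runs increments (load w ∷ []) (sweep (length w) 0) (hasZero w) (load (increment w)
    ∷ [])
  increments-runs w = forward w []
    where
    Result : Bool → List Bool → Bool → Vec Tape 1 → Set
    Result v w b ts = b ≡ v × ts ≡ load w ∷ []
    backward : ∀ v l r → Hit increments (Surely (Result v (l ʳ++ r))) (suc (length l)) 0 (inj₂ v)
      (back l r ∷ [])
    backward v []      []      = still λ _ → done (refl , refl)
    backward v []      (_ ∷ _) = still λ _ → done (refl , refl)
    backward v (x ∷ l) r       = still λ _ → running (backward v l (x ∷ r))
    forward : ∀ r l → Hit increments (Surely (Result (hasZero r) (l ʳ++ increment r))) (sweep (length r)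
      (length l)) 0 (inj₁ tt) (bits l r ∷ [])
    forward []          l = still λ _ → running (backward false l (true ∷ []))
    forward (true ∷ r)  l = still λ _ → running (forward r (false ∷ l))
    -- The carry ends here, before the end of the numeral; the time is padded to that of a full
    -- sweep.
    forward (false ∷ r) l = Reach-≤ (2+≤sweep (length (false ∷ r)) (length l))
                              (still λ _ → running (backward true l (true ∷ r)))

  clean-runs : ∀ {n t t′} → Marked n t t′ → Runs clean (t ∷ t′ ∷ []) (2 + 2 * n) true (load [] ∷ load [] ∷ [])
  clean-runs {n} {tape u v} m rewrite Marked.shadow≡ m =
    Reach-≤ (≤-trans (≤-reflexive (sweep≡ (length r) (length l))) (+-monoʳ-≤ 2 (begin
      2 * length r + length l              ≤⟨ +-monoʳ-≤ (2 * length r) (m≤n*m (length l) 2) ⟩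
      2 * length r + 2 * length l          ≡⟨ *-distribˡ-+ 2 (length r) (length l) ⟨
      2 * (length r + length l)            ≡⟨ cong (2 *_) (+-comm (length r) (length l)) ⟩
      2 * (length l + length r)            ≤⟨ *-monoʳ-≤ 2 total≤ ⟩
      2 * n                                ∎)))
      (rightmost r l u v before≤ after≤)
    where
    open Marked m
    open ≤-Reasoning
    Φ : Bool → Vec Tape 2 → Set
    Φ b ts = b ≡ true × ts ≡ load [] ∷ load [] ∷ []
    erase : ∀ l u → length u ≤ length l → Hit clean (Surely Φ) (suc (length l)) 0 false
                                            (move left (tape u []) ∷ back l [] ∷ [])
    erase []      []            le       = still λ _ → done (refl , refl)
    erase (b ∷ l) []            le       = still λ _ → running (erase l [] z≤n)
    erase (b ∷ l) (just _ ∷ u)  (s≤s le) = still λ _ → running (erase l u le)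
    erase (b ∷ l) (nothing ∷ u) (s≤s le) = still λ _ → running (erase l u le)
    rightmost : ∀ r l u v → length u ≤ length l → length v ≤ length r →
                Hit clean (Surely Φ) (sweep (length r) (length l)) 0 true (tape u v ∷ bits l r ∷ [])
    rightmost []      l u []      le le′ = still λ _ → running (erase l u le)
    rightmost (b ∷ r) l u v       le le′ = still λ _ → running (rightmost r (b ∷ l) _ _
      (≤-trans (length-∷ᵇ (first (scan (tape u v) ∷ᵇ rest v)) u) (s≤s le))
      (≤-trans (≤-reflexive (cong length (rest-∷ᵇ (scan (tape u v)) (rest v)))) (length-rest v (b ∷ r) le′)))

  Guessed : ∀ {n} → List Bool → List Bool → (Vec Bool n → ℕ) → Post 3
  Guessed {n} w l f b ts v = ∃[ x ] ts ≡ load w ∷ load (l ʳ++ toList x) ∷ load (l ʳ++ toList x) ∷ [] × v ≡ f x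

  guess-hit : ∀ mode w (f : Vec Bool (length w) → ℕ) →
    Hit (guess mode) (Guessed w [] f) (guessTime (length w) 0) (expect mode (length w) f * 2 ^ guessSlack
      (length w) 0)
      reading (load w ∷ load [] ∷ load [] ∷ [])
  guess-hit mode w f = forward w [] [] f refl
    where
    backward : ∀ {Φ : Post 3} {y} m l → length m ≡ length l → ∀ m′ l′ →
      Φ true (load (m ʳ++ m′) ∷ load (l ʳ++ l′) ∷ load (l ʳ++ l′) ∷ []) y →
      Hit (guess mode) Φ (suc (length l)) (y * 2 ^ suc (length l)) rewind (back m m′ ∷ back l l′ ∷ back l l′
        ∷ [])
    backward {y = y} [] [] eq m′ l′ φ = next (λ _ → y) (≤-reflexive (trans (*-comm y 2)
      (cong (y +_) (+-identityʳ y))))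
      λ c → stop m′ l′ φ
      where
      stop : ∀ {Φ : Post 3} {y} m′ l′ → Φ true (load m′ ∷ load l′ ∷ load l′ ∷ []) y →
        After (guess mode) Φ 0 y (step (code (guess mode) rewind) false (back [] m′ ∷ back [] l′
          ∷ back [] l′ ∷ []))
      stop []      []      φ = exited _ φ (≤-reflexive (sym (*-identityʳ _)))
      stop []      (_ ∷ _) φ = exited _ φ (≤-reflexive (sym (*-identityʳ _)))
      stop (_ ∷ _) []      φ = exited _ φ (≤-reflexive (sym (*-identityʳ _)))
      stop (_ ∷ _) (_ ∷ _) φ = exited _ φ (≤-reflexive (sym (*-identityʳ _)))
    backward {y = y} (b ∷ m) (x ∷ l) eq m′ l′ φ = next (λ _ → y * 2 ^ suc (length l))
      (≤-reflexive (halve y (suc (length l))))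
      λ _ → running (backward m l (suc-injective eq) (b ∷ m′) (x ∷ l′) φ)

    -- The payoff f is a function of the bits not guessed yet; those already guessed are on the
    -- tapes as l.
    forward : ∀ r m l (f : Vec Bool (length r) → ℕ) → length m ≡ length l →
      Hit (guess mode) (Guessed (m ʳ++ r) l f) (guessTime (length r) (length l))
        (expect mode (length r) f * 2 ^ guessSlack (length r) (length l)) reading (bits m r ∷ bits l []
          ∷ bits l [] ∷ [])
    forward [] m l f eq = next (λ _ → f [] * 2 ^ suc (length l)) (≤-reflexive (halve (f []) (suc (length l))))
      λ _ → running (backward m l eq [] [] ([] , refl , refl))
    forward (b ∷ r) m l f eq =
      next (λ _ → expect mode (suc (length r)) f * 2 ^ suc s)
        (≤-reflexive (halve (expect mode (suc (length r)) f) (suc s))) λ _ → running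
      (next total (≤-reflexive (expect-split mode (length r) f (2 ^ suc s))) λ c → running
      (next (λ d → e (bitOf mode c d) * 2 ^ suc s) (≤-reflexive (split′ c)) λ d → running
      (next (λ _ → e (bitOf mode c d) * 2 ^ s) (≤-reflexive (halve (e (bitOf mode c d)) s)) λ _ → running
        (Hit-weaken (λ { _ _ _ (x , p , q) → bitOf mode c d ∷ x , p , q })
          (forward r (b ∷ m) (bitOf mode c d ∷ l) (f ∘ (bitOf mode c d ∷_)) (cong suc eq))))))
      where
      s = guessSlack (length r) (suc (length l))
      e : Bool → ℕ
      e c = expect mode (length r) (f ∘ (c ∷_))
      total : Bool → ℕ
      total c = (e (bitOf mode c false) + e (bitOf mode c true)) * 2 ^ suc s
      split′ : ∀ c → total c ≡ e (bitOf mode c false) * 2 ^ suc s + e (bitOf mode c true) * 2 ^ suc s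
      split′ c = *-distribʳ-+ (2 ^ suc s) (e (bitOf mode c false)) (e (bitOf mode c true))

  -- The output of a machine ends at the first blank and nothing is known of the cells beyond it, so
  -- the hypothesis is about `prefix v` and not about v.
  parse-hit : ∀ w {v v′ u m l} → prefix v ≡ encodeStrings (w ∷ v′) →
    Reach parse (λ b ts → b ≡ false × ∃[ u′ ] ∃[ v″ ] prefix v″ ≡ encodeStrings v′ ×
                   ts ≡ tape u′ v″ ∷ bits (true ∷ m) [] ∷ bits (false ∷ l) [] ∷ [])
      (suc (2 * length w)) (tape u v ∷ bits m [] ∷ bits l [] ∷ [])
  parse-hit [] eq with prefix-∷ eq
  ... | v , refl , eq′ = still λ _ → done (refl , _ , v , eq′ , refl)
  parse-hit (b ∷ w) {v′ = v′} {u} {m} {l} eq with prefix-∷ eq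
  ... | v₁ , refl , eq₁ with prefix-∷ eq₁
  ... | v₂ , refl , eq₂ = Reach-≤ (≤-reflexive (cong suc (sym (*-suc 2 (length w)))))
    (still λ _ → running (still λ _ → running (parse-hit w {v′ = v′} eq₂)))

  parse-stops : ∀ {v u} m l → prefix v ≡ [] →
    Reach parse (λ b ts → b ≡ true × ∃[ t ] ts ≡ t ∷ bits m [] ∷ bits l [] ∷ []) 1 (tape u v ∷ bits m []
      ∷ bits l [] ∷ [])
  parse-stops {[]}          m l eq = still λ _ → done (refl , _ , refl)
  parse-stops {nothing ∷ v} m l eq = still λ _ → done (refl , _ , refl)

  finish-runs : ∀ m l → length m ≡ length l →
    Runs finish (bits m [] ∷ bits l [] ∷ []) (3 + length l) true (load (m ʳ++ []) ∷ load (false ∷ false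
      ∷ (l ʳ++ [])) ∷ [])
  finish-runs m l eq = still λ _ → running (backward m l eq [] [])
    where
    Φ : List Bool → List Bool → Bool → Vec Tape 2 → Set
    Φ m l b ts = b ≡ true × ts ≡ load m ∷ load (false ∷ false ∷ l) ∷ []
    backward : ∀ m l → length m ≡ length l → ∀ m′ l′ → Hit finish (Surely (Φ (m ʳ++ m′) (l ʳ++ l′)))
      (2 + length l) 0 (suc zero)
                 (back m m′ ∷ back l l′ ∷ [])
    backward [] [] eq []      []      = still λ _ → running (still λ _ → done (refl , refl))
    backward [] [] eq []      (_ ∷ _) = still λ _ → running (still λ _ → done (refl , refl))
    backward [] [] eq (_ ∷ _) []      = still λ _ → running (still λ _ → done (refl , refl))
    backward [] [] eq (_ ∷ _) (_ ∷ _) = still λ _ → running (still λ _ → done (refl , refl))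
    backward (x ∷ m) (y ∷ l) eq m′ l′ = still λ _ → running (backward m l (suc-injective eq) (x ∷ m′)
      (y ∷ l′))

  eraseBits-runs : ∀ q w → q ≤ length w → Runs (eraseBits q) (load w ∷ []) (q + 1) false (load (drop q w)
    ∷ [])
  eraseBits-runs zero    w       le       = exit-runs false _
  eraseBits-runs (suc q) (b ∷ w) (s≤s le) = branch-surely {F = eraseBit} {K = λ b →
    if b then exit true else eraseBits q}
    {Φ = λ b ts → b ≡ false × ts ≡ load w ∷ []} (erased w) λ { .false .(load w ∷ []) (refl , refl) →
      eraseBits-runs q w le }
    where
    erased : ∀ w → Runs eraseBit (load (b ∷ w) ∷ []) 1 false (load w ∷ [])
    erased []      = still λ _ → done (refl , refl)
    erased (_ ∷ _) = still λ _ → done (refl , refl)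

  eraseBits-stops : ∀ q w → length w < q → Reach (eraseBits q) (λ b _ → b ≡ true) (q + 1) (load w ∷ [])
  eraseBits-stops (suc q) [] le = Reach-≤ (s≤s (m≤n+m 1 q)) (branch-surely {F = eraseBit} {K = λ b →
    if b then exit true else eraseBits q}
    {Φ = λ b ts → b ≡ true} {τ = 1} (still λ _ → done refl) λ { .true ts refl → still λ _ → done refl })
  eraseBits-stops (suc q) (b ∷ w) (s≤s le) = branch-surely {F = eraseBit} {K = λ b →
    if b then exit true else eraseBits q}
    {Φ = λ b ts → b ≡ false × ts ≡ load w ∷ []} (erased w) λ { .false .(load w ∷ []) (refl , refl) →
      eraseBits-stops q w le }
    where
    erased : ∀ w → Runs eraseBit (load (b ∷ w) ∷ []) 1 false (load w ∷ [])
    erased []      = still λ _ → done (refl , refl)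
    erased (_ ∷ _) = still λ _ → done (refl , refl)

  drain-runs : ∀ w u → Runs drain (load w ∷ load u ∷ []) (sweep (length w) 0) true (load w ∷ load
    (drop (length w) u) ∷ [])
  drain-runs w u = forward w [] u
    where
    Φ : List Bool → List Bool → Bool → Vec Tape 2 → Set
    Φ w u b ts = b ≡ true × ts ≡ load w ∷ load u ∷ []
    backward : ∀ l r {u} → Hit drain (Surely (Φ (l ʳ++ r) u)) (suc (length l)) 0 false (back l r ∷ load u
      ∷ [])
    backward []      []      = still λ _ → done (refl , refl)
    backward []      (_ ∷ _) = still λ _ → done (refl , refl)
    backward (x ∷ l) r       = still λ _ → running (backward l (x ∷ r))
    forward : ∀ r l u → Hit drain (Surely (Φ (l ʳ++ r) (drop (length r) u))) (sweep (length r)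
      (length l)) 0 true
                          (bits l r ∷ load u ∷ [])
    forward []      l u = still λ _ → running (backward l [])
    forward (b ∷ r) l u = still λ _ →
      running (subst₂ (λ x y → Hit drain (Surely (Φ (l ʳ++ (b ∷ r)) x)) _ 0 true (bits (b ∷ l) r ∷ y ∷ []))
      (drop-drop₁ (length r) u) (sym (erase-load u)) (forward r (b ∷ l) (drop 1 u)))

indicator : Bool → ℕ
indicator b = if b then 1 else 0

-- Amplification by repetition

-- Let p = a / X ≥ 1 / (e + 1) be the chance of one trial and p′ = y / B ≥ 1 - f / D that of the
-- later ones. The joint chance p (1 - p′) + p′ is (a x + X y) / (X B), and it is at least 1 - (e /
-- (e + 1)) (f / D). All denominators are cleared.
amplify : ∀ e D X B x y f a → x + y ≡ B → D * B ≤ D * y + f * B → X ≤ suc e * a →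
          suc e * D * (X * B) ≤ suc e * D * (a * x + X * y) + e * f * (X * B)
amplify e D X B x y f a refl ih le = begin
  suc e * D * (X * B)                                      ≡⟨ lemma₁ e D X B ⟩
  X * (D * B) + e * X * (D * B)                            ≤⟨ +-monoʳ-≤ (X * (D * B)) (*-monoʳ-≤ (e * X) ih) ⟩
  X * (D * B) + e * X * (D * y + f * B)                    ≡⟨ lemma₂ e X D x y (f * B) ⟩
  D * (X * x) + (D * (suc e * (X * y)) + X * (e * (f * B))) ≤⟨ +-monoˡ-≤ _ (*-monoʳ-≤ D (*-monoˡ-≤ x le)) ⟩
  D * (suc e * a * x) + (D * (suc e * (X * y)) + X * (e * (f * B))) ≡⟨ cong (λ z → D * (suc e * a * x)
    + (D * (suc e * (X * y)) + z)) (lemma₄ X e f B) ⟩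
  D * (suc e * a * x) + (D * (suc e * (X * y)) + e * f * (X * B)) ≡⟨ lemma₃ (suc e) D a x (X * y)
    (e * f * (X * B)) ⟩
  suc e * D * (a * x + X * y) + e * f * (X * B)            ∎
  where
  open ≤-Reasoning
  lemma₁ : ∀ e D X B → suc e * D * (X * B) ≡ X * (D * B) + e * X * (D * B)
  lemma₁ = solve-∀
  lemma₂ : ∀ e X D x y z → X * (D * (x + y)) + e * X * (D * y + z) ≡ D * (X * x) + (D * (suc e * (X * y))
    + X * (e * z))
  lemma₂ = solve-∀
  lemma₄ : ∀ X e f B → X * (e * (f * B)) ≡ e * f * (X * B)
  lemma₄ = solve-∀
  lemma₃ : ∀ s D a x q r → D * (s * a * x) + (D * (s * q) + r) ≡ s * D * (a * x + q) + r
  lemma₃ = solve-∀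

-- The number of increments it takes a numeral to overflow.
remaining : List Bool → ℕ
remaining []          = 1
remaining (false ∷ w) = 2 * remaining w
remaining (true ∷ w)  = pred (2 * remaining w)

remaining>0 : ∀ w → 1 ≤ remaining w
remaining>0 []          = ≤-refl
remaining>0 (false ∷ w) = ≤-trans (remaining>0 w) (m≤m+n _ _)
remaining>0 (true ∷ w)  = pred-mono-≤ (*-monoʳ-≤ 2 (remaining>0 w))

remaining-increment : ∀ w → hasZero w ≡ true → remaining w ≡ suc (remaining (increment w))
remaining-increment (false ∷ w) _ = sym (suc-pred (2 * remaining w) {{>-nonZero (≤-trans (remaining>0 w)
  (m≤m+n _ _))}})
remaining-increment (true ∷ w)  z rewrite remaining-increment w z =
  +-suc (remaining (increment w)) (remaining (increment w) + 0)

remaining-full : ∀ w → hasZero w ≡ false → remaining w ≡ 1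
remaining-full []         _ = refl
remaining-full (true ∷ w) z rewrite remaining-full w z = refl

length-increment : ∀ w → hasZero w ≡ true → length (increment w) ≡ length w
length-increment (false ∷ w) _ = refl
length-increment (true ∷ w)  z = cong suc (length-increment w z)

remaining-zeros : ∀ m → remaining (replicate m false) ≡ 2 ^ m
remaining-zeros zero    = refl
remaining-zeros (suc m) = cong (2 *_) (remaining-zeros m)

module _ (answer : List Bool → Bool) where
  open Semantics answer

  module _ {k Q} {F : Frag k Q} {Φ : Post k} (w≤1 : ∀ b ts w → Φ b ts w → w ≤ 1) where
    mutual
      weight≤ : ∀ {τ a s ts} → Hit F Φ τ a s ts → a ≤ 2 ^ τ
      weight≤ {suc τ} (next w le f) = ≤-trans le (≤-trans (+-mono-≤ (weight≤′ (f false)) (weight≤′ (f true)))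
        (+-monoʳ-≤ (2 ^ τ) (≤-reflexive (sym (+-identityʳ (2 ^ τ))))))

      weight≤′ : ∀ {τ a x} → After F Φ τ a x → a ≤ 2 ^ τ
      weight≤′ (running h)     = weight≤ h
      weight≤′ (exited w φ le) = ≤-trans le (≤-trans (*-monoˡ-≤ _ (w≤1 _ _ w φ))
        (≤-reflexive (*-identityˡ _)))

-- Bernoulli's inequality (1 + 1/e) ^ (n + 1) ≥ 1 + (n + 1) / e without denominators, which also
-- makes sense for e = 0.
bernoulli : ∀ e n → e ^ suc n + suc n * e ^ n ≤ suc e ^ suc n
bernoulli e zero    = ≤-reflexive (lemma e)
  where
  lemma : ∀ e → e * 1 + 1 * 1 ≡ suc e * 1
  lemma = solve-∀
bernoulli e (suc n) = begin
  e * x + (1 + suc n) * x                          ≤⟨ m≤m+n _ (suc n * y) ⟩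
  e * x + (1 + suc n) * x + suc n * y              ≡⟨ lemma e n y ⟩
  suc e * (e * y + suc n * y)                      ≤⟨ *-monoʳ-≤ (suc e) (bernoulli e n) ⟩
  suc e * suc e ^ suc n                            ∎
  where
  open ≤-Reasoning
  y = e ^ n
  x = e ^ suc n
  lemma : ∀ e n y → e * (e * y) + (1 + suc n) * (e * y) + suc n * y ≡ suc e * (e * y + suc n * y)
  lemma = solve-∀

-- With D = e + 1 this is (1 - 1/D) ^ D ≤ 1/2, the case n = e of Bernoulli's inequality.
2e^e≤ : ∀ e → 2 * e ^ suc e ≤ suc e ^ suc e
2e^e≤ e = ≤-trans (+-monoʳ-≤ (e ^ suc e) (≤-trans (≤-reflexive (+-identityʳ _)) (m≤n+m (e ^ suc e)
  (e ^ e)))) (bernoulli e e)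

module Repetition (answer : List Bool → Bool) {k} {Q} (F G : Frag k Q) (Yes : Set) (Inv Mid : List Bool →
  Vec Tape k → Set) (τ ρ a : ℕ) where
  open Rules answer

  Tried : List Bool → Post k
  Tried u b ts w = w ≡ indicator b × (b ≡ true → Yes) × (b ≡ false → Mid u ts)

  module _ (try : ∀ {u ts} → Inv u ts → Hit F (Tried u) τ a (start F) ts)
           (refresh : ∀ {u ts} → Mid u ts → Reach G (λ b ts′ → b ≡ hasZero u × (b ≡ true →
             Inv (increment u) ts′)) ρ ts) where

    loopTime : ℕ → ℕ
    loopTime zero    = 0
    loopTime (suc r) = τ + (ρ + loopTime r)

    -- The numerator, over `2 ^ loopTime r`, of the chance p_r of success within r rounds, where p_0
    -- = 0 and p_(r+1) = p (1 - p_r) + p_r for the chance p = a / 2 ^ τ of one trial.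
    loopWeight : ℕ → ℕ
    loopWeight zero    = 0
    loopWeight (suc r) = a * (2 ^ (ρ + loopTime r) ∸ 2 ^ ρ * loopWeight r)
                           + 2 ^ τ * (2 ^ ρ * loopWeight r)

    loopTime≡ : ∀ r → loopTime r ≡ r * (τ + ρ)
    loopTime≡ zero    = refl
    loopTime≡ (suc r) = trans (cong (λ t → τ + (ρ + t)) (loopTime≡ r)) (sym (+-assoc τ ρ _))

    module _ (a≤ : a ≤ 2 ^ τ) where

      loopWeight≤ : ∀ r → loopWeight r ≤ 2 ^ loopTime r
      rest≤ : ∀ r → 2 ^ ρ * loopWeight r ≤ 2 ^ (ρ + loopTime r)
      loopWeight≤ zero    = z≤n
      loopWeight≤ (suc r) = begin
        a * (B ∸ y) + 2 ^ τ * y     ≤⟨ +-monoˡ-≤ _ (*-monoˡ-≤ (B ∸ y) a≤) ⟩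
        2 ^ τ * (B ∸ y) + 2 ^ τ * y ≡⟨ *-distribˡ-+ (2 ^ τ) (B ∸ y) y ⟨
        2 ^ τ * (B ∸ y + y)         ≡⟨ cong (2 ^ τ *_) (m∸n+n≡m (rest≤ r)) ⟩
        2 ^ τ * B                   ≡⟨ ^-distribˡ-+-* 2 τ _ ⟨
        2 ^ loopTime (suc r)        ∎
        where
        open ≤-Reasoning
        B = 2 ^ (ρ + loopTime r)
        y = 2 ^ ρ * loopWeight r
      rest≤ r = ≤-trans (*-monoʳ-≤ (2 ^ ρ) (loopWeight≤ r)) (≤-reflexive (sym (^-distribˡ-+-* 2 ρ _)))

      -- That is, p_r ≥ 1 - (e / (e + 1)) ^ r if a trial succeeds with probability at least 1 / (e +
      -- 1).
      loopWeight-bound : ∀ e → 2 ^ τ ≤ suc e * a → ∀ r →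
        suc e ^ r * 2 ^ loopTime r ≤ suc e ^ r * loopWeight r + e ^ r * 2 ^ loopTime r
      loopWeight-bound e le zero    = ≤-refl
      loopWeight-bound e le (suc r) = subst (λ z → suc e ^ suc r * z ≤ suc e ^ suc r * loopWeight (suc r)
        + e ^ suc r * z)
        (sym (^-distribˡ-+-* 2 τ (ρ + loopTime r)))
        (amplify e D (2 ^ τ) B (B ∸ y) y (e ^ r) a (m∸n+n≡m (rest≤ r)) ih le)
        where
        open ≤-Reasoning
        D = suc e ^ r
        y = 2 ^ ρ * loopWeight r
        B = 2 ^ (ρ + loopTime r)
        ih : D * B ≤ D * y + e ^ r * B
        ih = begin
          D * B                                               ≡⟨ cong (D *_) (^-distribˡ-+-* 2 ρ _) ⟩
          D * (2 ^ ρ * 2 ^ loopTime r)                        ≡⟨ swap D (2 ^ ρ) _ ⟩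
          2 ^ ρ * (D * 2 ^ loopTime r)                        ≤⟨ *-monoʳ-≤ (2 ^ ρ) (loopWeight-bound e le r) ⟩
          2 ^ ρ * (D * loopWeight r + e ^ r * 2 ^ loopTime r) ≡⟨ lemma (2 ^ ρ) D (loopWeight r) (e ^ r)
            (2 ^ loopTime r) ⟩
          D * y + e ^ r * (2 ^ ρ * 2 ^ loopTime r)            ≡⟨ cong (λ z → D * y + e ^ r * z)
            (^-distribˡ-+-* 2 ρ _) ⟨
          D * y + e ^ r * B                                   ∎
          where
          swap : ∀ a b c → a * (b * c) ≡ b * (a * c)
          swap = solve-∀
          lemma : ∀ p d w f t → p * (d * w + f * t) ≡ d * (p * w) + f * (p * t)
          lemma = solve-∀

      loopWeight-half : ∀ e → 2 ^ τ ≤ suc e * a → 2 ^ loopTime (suc e) ≤ 2 * loopWeight (suc e)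
      loopWeight-half e le = *-cancelˡ-≤ D {{m^n≢0 (suc e) (suc e)}} (+-cancelʳ-≤ (D * B) (D * B)
        (D * (2 * W)) (begin
        D * B + D * B                       ≡⟨ cong (D * B +_) (+-identityʳ (D * B)) ⟨
        2 * (D * B)                         ≤⟨ *-monoʳ-≤ 2 (loopWeight-bound e le (suc e)) ⟩
        2 * (D * W + e ^ suc e * B)         ≡⟨ lemma D W (e ^ suc e) B ⟩
        D * (2 * W) + 2 * e ^ suc e * B     ≤⟨ +-monoʳ-≤ _ (*-monoˡ-≤ B (2e^e≤ e)) ⟩
        D * (2 * W) + D * B                 ∎))
        where
        open ≤-Reasoning
        D = suc e ^ suc e
        W = loopWeight (suc e)
        B = 2 ^ loopTime (suc e)
        lemma : ∀ d w f b → 2 * (d * w + f * b) ≡ d * (2 * w) + 2 * f * b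
        lemma = solve-∀

      loop-hit : ∀ r {u ts} → Inv u ts → remaining u ≡ r →
        Hit (loop F G) (Verdict Yes) (loopTime r) (loopWeight r) (inj₁ (start F)) ts
      loop-hit zero    {u = u} inv rem with () ← subst (1 ≤_) rem (remaining>0 u)
      loop-hit (suc r) {u} {ts} inv rem = loop-first (Hit-affine x y (try inv)) after
        where
        y = 2 ^ ρ * loopWeight r
        B = 2 ^ (ρ + loopTime r)
        x = B ∸ y
        again : ∀ b ts₁ w → Const (λ b ts′ → b ≡ hasZero u × (b ≡ true → Inv (increment u) ts′))
          (loopWeight r) b ts₁ w →
          After (loop F G) (Verdict Yes) (loopTime r) w ((if b then inj₁ (inj₁ (start F)) else inj₂ false) ,
            ts₁)
        again true ts₁ _ ((eq , inv₁) , refl) = running (loop-hit r (inv₁ refl)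
          (suc-injective (trans (sym (remaining-increment u (sym eq))) rem)))
        -- The counter has overflowed, so r is 0 and no weight has to be accounted for any more.
        again false ts₁ _ ((eq , _) , refl) = exited 0 refl
          (≤-reflexive (cong loopWeight {y = 0} (suc-injective (trans (sym rem) (remaining-full u
            (sym eq))))))
        after : ∀ b ts₁ w → Affine {F = F} {Φ = Tried u} x y b ts₁ w →
          After (loop F G) (Verdict Yes) (ρ + loopTime r) w ((if b then inj₂ true else inj₁
            (inj₂ (start G))) , ts₁)
        -- Success is worth x + y = B, that is, all continuations of the coin sequence.
        after true ts₁ w (_ , (refl , found , _) , refl) = exited 1 (found refl , ≤-refl)
          (≤-reflexive (trans (cong (_+ y) (*-identityˡ x)) (trans (m∸n+n≡m (rest≤ r))
            (sym (*-identityˡ B)))))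
        after false ts₁ w (_ , (refl , _ , mid) , refl) =
          running (loop-second (Reach-const (loopWeight r) (refresh (mid refl))) again)

    weight-bounded : ∀ {u ts} → Inv u ts → a ≤ 2 ^ τ
    weight-bounded {u} inv = weight≤ answer {Φ = Tried u}
      (λ { true _ _ (refl , _) → ≤-refl ; false _ _ (refl , _) → z≤n }) (try inv)

-- Assembling the machine

module Layout (wG wE : ℕ) where

  -- The named tapes of the machine: its own ones, and the tapes of the two
  -- machines called, apart from the query tape, with their shadows.
  Ix : Set
  Ix = Fin 7 ⊎ Fin (2 + wG) ⊎ Fin (3 + wG) ⊎ Fin (4 + wE) ⊎ Fin (5 + wE)

  pattern query    = inj₁ zero
  pattern input    = inj₁ (suc (suc zero))
  pattern elements = inj₁ (suc (suc (suc zero)))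
  pattern counter  = inj₁ (suc (suc (suc (suc zero))))
  pattern size₂    = inj₁ (suc (suc (suc (suc (suc zero)))))
  pattern amount   = inj₁ (suc (suc (suc (suc (suc (suc zero))))))
  pattern ground j  = inj₂ (inj₁ j)
  pattern ground′ j = inj₂ (inj₂ (inj₁ j))
  pattern extend j  = inj₂ (inj₂ (inj₂ (inj₁ j)))
  pattern extend′ j = inj₂ (inj₂ (inj₂ (inj₂ j)))

  work : ℕ
  work = 4 + ((2 + wG) + ((3 + wG) + ((4 + wE) + (5 + wE))))

  K : ℕ
  K = 2 + (1 + work)

  tapes↔Ix : Fin K ↔ Ix
  tapes↔Ix = ↔-trans (+↔⊎ {7}) (↔-refl ⊎-↔ ↔-trans (+↔⊎ {2 + wG}) (↔-refl ⊎-↔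
               ↔-trans (+↔⊎ {3 + wG}) (↔-refl ⊎-↔ +↔⊎ {4 + wE})))

  -- The reasoning uses names only. Positions matter just through the inverse law and the places
  -- that the machine model prescribes for the query tape and the input tape.
  abstract
    pos : Ix → Fin K
    pos = Inverse.from tapes↔Ix

    name : Fin K → Ix
    name = Inverse.to tapes↔Ix

    name-pos : ∀ i → name (pos i) ≡ i
    name-pos = Inverse.strictlyInverseˡ tapes↔Ix

    pos-query : pos query ≡ zero
    pos-query = refl

    pos-input : pos input ≡ suc (suc zero)
    pos-input = refl

  _≟_ : DecidableEquality Ix
  _≟_ = Sum.≡-dec Fin._≟_ (Sum.≡-dec Fin._≟_ (Sum.≡-dec Fin._≟_ (Sum.≡-dec Fin._≟_ Fin._≟_)))

  open Named pos name name-pos _≟_ public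

  infix 8 _!_
  _!_ : Vec Tape K → Ix → Tape
  T ! i = lookup T (pos i)

  on : ∀ {k} (ns : Vec Ix k) → AllPairs Apart ns → Frag k Silent → Frag K IsQuery
  on ns apart = lift (names ns apart) (λ _ ())

  -- The oracle can only be asked about the query tape of the whole machine, so this tape is also
  -- tape 0 of every machine called. It is shared by the blocks, while its shadow is not, and it has
  -- to be blank again before the next call.
  record Block (k : ℕ) : Set where
    field
      main shadow : Fin (suc k) → Ix
      which       : Ix → Maybe (Fin (suc k) ⊎ Fin (suc k))
      main-zero   : main zero ≡ query
      apart       : ∀ j → Apart (main j) (shadow j)
      retract′    : ∀ x → which (Sum.[ main , shadow ]′ x) ≡ just x
      section′    : ∀ i x → which i ≡ just x → i ≡ Sum.[ main , shadow ]′ x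

    focus : Focus (suc k + suc k)
    focus = record
      { ι       = Sum.[ main , shadow ]′ ∘ splitAt (suc k)
      ; ι⁻¹     = Maybe.map (join (suc k) (suc k)) ∘ which
      ; retract = λ p → trans (cong (Maybe.map _) (retract′ (splitAt (suc k) p)))
                              (cong just (join-splitAt (suc k) (suc k) p))
      ; section = sec
      }
      where
      sec : ∀ i p → Maybe.map (join (suc k) (suc k)) (which i) ≡ just p → i ≡ Sum.[ main ,
        shadow ]′ (splitAt (suc k) p)
      sec i p eq with which i in e
      sec i .(join (suc k) (suc k) x) refl | just x = trans (section′ i x e) (cong Sum.[ main ,
        shadow ]′ (sym (splitAt-join (suc k) (suc k) x)))

    allowed : ∀ p → p ≡ zero → IsQuery (pos (ι focus p))
    allowed .zero refl = trans (cong pos main-zero) pos-query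

    calling : (Frag (suc k + suc k) (_≡ zero)) → Frag K IsQuery
    calling = lift focus allowed

    cleaning : Fin (suc k) → Frag K IsQuery
    cleaning j = on (main j ∷ shadow j ∷ []) ((apart j ∷ []) ∷ [] ∷ []) clean

    cleanUp : List (Fin (suc k)) → Frag K IsQuery
    cleanUp []       = exit true
    cleanUp (j ∷ js) = cleaning j ⨾ cleanUp js

  groundBlock : Block (2 + wG)
  groundBlock = record
    { main = main ; shadow = λ j → ground′ j ; which = which ; main-zero = refl
    ; apart = λ { zero → refl ; (suc j) → refl }
    ; retract′ = λ { (inj₁ zero) → refl ; (inj₁ (suc j)) → refl ; (inj₂ j) → refl }
    ; section′ = λ { query (inj₁ zero) refl → refl ; (ground j) (inj₁ (suc j)) refl → refl ; (ground′ j)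
      (inj₂ j) refl → refl
                   ; (inj₁ (suc _)) _ () ; (extend _) _ () ; (extend′ _) _ () } }
    where
    main : Fin (3 + wG) → Ix
    main zero    = query
    main (suc j) = ground j
    which : Ix → Maybe (Fin (3 + wG) ⊎ Fin (3 + wG))
    which query       = just (inj₁ zero)
    which (ground j)  = just (inj₁ (suc j))
    which (ground′ j) = just (inj₂ j)
    which _           = nothing

  extendBlock : Block (4 + wE)
  extendBlock = record
    { main = main ; shadow = λ j → extend′ j ; which = which ; main-zero = refl
    ; apart = λ { zero → refl ; (suc j) → refl }
    ; retract′ = λ { (inj₁ zero) → refl ; (inj₁ (suc j)) → refl ; (inj₂ j) → refl }
    ; section′ = λ { query (inj₁ zero) refl → refl ; (extend j) (inj₁ (suc j)) refl → refl ; (extend′ j)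
      (inj₂ j) refl → refl
                   ; (inj₁ (suc _)) _ () ; (ground _) _ () ; (ground′ _) _ () } }
    where
    main : Fin (5 + wE) → Ix
    main zero    = query
    main (suc j) = extend j
    which : Ix → Maybe (Fin (5 + wE) ⊎ Fin (5 + wE))
    which query       = just (inj₁ zero)
    which (extend j)  = just (inj₁ (suc j))
    which (extend′ j) = just (inj₂ j)
    which _           = nothing

  module BlockRules (answer : List Bool → Bool) where
    open Behaviour answer public
    open Rules answer public

    module _ {k} (Fo : Focus k) {Q : Fin k → Set} {allow : ∀ j → Q j →
      IsQuery (pos (ι Fo j))} {F : Frag k Q} where

      after-hit : ∀ {Kk Φ Ψ τ ρ a ts T} → Hit F Φ τ a (start F) ts → (∀ j → T ! ι Fo j ≡ lookup ts j) →
        (∀ b ts′ w T′ → Φ b ts′ w → Agrees T′ (override Fo ts′ (T !_)) → Hit (Kk b) Ψ ρ w (start (Kk b)) T′) →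
        Hit (branch (lift Fo allow F) Kk) Ψ (τ + ρ) a (inj₁ (start F)) T
      after-hit h pre k = branch-hit (lift-hit Fo {Q} {IsQuery} allow answer h (λ _ → refl) pre)
        λ { b T′ w (ts′ , φ , ag) → k b ts′ w T′ φ ag }

      after-runs : ∀ {Kk Ψ τ ρ a b ts ts′ T} → Runs F ts τ b ts′ → (∀ j → T ! ι Fo j ≡ lookup ts j) →
        (∀ T′ → Agrees T′ (override Fo ts′ (T !_)) → Hit (Kk b) Ψ ρ a (start (Kk b)) T′) →
        Hit (branch (lift Fo allow F) Kk) Ψ (τ + ρ) (2 ^ τ * a) (inj₁ (start F)) T
      after-runs {b = b} {ts′ = ts′} {T} h pre k = branch-reach {Φ = λ b′ T′ → b′ ≡ b × Agrees T′
        (override Fo ts′ (T !_))}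
        (Hit-weaken {Ψ = Surely λ b′ T′ → b′ ≡ b × Agrees T′ (override Fo ts′ (T !_))}
          (λ { _ _ _ (_ , (refl , refl) , ag) → refl , ag }) (lift-hit Fo {Q} {IsQuery} allow answer h
          (λ _ → refl) pre))
        λ { b T′ (refl , ag) → k T′ ag }

    override-cases : ∀ {k} (Fo : Focus k) ts S i →
      (∃[ j ] i ≡ ι Fo j × override Fo ts S i ≡ lookup ts j) ⊎ (override Fo ts S i ≡ S i)
    override-cases Fo ts S i with ι⁻¹ Fo i in e
    ... | nothing = inj₂ refl
    ... | just j  = inj₁ (j , section Fo i j e , refl)

    module _ {k} (Bl : Block k) where
      open Block Bl

      Blank : Vec Tape K → Fin (suc k) → Set
      Blank T j = T ! main j ≡ load [] × T ! shadow j ≡ load []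

      Dirty : ℕ → Vec Tape K → Fin (suc k) → Set
      Dirty n T j = Marked n (T ! main j) (T ! shadow j)

      Elsewhere : Vec Tape K → Vec Tape K → Set
      Elsewhere T T′ = ∀ i → which i ≡ nothing → T′ ! i ≡ T ! i

      override-elsewhere : ∀ {k} (Fo : Focus k) ts S → (∀ j → lookup ts j ≡ S (ι Fo j) ⊎ ∃[ x ] which
        (ι Fo j) ≡ just x) →
                           ∀ i → which i ≡ nothing → override Fo ts S i ≡ S i
      override-elsewhere Fo ts S f i e with override-cases Fo ts S i
      ... | inj₂ eq              = eq
      ... | inj₁ (j , refl , eq) with f j
      ...   | inj₁ eq′       = trans eq eq′
      ...   | inj₂ (x , e′) with () ← trans (sym e) e′

      private
        main-injective : ∀ {x y} → Sum.[ main , shadow ]′ x ≡ Sum.[ main , shadow ]′ y → x ≡ y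
        main-injective {x} {y} eq = just-injective (trans (sym (retract′ x)) (trans (cong which eq)
          (retract′ y)))

        blank-dirty : ∀ {n T} j → Blank T j → Dirty n T j
        blank-dirty j (p , q) = record { l = [] ; r = [] ; shadow≡ = q ; before≤ = ≤-reflexive
          (cong (length ∘ Tape.before) p)
          ; after≤ = ≤-reflexive (cong (length ∘ Tape.after) p) ; total≤ = z≤n }

      clean-one : ∀ {n T} j → Dirty n T j → Reach (cleaning j)
        (λ b T′ → b ≡ true × Blank T′ j × (∀ i → i ≢ main j → i ≢ shadow j → T′ ! i ≡ T ! i)) (2 + 2 * n) T
      clean-one {n} {T} j d = Hit-weaken
        (λ { _ T′ _ (_ , (refl , refl) , ag) → refl , (trans (ag (main j)) (override-ι Fo blanks
          (T !_) zero) , trans (ag (shadow j)) (override-ι Fo blanks (T !_) (suc zero)))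
          , λ i i≢m i≢s → trans (ag i) (other i i≢m i≢s) })
        (lift-hit Fo {Silent} {IsQuery} (λ _ ()) answer (clean-runs d) (λ _ → refl) λ { zero →
          refl ; (suc zero) → refl })
        where
        blanks = load [] ∷ load [] ∷ []
        Fo = names (main j ∷ shadow j ∷ []) ((apart j ∷ []) ∷ [] ∷ [])
        other : ∀ i → i ≢ main j → i ≢ shadow j → override Fo blanks (T !_) i ≡ T ! i
        other i i≢m i≢s with override-cases Fo blanks (T !_) i
        ... | inj₂ eq                  = eq
        ... | inj₁ (zero , eq , _)     with () ← i≢m eq
        ... | inj₁ (suc zero , eq , _) with () ← i≢s eq

      cleanTime : ℕ → ℕ → ℕ
      cleanTime n m = m * (2 + 2 * n) + 1

      -- The tapes are cleaned one after the other, so the induction has to know that those already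
      -- blank remain so; hence the alternative `Blank T j`. Blank tapes also count as dirty, so the
      -- list may contain repetitions.
      cleanUp-reach : ∀ {n} js {T} → (∀ j → Dirty n T j) → Reach (cleanUp js)
        (λ b T′ → b ≡ true × Elsewhere T T′ × (∀ j → j ∈ js ⊎ Blank T j → Blank T′ j))
          (cleanTime n (length js)) T
      cleanUp-reach []       {T} d = Hit-weaken (λ { _ _ _ (refl , refl) → refl , (λ _ _ → refl) ,
        λ { j (inj₂ bl) → bl } }) (exit-runs true T)
      cleanUp-reach {n} (j₀ ∷ js) {T} d = Reach-≤
        (≤-reflexive (sym (+-assoc (2 + 2 * n) (length js * (2 + 2 * n)) 1)))
        (branch-surely {K = const (cleanUp js)} (clean-one j₀ (d j₀)) next-one)
        where
        elsewhere≢ : ∀ i x → which i ≡ nothing → i ≢ Sum.[ main , shadow ]′ x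
        elsewhere≢ i x e refl with () ← trans (sym e) (retract′ x)
        module _ T₁ (bl : Blank T₁ j₀) (same : ∀ i → i ≢ main j₀ → i ≢ shadow j₀ → T₁ ! i ≡ T ! i) where
          pair : ∀ j → j ≢ j₀ → T₁ ! main j ≡ T ! main j × T₁ ! shadow j ≡ T ! shadow j
          pair j j≢ = same (main j) (λ eq → j≢ (inj₁-injective (main-injective {inj₁ j} {inj₁ j₀} eq)))
                                   (λ eq → case main-injective {inj₁ j} {inj₂ j₀} eq of λ ())
                    , same (shadow j) (λ eq → case main-injective {inj₂ j} {inj₁ j₀} eq of λ ())
                                      (λ eq → j≢ (inj₂-injective (main-injective {inj₂ j} {inj₂ j₀} eq)))
          dirty : ∀ j → Dirty n T₁ j
          dirty j with j Fin.≟ j₀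
          ... | yes refl = blank-dirty {T = T₁} j bl
          ... | no j≢    = subst₂ (Marked n) (sym (proj₁ (pair j j≢))) (sym (proj₂ (pair j j≢))) (d j)
          keep : ∀ j → Blank T j → Blank T₁ j
          keep j (p , q) with j Fin.≟ j₀
          ... | yes refl = bl
          ... | no j≢    = trans (proj₁ (pair j j≢)) p , trans (proj₂ (pair j j≢)) q
          rest-clean : ∀ {T₂} → (∀ j → j ∈ js ⊎ Blank T₁ j → Blank T₂ j) → ∀ j → j ∈ j₀ ∷ js ⊎ Blank T j →
            Blank T₂ j
          rest-clean bls j (inj₁ (here refl)) = bls j (inj₂ bl)
          rest-clean bls j (inj₁ (there j∈))  = bls j (inj₁ j∈)
          rest-clean bls j (inj₂ bl′)         = bls j (inj₂ (keep j bl′))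
        next-one : ∀ b T₁ → b ≡ true × Blank T₁ j₀ × (∀ i → i ≢ main j₀ → i ≢ shadow j₀ → T₁ ! i ≡ T ! i) →
          Reach (cleanUp js) (λ b T′ → b ≡ true × Elsewhere T T′ × (∀ j → j ∈ j₀ ∷ js ⊎ Blank T j →
            Blank T′ j)) (cleanTime n (length js)) T₁
        next-one b T₁ (_ , bl , same) = Hit-weaken
          (λ { _ T₂ _ (refl , els , bls) → refl
             , (λ i e → trans (els i e) (same i (elsewhere≢ i (inj₁ j₀) e) (elsewhere≢ i (inj₂ j₀) e)))
             , rest-clean T₁ bl same {T₂} bls })
          (cleanUp-reach js (dirty T₁ bl same))

-- Counting guessed sets

choose : ℕ → ℕ → ℕ
choose n       zero    = 1
choose zero    (suc k) = 0
choose (suc n) (suc k) = choose n k + choose n (suc k)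

choose-mono : ∀ {m n} k → m ≤ n → choose m k ≤ choose n k
choose-mono zero    le      = ≤-refl
choose-mono (suc k) z≤n     = z≤n
choose-mono (suc k) (s≤s le) = +-mono-≤ (choose-mono k le) (choose-mono (suc k) le)

choose-step : ∀ d n k → d * choose n k ≤ choose (d + n) (suc k)
choose-step zero    n k = z≤n
choose-step (suc d) n k = +-mono-≤ (choose-mono k (m≤n+m n d)) (choose-step d n k)

-- Partition k d elements into k blocks of size d and choose one element of each block;
-- `choose-step` adds one block.
^≤choose : ∀ d k → d ^ k ≤ choose (k * d) k
^≤choose d zero    = ≤-refl
^≤choose d (suc k) = ≤-trans (*-monoʳ-≤ d (^≤choose d k)) (choose-step d (k * d) k)

removes : ∀ {n} → Subset n → Vec Bool n → ℕ → Bool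
removes []          []          zero    = true
removes []          []          (suc ℓ) = false
removes (false ∷ S) (false ∷ X) ℓ       = removes S X ℓ
removes (false ∷ S) (true ∷ X)  ℓ       = false
removes (true ∷ S)  (true ∷ X)  ℓ       = removes S X ℓ
removes (true ∷ S)  (false ∷ X) zero    = false
removes (true ∷ S)  (false ∷ X) (suc ℓ) = removes S X ℓ

removes-extension : ∀ {n} ℓ (S : Subset n) X → removes S X ℓ ≡ true → ∃[ D ] D ⊆ ∁ X × X ∪ D ≡ S × ∣ D ∣ ≡ ℓ
removes-extension zero    []          []          _ = [] , (λ ()) , refl , refl
removes-extension (suc ℓ) []          []          ()
removes-extension ℓ       (false ∷ S) (false ∷ X) e with removes-extension ℓ S X e
... | D , sub , un , card = outside ∷ D , (λ { (there p) → there (sub p) }) , cong (_ ∷_) un , card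
removes-extension ℓ       (true ∷ S)  (true ∷ X)  e with removes-extension ℓ S X e
... | D , sub , un , card = outside ∷ D , (λ { (there p) → there (sub p) }) , cong (_ ∷_) un , card
removes-extension (suc ℓ) (true ∷ S)  (false ∷ X) e with removes-extension ℓ S X e
... | D , sub , un , card = inside ∷ D , (λ { here → here ; (there p) → there (sub p) }) , cong (_ ∷_) un ,
  cong suc card

expect-zero : ∀ mode n → expect mode n (const 0) ≡ 0
expect-zero mode  zero    = refl
expect-zero true  (suc n) rewrite expect-zero true n = refl
expect-zero false (suc n) rewrite expect-zero false n = refl

-- Every set has weight 2 ^ n out of 4 ^ n under uniform guesses, and the sets counted arise from S
-- by choosing the ℓ elements to remove.
expect-removes : ∀ {n} ℓ (S : Subset n) → expect true n (λ X → indicator (removes S X ℓ)) ≡ 2 ^ n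
  * choose ∣ S ∣ ℓ
expect-removes zero    []  = refl
expect-removes (suc ℓ) []  = refl
expect-removes {suc n} ℓ (false ∷ S) rewrite expect-zero true n | expect-removes ℓ S =
  lemma (2 ^ n) (choose ∣ S ∣ ℓ) where
  lemma : ∀ x y → 2 * (x * y) + 0 ≡ 2 * x * y
  lemma = solve-∀
expect-removes {suc n} zero    (true ∷ S)  rewrite expect-zero true n | expect-removes zero S =
  lemma (2 ^ n) where
  lemma : ∀ x → 0 + 2 * (x * 1) ≡ 2 * x * 1
  lemma = solve-∀
expect-removes {suc n} (suc ℓ) (true ∷ S)  rewrite expect-removes ℓ S | expect-removes (suc ℓ) S =
  lemma (2 ^ n) (choose ∣ S ∣ ℓ) (choose ∣ S ∣ (suc ℓ)) where
  lemma : ∀ x y z → 2 * (x * y) + 2 * (x * z) ≡ 2 * x * (y + z)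
  lemma = solve-∀

-- Exactly one guess counts, namely S. An element outside S contributes the factor 3 and one inside
-- the factor 1, so the weight is 3 ^ (n - |S|); multiplying by 3 ^ |S| avoids the subtraction.
expect-equals : ∀ {n} (S : Subset n) → expect false n (λ X → indicator (removes S X 0)) * 3 ^ ∣ S ∣ ≡ 3 ^ n
expect-equals []                      = refl
expect-equals {suc n} (false ∷ S) rewrite expect-zero false n =
  trans (lemma (expect false n (λ X → indicator (removes S X 0))) (3 ^ ∣ S ∣)) (cong (3 *_)
    (expect-equals S)) where
  lemma : ∀ x y → (3 * x + 0) * y ≡ 3 * (x * y)
  lemma = solve-∀
expect-equals {suc n} (true ∷ S)  rewrite expect-zero false n =
  trans (lemma (expect false n (λ X → indicator (removes S X 0))) (3 ^ ∣ S ∣)) (cong (3 *_)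
    (expect-equals S)) where
  lemma : ∀ x y → x * (3 * y) ≡ 3 * (x * y)
  lemma = solve-∀

-- Lengths of numerals

fromBits-increment : ∀ w → fromBits (increment w) ≡ suc (fromBits w)
fromBits-increment []          = refl
fromBits-increment (false ∷ w) = refl
fromBits-increment (true ∷ w)  rewrite fromBits-increment w = lemma (fromBits w) where
  lemma : ∀ x → 2 * suc x ≡ suc (1 + 2 * x)
  lemma = solve-∀

fromBits-toBits : ∀ n → fromBits (toBits n) ≡ n
fromBits-toBits zero    = refl
fromBits-toBits (suc n) = trans (fromBits-increment (toBits n)) (cong suc (fromBits-toBits n))

fromBits< : ∀ w → fromBits w < 2 ^ length w
fromBits< []      = ≤-refl
fromBits< (b ∷ w) = begin
  suc ((if b then 1 else 0) + 2 * fromBits w) ≤⟨ s≤s (+-monoˡ-≤ _ (bit≤1 b)) ⟩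
  suc (1 + 2 * fromBits w)                    ≡⟨ lemma (fromBits w) ⟩
  2 * suc (fromBits w)                        ≤⟨ *-monoʳ-≤ 2 (fromBits< w) ⟩
  2 * 2 ^ length w                            ∎
  where
  open ≤-Reasoning
  bit≤1 : ∀ b → (if b then 1 else 0) ≤ 1
  bit≤1 true  = ≤-refl
  bit≤1 false = z≤n
  lemma : ∀ x → suc (1 + 2 * x) ≡ 2 * suc x
  lemma = solve-∀

full-numeral : ∀ w → hasZero w ≡ false → length (increment w) ≡ suc (length w) × suc (fromBits w)
  ≡ 2 ^ length w
full-numeral []         _ = refl , refl
full-numeral (true ∷ w) z with full-numeral w z
... | p , q = cong suc p , trans (lemma (fromBits w)) (cong (2 *_) q)
  where
  lemma : ∀ x → suc (1 + 2 * x) ≡ 2 * suc x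
  lemma = solve-∀

n<2^length : ∀ n → n < 2 ^ length (toBits n)
n<2^length n = subst (_< 2 ^ length (toBits n)) (fromBits-toBits n) (fromBits< (toBits n))

-- A numeral only gets longer when all its bits are 1, and then the successor is the power of two
-- `2 ^ length`.
2^length≤ : ∀ n → 2 ^ length (toBits n) ≤ suc (2 * n)
2^length≤ zero    = ≤-refl
2^length≤ (suc n) with hasZero (toBits n) in z
... | true  rewrite length-increment (toBits n) z = ≤-trans (2^length≤ n) (s≤s (*-monoʳ-≤ 2 (n≤1+n n)))
... | false with full-numeral (toBits n) z
...   | p , q rewrite p | sym q | fromBits-toBits n = n≤1+n (2 * suc n)

length-toBits≤ : ∀ n → length (toBits n) ≤ n
length-toBits≤ zero    = z≤n
length-toBits≤ (suc n) = ≤-trans (length-increment≤ (toBits n)) (s≤s (length-toBits≤ n))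
  where
  length-increment≤ : ∀ w → length (increment w) ≤ suc (length w)
  length-increment≤ []          = ≤-refl
  length-increment≤ (false ∷ w) = n≤1+n _
  length-increment≤ (true ∷ w)  = s≤s (length-increment≤ w)

1+n≤2^n : ∀ n → suc n ≤ 2 ^ n
1+n≤2^n zero    = ≤-refl
1+n≤2^n (suc n) = ≤-trans (+-mono-≤ (≤-trans (s≤s z≤n) (1+n≤2^n n)) (1+n≤2^n n))
                    (≤-reflexive (cong (2 ^ n +_) (sym (+-identityʳ _))))

-- From 2 ^ 3 ≤ 3 ^ 2, that is, log 3 ≥ 3/2, by descending 3 in y and 2 in r. The summand 3 is slack
-- that excludes r ≤ 1 unless y = 0.
2^≤3^ : ∀ y r → 2 * y + 3 ≤ 3 * r → 2 ^ y ≤ 3 ^ r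
2^≤3^ zero                r             le = m^n>0 3 r
2^≤3^ (suc y)             zero          le = case ≤-trans (m≤n+m 3 (2 * suc y)) le of λ ()
2^≤3^ (suc y)             (suc zero)    le = case ≤-trans (+-monoˡ-≤ 3 (*-monoʳ-≤ 2 (s≤s (z≤n {y})))) le of
  λ { (s≤s (s≤s (s≤s ()))) }
2^≤3^ (suc zero)          (suc (suc r)) le = ≤-trans (s≤s (s≤s z≤n)) (*-monoʳ-≤ 3 (*-monoʳ-≤ 3 (m^n>0 3 r)))
2^≤3^ (suc (suc zero))    (suc (suc r)) le = ≤-trans (s≤s (s≤s (s≤s (s≤s z≤n))))
  (*-monoʳ-≤ 3 (*-monoʳ-≤ 3 (m^n>0 3 r)))
2^≤3^ (suc (suc (suc y))) (suc (suc r)) le = begin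
  2 * (2 * (2 * 2 ^ y)) ≡⟨ lemma (2 ^ y) ⟩
  8 * 2 ^ y             ≤⟨ *-mono-≤ (n≤1+n 8) (2^≤3^ y r (+-cancelˡ-≤ 6 _ _
    (≤-trans (≤-reflexive (lemma₁ y)) (≤-trans le (≤-reflexive (lemma₂ r)))))) ⟩
  9 * 3 ^ r             ≡⟨ *-assoc 3 3 (3 ^ r) ⟩
  3 * (3 * 3 ^ r)       ∎
  where
  open ≤-Reasoning
  lemma : ∀ x → 2 * (2 * (2 * x)) ≡ 8 * x
  lemma = solve-∀
  lemma₁ : ∀ y → 6 + (2 * y + 3) ≡ 2 * suc (suc (suc y)) + 3
  lemma₁ = solve-∀
  lemma₂ : ∀ r → 3 * suc (suc r) ≡ 6 + 3 * r
  lemma₂ = solve-∀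

-- Parameters of the search

-- The number of bits by which the counter of the trials gets shorter when a
-- numeral of ρ + ℓ * q bits is consumed in ℓ chunks.
erased : ℕ → ℕ → ℕ → ℕ
erased q ρ zero    = 0
erased q ρ (suc ℓ) = (ρ + ℓ * q) + erased q ρ ℓ

erased≡ : ∀ a ρ k → erased (4 * a) ρ (suc k) ≡ suc k * (ρ + 2 * a * k)
erased≡ a ρ zero    = lemma a ρ
  where
  lemma : ∀ a ρ → ρ + 0 + 0 ≡ 1 * (ρ + 2 * a * 0)
  lemma = solve-∀
erased≡ a ρ (suc k) rewrite erased≡ a ρ k = lemma a ρ k
  where
  lemma : ∀ a ρ k → ρ + suc k * (4 * a) + suc k * (ρ + 2 * a * k) ≡ suc (suc k) * (ρ + 2 * a * suc k)
  lemma = solve-∀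

-- For ℓ = k + 1 the right-hand side exceeds the left-hand side by ℓ ρ + a k². The square a ℓ² is
-- what the search has to gain: the time of an extension call and the final saving.
square≤erased : ∀ a ρ ℓ → a * ℓ ^ 2 ≤ erased (4 * a) ρ ℓ + a
square≤erased a ρ zero    = ≤-trans (≤-reflexive (*-zeroʳ a)) z≤n
square≤erased a ρ (suc k) rewrite erased≡ a ρ k = begin
  a * suc k ^ 2                                        ≤⟨ m≤m+n _ (suc k * ρ + a * k * k) ⟩
  a * suc k ^ 2 + (suc k * ρ + a * k * k)              ≡⟨ lemma a ρ k ⟩
  suc k * (ρ + 2 * a * k) + a                          ∎
  where
  open ≤-Reasoning
  lemma : ∀ a ρ k → a * (suc k * (suc k * 1)) + (suc k * ρ + a * k * k) ≡ suc k * (ρ + 2 * a * k) + a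
  lemma = solve-∀

module _ (a′ : ℕ) where
  private
    a = suc a′

  -- The length ρ + 4 a (k + 1) of the numeral grows with k at twice the rate of δ = ρ + 2 a k. The
  -- difference suffices for k + 1 ≤ 2 ^ k and for the constant 16, so 16 (k + 1) 2 ^ δ is at most 2
  -- to the length of the numeral, hence at most 2 n + 1. This is where the factor 4 in `4 * a`
  -- comes from.
  room : ∀ n ρ k → length (toBits n) ≡ ρ + suc k * (4 * a) → 8 * (suc k * 2 ^ (ρ + 2 * a * k)) ≤ n
  room n ρ k len = *-cancelˡ-≤ 2 (even (8 * (suc k * 2 ^ δ)) n (begin
    2 * (8 * (suc k * 2 ^ δ))               ≤⟨ *-monoʳ-≤ 2 (*-monoʳ-≤ 8 (*-monoˡ-≤ (2 ^ δ) (1+n≤2^n k))) ⟩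
    2 ^ 1 * (2 ^ 3 * (2 ^ k * 2 ^ δ))       ≡⟨ cong (λ z → 2 ^ 1 * (2 ^ 3 * z)) (^-distribˡ-+-* 2 k δ) ⟨
    2 ^ 1 * (2 ^ 3 * 2 ^ (k + δ))           ≡⟨ cong (2 ^ 1 *_) (^-distribˡ-+-* 2 3 (k + δ)) ⟨
    2 ^ 1 * 2 ^ (3 + (k + δ))               ≡⟨ ^-distribˡ-+-* 2 1 (3 + (k + δ)) ⟨
    2 ^ (1 + (3 + (k + δ)))                 ≤⟨ ^-monoʳ-≤ 2 (≤-trans (m≤m+n (1 + (3 + (k + δ)))
      (k + 4 * a′ + 2 * a′ * k)) (≤-reflexive (trans (lemma a′ ρ k) (sym len)))) ⟩
    2 ^ length (toBits n)                   ≤⟨ 2^length≤ n ⟩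
    suc (2 * n)                             ∎))
    where
    open ≤-Reasoning
    δ = ρ + 2 * a * k
    lemma : ∀ a′ ρ k → 1 + (3 + (k + (ρ + 2 * suc a′ * k))) + (k + 4 * a′ + 2 * a′ * k) ≡ ρ + suc k
      * (4 * suc a′)
    lemma = solve-∀
    -- Parity disposes of the 1 in 2 n + 1.
    even : ∀ x y → 2 * x ≤ suc (2 * y) → 2 * x ≤ 2 * y
    even zero    y       le = z≤n
    even (suc x) zero    le = case ≤-trans (*-monoʳ-≤ 2 (s≤s (z≤n {x}))) le of λ { (s≤s ()) }
    even (suc x) (suc y) le = ≤-trans (≤-reflexive (*-suc 2 x)) (≤-trans (+-monoʳ-≤ 2 (even x y
      (+-cancelˡ-≤ 2 _ _ (≤-trans (≤-reflexive (sym (*-suc 2 x)))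
        (≤-trans le (≤-reflexive (cong suc (*-suc 2 y))))))))
      (≤-reflexive (sym (*-suc 2 y))))

  -- The factor 8 of `room` is spent as 3 + 3 + 2: on the threshold for |S|, on the slack of
  -- `2^≤3^`, and on the erased bits, whose number (k + 1) δ is bounded by means of δ ≤ 2 ^ δ.
  few : ∀ n ρ k → length (toBits n) ≡ ρ + suc k * (4 * a) →
        3 * (suc k * 2 ^ (ρ + 2 * a * k)) + 3 + 2 * erased (4 * a) ρ (suc k) ≤ n
  few n ρ k len rewrite erased≡ a ρ k = ≤-trans (begin
    3 * x + 3 + 2 * (suc k * δ)     ≤⟨ +-mono-≤ (+-monoʳ-≤ (3 * x) (*-monoʳ-≤ 3 1≤x))
      (*-monoʳ-≤ 2 (*-monoʳ-≤ (suc k) (≤-trans (n≤1+n δ) (1+n≤2^n δ)))) ⟩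
    3 * x + 3 * x + 2 * x           ≡⟨ lemma x ⟩
    8 * x                           ∎) (room n ρ k len)
    where
    open ≤-Reasoning
    δ = ρ + 2 * a * k
    x = suc k * 2 ^ δ
    1≤x : 1 ≤ x
    1≤x = *-mono-≤ (s≤s (z≤n {k})) (m^n>0 2 δ)
    lemma : ∀ x → 3 * x + 3 * x + 2 * x ≡ 8 * x
    lemma = solve-∀

  erased≤ : ∀ n ρ ℓ → length (toBits n) ≡ ρ + ℓ * (4 * a) → erased (4 * a) ρ ℓ ≤ n
  erased≤ n ρ zero    len = z≤n
  erased≤ n ρ (suc k) len = ≤-trans (≤-trans (m≤m+n _ _) (m≤n+m _ (3 * (suc k * 2 ^ (ρ + 2 * a * k)) + 3)))
    (few n ρ k len)

  -- A set with at least k 2^δ elements is reached by the uniform guesses, a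
  -- smaller one by the guesses biased towards the empty set.
  success : ∀ {n} ρ ℓ → length (toBits n) ≡ ρ + ℓ * (4 * a) → (S : Subset n) →
    2 ^ (n + erased (4 * a) ρ ℓ) ≤ expect true n (λ X → indicator (removes S X ℓ)) + expect false n (λ X →
      indicator (removes S X 0))
  success {n} ρ zero    len S = ≤-trans (≤-reflexive (trans (cong (2 ^_) (+-identityʳ n))
    (sym (trans (expect-removes 0 S) (*-identityʳ _))))) (m≤m+n _ _)
  success {n} ρ (suc k) len S with suc k * 2 ^ (ρ + 2 * a * k) ≤? ∣ S ∣
  -- The erased bits number δ (k + 1), so 2 to this power is (2 ^ δ) ^ (k + 1), the lower bound for
  -- choosing k + 1 out of (k + 1) 2 ^ δ elements.
  ... | yes big = ≤-trans (begin
    2 ^ (n + erased (4 * a) ρ (suc k))      ≡⟨ ^-distribˡ-+-* 2 n _ ⟩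
    2 ^ n * 2 ^ erased (4 * a) ρ (suc k)    ≡⟨ cong (λ z → 2 ^ n * 2 ^ z) (trans (erased≡ a ρ k)
      (*-comm (suc k) δ)) ⟩
    2 ^ n * 2 ^ (δ * suc k)                 ≡⟨ cong (2 ^ n *_) (^-*-assoc 2 δ (suc k)) ⟨
    2 ^ n * (2 ^ δ) ^ suc k                 ≤⟨ *-monoʳ-≤ (2 ^ n) (≤-trans (^≤choose (2 ^ δ) (suc k))
      (choose-mono (suc k) big)) ⟩
    2 ^ n * choose ∣ S ∣ (suc k)            ≡⟨ expect-removes (suc k) S ⟨
    expect true n (λ X → indicator (removes S X (suc k))) ∎) (m≤m+n _ _)
    where
    open ≤-Reasoning
    δ = ρ + 2 * a * k
  -- It suffices that 2 ^ y ≤ 3 ^ (n - s). By log 3 ≥ 3/2 this reduces to 2 y + 3 ≤ 3 (n - s), which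
  -- `few` provides as s is below the threshold.
  ... | no small = ≤-trans (*-cancelʳ-≤ (2 ^ y) (expect false n (λ X → indicator (removes S X 0)))
    (3 ^ s) {{m^n≢0 3 s}} (begin
    2 ^ y * 3 ^ s                       ≤⟨ *-monoˡ-≤ (3 ^ s) (2^≤3^ y (n ∸ s)
      (+-cancelˡ-≤ (3 * s) _ _ need)) ⟩
    3 ^ (n ∸ s) * 3 ^ s                 ≡⟨ ^-distribˡ-+-* 3 (n ∸ s) s ⟨
    3 ^ (n ∸ s + s)                     ≡⟨ cong (3 ^_) (m∸n+n≡m (∣p∣≤n S)) ⟩
    3 ^ n                               ≡⟨ expect-equals S ⟨
    expect false n (λ X → indicator (removes S X 0)) * 3 ^ s ∎)) (m≤n+m _ (expect true n (λ X →
      indicator (removes S X (suc k)))))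
    where
    open ≤-Reasoning
    s = ∣ S ∣
    hc = erased (4 * a) ρ (suc k)
    y = n + hc
    lemma₁ : ∀ s n h → 3 * s + (2 * (n + h) + 3) ≡ 2 * n + (3 * s + 3 + 2 * h)
    lemma₁ = solve-∀
    lemma₂ : ∀ n → 2 * n + n ≡ 3 * n
    lemma₂ = solve-∀
    need : 3 * s + (2 * y + 3) ≤ 3 * s + 3 * (n ∸ s)
    need = begin
      3 * s + (2 * (n + hc) + 3)     ≡⟨ lemma₁ s n hc ⟩
      2 * n + (3 * s + 3 + 2 * hc)   ≤⟨ +-monoʳ-≤ (2 * n) (≤-trans (+-monoˡ-≤ (2 * hc)
        (+-monoˡ-≤ 3 (*-monoʳ-≤ 3 (<⇒≤ (≰⇒> small))))) (few n ρ k len)) ⟩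
      2 * n + n                      ≡⟨ lemma₂ n ⟩
      3 * n                          ≡⟨ cong (3 *_) (m+[n∸m]≡n (∣p∣≤n S)) ⟨
      3 * (s + (n ∸ s))              ≡⟨ *-distribˡ-+ 3 s (n ∸ s) ⟩
      3 * s + 3 * (n ∸ s)            ∎

  -- A trial succeeds with probability at least the sum of the two expectations divided by 4 * 4 ^
  -- n, where one factor 2 is due to the choice of the kind of guess and another to the extension
  -- algorithm. The two zeros prepended to the counter make up for this 4.
  rounds-suffice : ∀ {n} ρ ℓ → length (toBits n) ≡ ρ + ℓ * (4 * a) → (S : Subset n) →
    4 * 4 ^ n ≤ 2 ^ (2 + n ∸ erased (4 * a) ρ ℓ) * (expect true n (λ X → indicator (removes S X ℓ))
      + expect false n (λ X → indicator (removes S X 0)))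
  rounds-suffice {n} ρ ℓ len S = ≤-trans (≤-reflexive (begin-equality
    4 * 4 ^ n                        ≡⟨ cong (4 *_) (^-*-assoc 2 2 n) ⟩
    2 ^ 2 * 2 ^ (2 * n)              ≡⟨ ^-distribˡ-+-* 2 2 (2 * n) ⟨
    2 ^ (2 + 2 * n)                  ≡⟨ cong (2 ^_) (begin-equality
      2 + (n + (n + 0))                ≡⟨ cong (λ z → 2 + (n + z)) (+-identityʳ n) ⟩
      2 + (n + n)                      ≡⟨ +-assoc 2 n n ⟨
      2 + n + n                        ≡⟨ cong (_+ n) (m∸n+n≡m hc≤) ⟨
      2 + n ∸ hc + hc + n              ≡⟨ +-assoc (2 + n ∸ hc) hc n ⟩
      2 + n ∸ hc + (hc + n)            ≡⟨ cong (2 + n ∸ hc +_) (+-comm hc n) ⟩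
      2 + n ∸ hc + (n + hc)            ∎) ⟩
    2 ^ (2 + n ∸ hc + (n + hc))      ≡⟨ ^-distribˡ-+-* 2 (2 + n ∸ hc) (n + hc) ⟩
    2 ^ (2 + n ∸ hc) * 2 ^ (n + hc)  ∎)) (*-monoʳ-≤ (2 ^ (2 + n ∸ hc)) (success ρ ℓ len S))
    where
    open ≤-Reasoning
    hc = erased (4 * a) ρ ℓ
    hc≤ : hc ≤ 2 + n
    hc≤ = ≤-trans (erased≤ n ρ ℓ len) (m≤n+m n 2)

-- Running times

measureTime : ℕ → ℕ → ℕ → ℕ → ℕ
measureTime q ρ c zero    = q + 1
measureTime q ρ c (suc ℓ) = (q + 1) + ((sweep (length (toBits c)) 0 + sweep (ρ + ℓ * q) 0) + measureTime q ρ
  (suc c) ℓ)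

tallyTime : ℕ → List (List Bool) → ℕ
tallyTime c []       = 1
tallyTime c (w ∷ ws) = suc (2 * length w) + ((sweep (length (toBits c)) 0 + 1) + tallyTime (suc c) ws)

sweep≤ : ∀ {w n} → w ≤ n → sweep w 0 ≤ 2 + 2 * n
sweep≤ {w} le = ≤-trans (≤-reflexive (trans (sweep≡ w 0) (cong (2 +_) (+-identityʳ _))))
  (+-monoʳ-≤ 2 (*-monoʳ-≤ 2 le))

measureTime≤ : ∀ q ρ c ℓ {n} → c + ℓ ≤ n → ρ + ℓ * q ≤ n → measureTime q ρ c ℓ ≤ suc ℓ
  * (q + 1 + ((2 + 2 * n) + (2 + 2 * n)))
measureTime≤ q ρ c zero    le le′ = ≤-trans (m≤m+n _ _) (≤-reflexive (sym (*-identityˡ _)))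
measureTime≤ q ρ c (suc ℓ) {n} le le′ = ≤-trans (+-monoʳ-≤ (q + 1) (+-mono-≤ (+-mono-≤
    (sweep≤ (≤-trans (length-toBits≤ c) (≤-trans (m≤m+n c (suc ℓ)) le)))
    (sweep≤ le″)) (measureTime≤ q ρ (suc c) ℓ (≤-trans (≤-reflexive (sym (+-suc c ℓ))) le) le″)))
  (≤-reflexive (sym (+-assoc (q + 1) _ _)))
  where
  le″ : ρ + ℓ * q ≤ n
  le″ = ≤-trans (+-monoʳ-≤ ρ (m≤n+m (ℓ * q) q)) le′

length-encode : ∀ w ws → length (encodeStrings (w ∷ ws)) ≡ suc (2 * length w) + length (encodeStrings ws)
length-encode []      ws = refl
length-encode (b ∷ w) ws = trans (cong (2 +_) (length-encode w ws)) (lemma (length w)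
  (length (encodeStrings ws)))
  where
  lemma : ∀ x y → 2 + (suc (2 * x) + y) ≡ suc (2 * suc x) + y
  lemma = solve-∀

length≤encode : ∀ ws → length ws ≤ length (encodeStrings ws)
length≤encode []       = z≤n
length≤encode (w ∷ ws) = ≤-trans (s≤s (length≤encode ws)) (≤-trans (s≤s (m≤n+m _ (2 * length w)))
  (≤-reflexive (sym (length-encode w ws))))

tallyTime≤ : ∀ c ws {n} → c + length ws ≤ n → tallyTime c ws ≤ length (encodeStrings ws) + length ws
  * (3 + 2 * n) + 1
tallyTime≤ c []       le = ≤-refl
tallyTime≤ c (w ∷ ws) {n} le rewrite length-encode w ws = begin
  suc (2 * length w) + ((sweep (length (toBits c)) 0 + 1) + tallyTime (suc c) ws)
    ≤⟨ +-monoʳ-≤ (suc (2 * length w)) (+-mono-≤ (+-monoˡ-≤ 1 (sweep≤ (≤-trans (length-toBits≤ c)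
      (≤-trans (m≤m+n c _) le))))
        (tallyTime≤ (suc c) ws (≤-trans (≤-reflexive (sym (+-suc c (length ws)))) le))) ⟩
  suc (2 * length w) + ((2 + 2 * n + 1) + (length (encodeStrings ws) + length ws * (3 + 2 * n) + 1))
    ≡⟨ lemma (length w) n (length (encodeStrings ws)) (length ws * (3 + 2 * n)) ⟩
  suc (2 * length w) + length (encodeStrings ws) + (3 + 2 * n + length ws * (3 + 2 * n)) + 1 ∎
  where
  open ≤-Reasoning
  lemma : ∀ w n e l → suc (2 * w) + ((2 + 2 * n + 1) + (e + l + 1)) ≡ suc (2 * w) + e + (3 + 2 * n + l) + 1
  lemma = solve-∀

module Assembly (G : Machine 1) (E : Machine 3) (q : ℕ) where
  open Layout (Machine.work G) (Machine.work E) public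

  callGround callExtend : Frag K IsQuery
  callGround = Block.calling groundBlock (Calling.call G refl)
  callExtend = Block.calling extendBlock (Calling.call E refl)

  pattern 0F = zero
  pattern 1F = suc zero
  pattern 2F = suc (suc zero)
  pattern 3F = suc (suc (suc zero))
  pattern 4F = suc (suc (suc (suc zero)))

  apart₂ : ∀ {i j} → Apart i j → AllPairs Apart (i ∷ j ∷ [])
  apart₂ p = (p ∷ []) ∷ [] ∷ []

  apart₃ : ∀ {i j k} → Apart i j → Apart i k → Apart j k → AllPairs Apart (i ∷ j ∷ k ∷ [])
  apart₃ p q r = (p ∷ q ∷ []) ∷ (r ∷ []) ∷ [] ∷ []

  body : Bool → Frag K IsQuery
  body mode = on (elements ∷ extend 2F ∷ extend′ 3F ∷ []) (apart₃ refl refl refl) (guess mode)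
            ⨾ on (input ∷ extend 1F ∷ extend′ 2F ∷ []) (apart₃ refl refl refl) copy
            ⨾ callExtend

  -- For the biased guesses the last argument stays blank, which is the numeral of ℓ = 0.
  variant : Bool → Frag K IsQuery
  variant true  = on (amount ∷ extend 3F ∷ extend′ 4F ∷ []) (apart₃ refl refl refl) copy ⨾ body true
  variant false = body false

  trial : Frag K IsQuery
  trial = branch coin variant

  -- Only the number of elements is extracted from the ground set, in three forms: in unary to steer
  -- the guesses (`elements`), as a row of zeros that becomes the counter of the trials (`counter`),
  -- and in binary to be used up while ℓ is computed (`size₂`).
  copyInput parsing numbering tally finishing cleaningQuery chunk advance measure setup : Frag K IsQuery
  copyInput     = on (input ∷ ground 1F ∷ ground′ 2F ∷ []) (apart₃ refl refl refl) copy
  parsing       = on (ground 0F ∷ elements ∷ counter ∷ []) (apart₃ refl refl refl) parse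
  numbering     = on (size₂ ∷ []) ([] ∷ []) increments ⨾ exit true
  tally         = loop parsing numbering
  finishing     = on (elements ∷ counter ∷ []) (apart₂ refl) finish
  cleaningQuery = on (query ∷ ground′ 0F ∷ []) (apart₂ refl) clean
  chunk         = on (size₂ ∷ []) ([] ∷ []) (eraseBits q)
  advance       = on (amount ∷ []) ([] ∷ []) increments ⨾ on (size₂ ∷ counter ∷ []) (apart₂ refl) drain
  measure       = loop chunk advance
  setup         = copyInput ⨾ callGround ⨾ tally ⨾ finishing ⨾ cleaningQuery ⨾ measure

  refresh search algorithm : Frag K IsQuery
  refresh   = Block.cleanUp extendBlock (allFin _) ⨾ on (counter ∷ []) ([] ∷ []) increments
  search    = loop trial refresh
  algorithm = setup ⨾ search

expect-* : ∀ mode n (f : Vec Bool n → ℕ) c → expect mode n (λ x → f x * c) ≡ expect mode n f * c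
expect-* mode  zero    f c = refl
expect-* true  (suc n) f c
  rewrite expect-* true n (f ∘ (false ∷_)) c | expect-* true n (f ∘ (true ∷_)) c =
  lemma (expect true n (f ∘ (false ∷_))) (expect true n (f ∘ (true ∷_))) c
  where
  lemma : ∀ a b c → 2 * (a * c) + 2 * (b * c) ≡ (2 * a + 2 * b) * c
  lemma = solve-∀
expect-* false (suc n) f c
  rewrite expect-* false n (f ∘ (false ∷_)) c | expect-* false n (f ∘ (true ∷_)) c =
  lemma (expect false n (f ∘ (false ∷_))) (expect false n (f ∘ (true ∷_))) c
  where
  lemma : ∀ a b c → 3 * (a * c) + b * c ≡ (3 * a + b) * c
  lemma = solve-∀

-- Each of the n bits takes two more coins than are accounted for by the slack.
guessTime≡ : ∀ n l → 2 ^ guessTime n l ≡ 4 ^ n * 2 ^ guessSlack n l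
guessTime≡ zero    l = sym (+-identityʳ _)
guessTime≡ (suc n) l rewrite guessTime≡ n (suc l) = lemma (4 ^ n) (2 ^ guessSlack n (suc l))
  where
  lemma : ∀ x y → 2 * (2 * (2 * (2 * (x * y)))) ≡ 4 * x * (2 * (2 * y))
  lemma = solve-∀

count-mono : ∀ {T} {f g : Vec Bool T → Bool} → (∀ c → f c ≡ true → g c ≡ true) → count f ≤ count g
count-mono {zero} {f} {g} imp with f [] in e
... | false = z≤n
... | true rewrite imp [] e = ≤-refl
count-mono {suc T} imp = +-mono-≤ (count-mono (imp ∘ (false ∷_))) (count-mono (imp ∘ (true ∷_)))

-- One trial

GroundWithin : Instance → Machine 1 → ℕ → Set
GroundWithin I G t = ∀ (coins : Vec Bool t) →
  verdict (encoding ∷ []) coins ≡ just true × output (encoding ∷ []) coins ≡ encodeStrings ground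
  where
  open Instance I
  open On I G

module Search (G : Machine 1) (E : Machine 3) (q : ℕ) (I : Instance) where
  open Assembly G E q public
  open Instance I renaming (ground to strings)

  answer : List Bool → Bool
  answer = answerQuery size oracle

  open BlockRules answer public

  -- Γ bounds the calls with ℓ = l and with ℓ = 0 alike, so that the two kinds of guesses share
  -- their time bounds and hence their denominators.
  module Times (l Γ : ℕ) where
    inputLength : ℕ → ℕ
    inputLength ℓ = length encoding + size + length (toBits ℓ)

    b₀ copyTime bodyTime trialTime : ℕ
    b₀        = suc (Γ + inputLength l)
    copyTime  = sweep (length encoding) 0
    bodyTime  = guessTime size 0 + (copyTime + suc Γ)
    trialTime = suc (sweep (length (toBits l)) 0 + bodyTime)

    refreshTime : ℕ → ℕ
    refreshTime m = cleanTime extendBlock b₀ (length (allFin (5 + Machine.work E))) + sweep m 0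

  -- `claim` exists only in the analysis: it selects the guesses whose success is to be counted. On
  -- a yes-instance it is derived from one fixed solution. Claiming nothing yields a derivation that
  -- is available on every instance.
  module Extending (l Γ : ℕ) (time : ℕ → ℕ) (correct : ∀ X ℓ → Extension.CorrectWithin I E X ℓ (time ℓ))
                   (claim : ℕ → Subset size → Bool)
                   (sound : ∀ ℓ X → claim ℓ X ≡ true → ∃ (IsExtension I X ℓ)) where
    open Times l Γ public

    load-args : Subset size → ℕ → Vec Tape (5 + Machine.work E)
    load-args X ℓ = load [] ∷ load [] ∷ load encoding ∷ load (toList X) ∷ load (toBits ℓ) ∷ Vec.replicate _
      (load [])

    args-shadowed : ∀ X ℓ j → Shadowed (inputLength ℓ) (lookup (load-args X ℓ) j) (lookup (load-args X ℓ) j)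
    args-shadowed X ℓ 0F = shadowed-load [] z≤n
    args-shadowed X ℓ 1F = shadowed-load [] z≤n
    args-shadowed X ℓ 2F = shadowed-load encoding (≤-trans (m≤m+n (length encoding) size)
      (m≤m+n _ (length (toBits ℓ))))
    args-shadowed X ℓ 3F = shadowed-load (toList X) (≤-trans (≤-reflexive (length-toList X))
      (≤-trans (m≤n+m size (length encoding)) (m≤m+n _ (length (toBits ℓ)))))
      where open import Data.Vec.Properties using (length-toList)
    args-shadowed X ℓ 4F = shadowed-load (toBits ℓ) (m≤n+m (length (toBits ℓ)) (length encoding + size))
    args-shadowed X ℓ (suc (suc (suc (suc (suc j))))) rewrite lookup-replicate {n = Machine.work E} j
      (load []) = shadowed-load [] z≤n

    Sound : Bool → Vec Tape (5 + Machine.work E) → Set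
    Sound v _ = v ≡ true → IsYes I

    CallPost : ℕ → Post ((5 + Machine.work E) + (5 + Machine.work E))
    CallPost ℓ = Calling.Called E {Q = _≡ zero} refl answer Sound (suc (Γ + inputLength ℓ))

    -- The weight 2 ^ Γ over 2 ^ (Γ + 1) is the success probability 1/2 that the extension algorithm
    -- guarantees on a claimed guess.
    call-extend : ∀ X ℓ → time ℓ ≤ Γ →
      Hit (Calling.call E {Q = _≡ zero} refl) (CallPost ℓ) (suc Γ) (indicator (claim ℓ X) * 2 ^ Γ)
        (Machine.start E) (load-args X ℓ Vec.++ load-args X ℓ)
    call-extend X ℓ le with m≤n⇒∃[o]m+o≡n le
    ... | d , refl = Hit-lower bound (Hit-pad d (Hit-weaken later
          (Calling.call-hit E {Q = _≡ zero} refl answer (time ℓ) (args-shadowed X ℓ) ok)))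
      where
      open On I E
      ok : Calling.Succeeds E {Q = _≡ zero} refl answer Sound (time ℓ) (Machine.start E , load-args X ℓ)
      ok coins with proj₁ (correct X ℓ) coins
      ... | inj₁ (S , ret) = true , proj₁ ret , λ _ →
              let _ , S∈𝓕 , _ = proj₁ (proj₂ (correct X ℓ)) coins S ret in _ , S∈𝓕
      ... | inj₂ ret = false , ret , λ ()
      later : ∀ b ts w → Calling.Called E {Q = _≡ zero} refl answer Sound
        (suc (time ℓ + inputLength ℓ)) b ts w → CallPost ℓ b ts w
      later b ts w (a , a′ , eq , fin , m , v) = a , a′ , eq , fin ,
        (λ j → record { Marked (m j) ; total≤ = ≤-trans (Marked.total≤ (m j)) (s≤s (+-monoˡ-≤ _ le)) }) , v
      bound : indicator (claim ℓ X) * 2 ^ (time ℓ + d) ≤ 2 * Calling.successes E {Q = _≡ zero} refl answer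
        (time ℓ) (Machine.start E , load-args X ℓ) * 2 ^ d
      bound with claim ℓ X in e
      ... | false = z≤n
      ... | true with proj₂ (proj₂ (correct X ℓ)) (sound ℓ X e)
      ... | f , imp , half = begin
        1 * 2 ^ (time ℓ + d)     ≡⟨ *-identityˡ _ ⟩
        2 ^ (time ℓ + d)         ≡⟨ ^-distribˡ-+-* 2 (time ℓ) d ⟩
        2 ^ time ℓ * 2 ^ d       ≤⟨ *-monoˡ-≤ (2 ^ d) (≤-trans half (*-monoʳ-≤ 2 (count-mono λ c fc →
                                      cong accepts (proj₁ (proj₁ (proj₂ (imp c fc))))))) ⟩
        2 * Calling.successes E {Q = _≡ zero} refl answer (time ℓ) (Machine.start E , load-args X ℓ) * 2 ^ d ∎
        where open ≤-Reasoning

    TrialPost : Vec Tape K → Post K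
    TrialPost T b T′ w = w ≡ indicator b × (b ≡ true → IsYes I) ×
      (∀ j → Dirty extendBlock b₀ T′ j) × Elsewhere extendBlock T T′

    open Block extendBlock using (main; shadow; which; focus; retract′; allowed)

    Holds : Vec Tape (5 + Machine.work E) → Vec Tape K → Set
    Holds a T = ∀ j → T ! main j ≡ lookup a j × T ! shadow j ≡ lookup a j

    call-hits : ∀ {ℓ T T₀} X → time ℓ ≤ Γ → inputLength ℓ ≤ inputLength l → Holds (load-args X ℓ) T →
      Elsewhere extendBlock T₀ T →
      Hit callExtend (TrialPost T₀) (suc Γ) (indicator (claim ℓ X) * 2 ^ Γ) (start callExtend) T
    call-hits {ℓ} {T} {T₀} X le le′ holds els = Hit-weaken post
      (lift-hit focus {_≡ zero} {IsQuery} allowed answer (call-extend X ℓ le) (λ _ → refl) pre)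
      where
      a₀ = load-args X ℓ
      pre : ∀ p → T ! ι focus p ≡ lookup (a₀ Vec.++ a₀) p
      pre p rewrite lookup-splitAt (5 + Machine.work E) a₀ a₀ p with splitAt (5 + Machine.work E) p
      ... | inj₁ j = proj₁ (holds j)
      ... | inj₂ j = proj₂ (holds j)
      post : ∀ b T′ w → Framed focus {_≡ zero} {IsQuery} allowed answer (CallPost ℓ) (T !_) b T′ w →
        TrialPost T₀ b T′ w
      post b T′ w (_ , (a , a′ , refl , fin , marked , v) , ag) = v , fin , dirty ,
        λ i e → trans (ag i) (trans (cong (maybe′ (lookup (a Vec.++ a′)) (T ! i)) (cong (Maybe.map _) e))
          (els i e))
        where
        at : ∀ x → T′ ! Sum.[ main , shadow ]′ x ≡ lookup (a Vec.++ a′) (join _ _ x)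
        at x = trans (ag _) (cong (maybe′ (lookup (a Vec.++ a′)) _) (cong (Maybe.map (join _ _))
          (retract′ x)))
        dirty : ∀ j → Dirty extendBlock b₀ T′ j
        dirty j = subst₂ (Marked b₀) (sym (trans (at (inj₁ j)) (lookup-++ˡ a a′ j)))
          (sym (trans (at (inj₂ j)) (lookup-++ʳ a a′ j)))
          (record { Marked (marked j) ; total≤ = ≤-trans (Marked.total≤ (marked j)) (s≤s (+-monoʳ-≤ Γ le′)) })

    record Prepared (ℓ : ℕ) (T : Vec Tape K) : Set where
      field
        cells     : List Bool
        cells-n   : length cells ≡ size
        elements≡ : T ! elements ≡ load cells
        input≡    : T ! input ≡ load encoding
        holds     : Holds (load [] ∷ load [] ∷ load [] ∷ load [] ∷ load (toBits ℓ) ∷ Vec.replicate _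
          (load [])) T

    weigh : ℕ → Subset size → ℕ
    weigh ℓ X = indicator (claim ℓ X) * (2 ^ copyTime * 2 ^ Γ)

    bodyWeight : Bool → ℕ → ℕ
    bodyWeight mode ℓ = expect mode size (weigh ℓ) * 2 ^ guessSlack size 0

    -- Steps that toss no coin contribute equal powers of two to both sides. What remains is 4 ^ n
    -- for the guess and 2 for the extension algorithm.
    body-ratio : ∀ mode ℓ → expect mode size (indicator ∘ claim ℓ) * 2 ^ bodyTime ≤ 2 * 4 ^ size
      * bodyWeight mode ℓ
    body-ratio mode ℓ rewrite expect-* mode size (indicator ∘ claim ℓ) (2 ^ copyTime * 2 ^ Γ)
                | ^-distribˡ-+-* 2 (guessTime size 0) (copyTime + suc Γ) | ^-distribˡ-+-* 2 copyTime
                  (suc Γ) | guessTime≡ size 0 =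
      ≤-reflexive (lemma (expect mode size (indicator ∘ claim ℓ)) (4 ^ size) (2 ^ guessSlack size 0)
        (2 ^ copyTime) (2 ^ Γ))
      where
      lemma : ∀ e x s y z → e * (x * s * (y * (2 * z))) ≡ 2 * x * (e * (y * z) * s)
      lemma = solve-∀

    body-hit : ∀ mode {ℓ T T₀} → time ℓ ≤ Γ → inputLength ℓ ≤ inputLength l → Prepared ℓ T →
      Elsewhere extendBlock T₀ T →
      Hit (body mode) (TrialPost T₀) bodyTime (bodyWeight mode ℓ) (start (body mode)) T
    body-hit mode {ℓ} {T} {T₀} le le′ P els = after-hit F₁ {Kk = const rest′} {Ψ = TrialPost T₀}
      (guesses mode cells cells-n f) pre₁ second
      where
      open Prepared P
      F₁ = names (elements ∷ extend 2F ∷ extend′ 3F ∷ []) (apart₃ refl refl refl)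
      F₂ = names (input ∷ extend 1F ∷ extend′ 2F ∷ []) (apart₃ refl refl refl)
      rest′ = on (input ∷ extend 1F ∷ extend′ 2F ∷ []) (apart₃ refl refl refl) copy ⨾ callExtend
      f = weigh ℓ
      guesses : ∀ mode w {n} → length w ≡ n → (f : Vec Bool n → ℕ) →
        Hit (guess mode) (λ b ts v → ∃[ x ] ts ≡ load w ∷ load (toList x) ∷ load (toList x) ∷ [] × v ≡ f x)
          (guessTime n 0)
          (expect mode n f * 2 ^ guessSlack n 0) reading (load w ∷ load [] ∷ load [] ∷ [])
      guesses mode w refl f = guess-hit mode w f
      pre₁ : ∀ j → T ! ι F₁ j ≡ lookup (load cells ∷ load [] ∷ load [] ∷ []) j
      pre₁ 0F = elements≡
      pre₁ 1F = proj₁ (holds 3F)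
      pre₁ 2F = proj₂ (holds 3F)
      second : ∀ b ts w T₁ → (∃[ x ] ts ≡ load cells ∷ load (toList x) ∷ load (toList x) ∷ [] × w ≡ f x) →
               Agrees T₁ (override F₁ ts (T !_)) → Hit rest′ (TrialPost T₀) (copyTime + suc Γ) w
                 (start rest′) T₁
      second b ts w T₁ (X , refl , refl) ag₁ = Hit-lower (≤-reflexive (lemma (indicator (claim ℓ X))
        (2 ^ copyTime) (2 ^ Γ)))
        (after-runs F₂ {Kk = const callExtend} (copy-runs encoding) pre₂ λ T₂ ag₂ →
          call-hits {T₀ = T₀} X le le′ (third T₂ ag₂) λ i e → trans (ag₂ i)
            (trans (override-elsewhere extendBlock F₂ (load encoding ∷ load encoding ∷ load encoding
            ∷ []) (T₁ !_) out₂ i e)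
            (trans (ag₁ i) (trans (override-elsewhere extendBlock F₁ (load cells ∷ load (toList X) ∷ load
              (toList X) ∷ []) (T !_) out₁ i e) (els i e)))))
        where
        lemma : ∀ x y z → x * (y * z) ≡ y * (x * z)
        lemma = solve-∀
        pre₂ : ∀ j → T₁ ! ι F₂ j ≡ lookup (load encoding ∷ load [] ∷ load [] ∷ []) j
        pre₂ 0F = trans (ag₁ input) input≡
        pre₂ 1F = trans (ag₁ (extend 1F)) (proj₁ (holds 2F))
        pre₂ 2F = trans (ag₁ (extend′ 2F)) (proj₂ (holds 2F))
        out₁ : ∀ j → lookup (load cells ∷ load (toList X) ∷ load (toList X) ∷ []) j ≡ T ! ι F₁ j
          ⊎ ∃[ x ] which (ι F₁ j) ≡ just x
        out₁ 0F = inj₁ (sym elements≡)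
        out₁ 1F = inj₂ (_ , refl)
        out₁ 2F = inj₂ (_ , refl)
        out₂ : ∀ j → lookup (load encoding ∷ load encoding ∷ load encoding ∷ []) j ≡ T₁ ! ι F₂ j
          ⊎ ∃[ x ] which (ι F₂ j) ≡ just x
        out₂ 0F = inj₁ (sym (pre₂ 0F))
        out₂ 1F = inj₂ (_ , refl)
        out₂ 2F = inj₂ (_ , refl)
        third : ∀ T₂ → Agrees T₂ (override F₂ (load encoding ∷ load encoding ∷ load encoding ∷ []) (T₁ !_))
          → Holds (load-args X ℓ) T₂
        third T₂ ag₂ 0F = trans (ag₂ (main 0F)) (trans (ag₁ (main 0F)) (proj₁ (holds 0F)))
                        , trans (ag₂ (shadow 0F)) (trans (ag₁ (shadow 0F)) (proj₂ (holds 0F)))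
        third T₂ ag₂ 1F = trans (ag₂ (main 1F)) (trans (ag₁ (main 1F)) (proj₁ (holds 1F)))
                        , trans (ag₂ (shadow 1F)) (trans (ag₁ (shadow 1F)) (proj₂ (holds 1F)))
        third T₂ ag₂ 2F = ag₂ (main 2F) , ag₂ (shadow 2F)
        third T₂ ag₂ 3F = trans (ag₂ (main 3F)) (ag₁ (main 3F)) , trans (ag₂ (shadow 3F)) (ag₁ (shadow 3F))
        third T₂ ag₂ 4F = trans (ag₂ (main 4F)) (trans (ag₁ (main 4F)) (proj₁ (holds 4F)))
                        , trans (ag₂ (shadow 4F)) (trans (ag₁ (shadow 4F)) (proj₂ (holds 4F)))
        third T₂ ag₂ j@(suc (suc (suc (suc (suc _))))) = trans (ag₂ (main j)) (trans (ag₁ (main j))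
          (proj₁ (holds j)))
                        , trans (ag₂ (shadow j)) (trans (ag₁ (shadow j)) (proj₂ (holds j)))

    record Ready (T : Vec Tape K) : Set where
      field
        cells     : List Bool
        cells-n   : length cells ≡ size
        elements≡ : T ! elements ≡ load cells
        input≡    : T ! input ≡ load encoding
        amount≡   : T ! amount ≡ load (toBits l)
        blank     : ∀ j → Blank extendBlock T j

    successWeight : ℕ
    successWeight = expect true size (indicator ∘ claim l) + expect false size (indicator ∘ claim 0)

    blanks : ∀ {T} j → Blank extendBlock T j → T ! main j ≡ lookup (Vec.replicate _ (load [])) j
      × T ! shadow j ≡ lookup (Vec.replicate _ (load [])) j
    blanks j (p , q) = trans p (sym (lookup-replicate j (load []))) ,
      trans q (sym (lookup-replicate j (load [])))

    copyTimeᴸ trialWeight : ℕ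
    copyTimeᴸ   = sweep (length (toBits l)) 0
    trialWeight = 2 ^ copyTimeᴸ * bodyWeight false 0 + 2 ^ copyTimeᴸ * bodyWeight true l

    trial-ratio : successWeight * 2 ^ trialTime ≤ 4 * 4 ^ size * trialWeight
    trial-ratio = begin
      (x + y) * (2 * 2 ^ (copyTimeᴸ + bodyTime))                       ≡⟨ cong (λ z → (x + y) * (2 * z))
        (^-distribˡ-+-* 2 copyTimeᴸ bodyTime) ⟩
      (x + y) * (2 * (c * 2 ^ bodyTime))                               ≡⟨ lemma₁ x y c (2 ^ bodyTime) ⟩
      2 * c * (y * 2 ^ bodyTime + x * 2 ^ bodyTime)                    ≤⟨ *-monoʳ-≤ (2 * c)
        (+-mono-≤ (body-ratio false 0) (body-ratio true l)) ⟩
      2 * c * (2 * 4 ^ size * bodyWeight false 0 + 2 * 4 ^ size * bodyWeight true l) ≡⟨ lemma₂ (4 ^ size) c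
        (bodyWeight false 0) (bodyWeight true l) ⟩
      4 * 4 ^ size * (c * bodyWeight false 0 + c * bodyWeight true l)  ∎
      where
      open ≤-Reasoning
      c = 2 ^ copyTimeᴸ
      x = expect true size (indicator ∘ claim l)
      y = expect false size (indicator ∘ claim 0)
      lemma₁ : ∀ x y c z → (x + y) * (2 * (c * z)) ≡ 2 * c * (y * z + x * z)
      lemma₁ = solve-∀
      lemma₂ : ∀ z c a b → 2 * c * (2 * z * a + 2 * z * b) ≡ 4 * z * (c * a + c * b)
      lemma₂ = solve-∀

    trial-hit : ∀ {T} → time l ≤ Γ → time 0 ≤ Γ → Ready T → Hit trial (TrialPost T) trialTime trialWeight
      (start trial) T
    trial-hit {T} le le₀ R = branch-hit {F = coin} {K = variant}
      (coin-hit {Φ = Tossed} (2 ^ copyTimeᴸ * bodyWeight false 0) (2 ^ copyTimeᴸ * bodyWeight true l)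
        (refl , refl) (refl , refl)) next′
      where
      open Ready R
      F = names (amount ∷ extend 3F ∷ extend′ 4F ∷ []) (apart₃ refl refl refl)
      Tossed : Post K
      Tossed b T′ w = T′ ≡ T × w ≡ (if b then 2 ^ copyTimeᴸ * bodyWeight true l else 2 ^ copyTimeᴸ
        * bodyWeight false 0)
      prepared₀ : Prepared 0 T
      prepared₀ = record { Ready R ; holds = λ
        { 0F → blank 0F ; 1F → blank 1F ; 2F → blank 2F ; 3F → blank 3F ; 4F → blank 4F
        ; j@(suc (suc (suc (suc (suc _))))) → blanks {T} j (blank j) } }
      -- This is the branch of the uniform guesses, in which the numeral of l is copied to the last
      -- argument and to its shadow.
      biased : Hit (variant true) (TrialPost T) (copyTimeᴸ + bodyTime) (2 ^ copyTimeᴸ * bodyWeight true l)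
        (start (variant true)) T
      biased = after-runs F {Kk = const (body true)} (copy-runs (toBits l)) pre λ T₁ ag →
        body-hit true {T₀ = T} le ≤-refl (prepared T₁ ag) λ i e → trans (ag i)
          (override-elsewhere extendBlock F copies (T !_) out i e)
        where
        copies : Vec Tape 3
        copies = load (toBits l) ∷ load (toBits l) ∷ load (toBits l) ∷ []
        pre : ∀ j → T ! ι F j ≡ lookup (load (toBits l) ∷ load [] ∷ load [] ∷ []) j
        pre 0F = amount≡
        pre 1F = proj₁ (blank 4F)
        pre 2F = proj₂ (blank 4F)
        out : ∀ j → lookup copies j ≡ T ! ι F j ⊎ ∃[ x ] which (ι F j) ≡ just x
        out 0F = inj₁ (sym amount≡)
        out 1F = inj₂ (_ , refl)
        out 2F = inj₂ (_ , refl)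
        prepared : ∀ T₁ → Agrees T₁ (override F copies (T !_)) → Prepared l T₁
        prepared T₁ ag = record
          { cells = cells ; cells-n = cells-n ; elements≡ = trans (ag elements) elements≡ ; input≡ = trans
            (ag input) input≡
          ; holds = λ { 0F → keep 0F (blank 0F) ; 1F → keep 1F (blank 1F) ; 2F → keep 2F (blank 2F) ; 3F →
            keep 3F (blank 3F)
                      ; 4F → ag (main 4F) , ag (shadow 4F)
                      ; j@(suc (suc (suc (suc (suc _))))) → blanks {T₁} j (trans (ag (main j))
                        (proj₁ (blank j)) , trans (ag (shadow j)) (proj₂ (blank j))) } }
          where
          keep : ∀ j {t} → override F copies (T !_) (main j) ≡ t × override F copies (T !_) (shadow j) ≡ t →
            T₁ ! main j ≡ t × T₁ ! shadow j ≡ t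
          keep j (p , q) = trans (ag (main j)) p , trans (ag (shadow j)) q
      next′ : ∀ b T′ w → Tossed b T′ w → Hit (variant b) (TrialPost T) (copyTimeᴸ + bodyTime) w
        (start (variant b)) T′
      next′ true  _ _ (refl , refl) = biased
      -- This branch copies no numeral; padding by the time of that copy makes the branches equally
      -- long.
      next′ false _ _ (refl , refl) = Hit-lower (≤-reflexive (*-comm (2 ^ copyTimeᴸ) (bodyWeight false 0)))
        (subst (λ t → Hit (body false) (TrialPost T) t (bodyWeight false 0 * 2 ^ copyTimeᴸ)
          (start (body false)) T) (+-comm bodyTime copyTimeᴸ)
          (Hit-pad copyTimeᴸ (body-hit false {T₀ = T} le₀ (+-monoʳ-≤ (length encoding + size) z≤n) prepared₀
            (λ _ _ → refl))))

    module Rounds (le : time l ≤ Γ) (le₀ : time 0 ≤ Γ) (m : ℕ) where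

      Refreshed : List Bool → Bool → Vec Tape K → Set
      Refreshed u b T = b ≡ hasZero u × Ready T × T ! counter ≡ load (increment u)

      refresh-reach : ∀ {T T′ u} → Ready T → T ! counter ≡ load u → length u ≡ m →
        (∀ j → Dirty extendBlock b₀ T′ j) → Elsewhere extendBlock T T′ → Reach refresh (Refreshed u)
          (refreshTime m) T′
      refresh-reach {T} {T′} {u} R c≡ refl dirty els = branch-surely {K = const
        (on (counter ∷ []) ([] ∷ []) increments)} (cleanUp-reach extendBlock (allFin _) dirty)
        λ { b T₁ (refl , els₁ , bls) → Hit-weaken (post T₁ els₁ bls)
              (lift-hit F {Silent} {IsQuery} (λ _ ()) answer (increments-runs u) (λ _ → refl)
                λ { 0F → trans (els₁ counter refl) (trans (els counter refl) c≡) }) }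
        where
        F = names (counter ∷ []) ([] ∷ [])
        post : ∀ T₁ → Elsewhere extendBlock T′ T₁ → (∀ j → j ∈ allFin _ ⊎ Blank extendBlock T′ j →
          Blank extendBlock T₁ j) →
          ∀ b T₂ w → Framed F {Silent} {IsQuery} (λ _ ()) answer (Surely (λ b′ ts → b′ ≡ hasZero u × ts
            ≡ load (increment u) ∷ [])) (T₁ !_) b T₂ w →
          Refreshed u b T₂
        post T₁ els₁ bls b T₂ w (_ , (refl , refl) , ag) = refl , ready , ag counter
          where
          open Ready R
          back-to : ∀ i → which i ≡ nothing → i ≢ counter → T₂ ! i ≡ T ! i
          back-to i e i≢c with override-cases F (load (increment u) ∷ []) (T₁ !_) i
          ... | inj₂ eq              = trans (ag i) (trans eq (trans (els₁ i e) (els i e)))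
          ... | inj₁ (0F , i≡c , _) with () ← i≢c i≡c
          ready : Ready T₂
          ready = record
            { cells = cells ; cells-n = cells-n
            ; elements≡ = trans (back-to elements refl λ ()) elements≡
            ; input≡    = trans (back-to input refl λ ()) input≡
            ; amount≡   = trans (back-to amount refl λ ()) amount≡
            ; blank     = λ { 0F → trans (ag query) (proj₁ (blanked 0F)) , trans (ag (extend′ 0F))
              (proj₂ (blanked 0F))
                            ; (suc j) → trans (ag (extend j)) (proj₁ (blanked (suc j))) ,
                              trans (ag (extend′ (suc j))) (proj₂ (blanked (suc j))) } }
            where
            blanked : ∀ j → Blank extendBlock T₁ j
            blanked j = bls j (inj₁ (∈-allFin j))

      -- After a failed trial nothing but a bound on the marked cells is known of the tapes of the
      -- extension machine. All others still agree with the tapes T from which the trial started,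
      -- and the invariant of T is what cleaning restores.
      Inv Mid : List Bool → Vec Tape K → Set
      Inv u T = Ready T × T ! counter ≡ load u × length u ≡ m
      Mid u T′ = ∃[ T ] Inv u T × (∀ j → Dirty extendBlock b₀ T′ j) × Elsewhere extendBlock T T′

      tried : ∀ {a} → (∀ {T} → Ready T → Hit trial (TrialPost T) trialTime a (start trial) T) →
        ∀ {u T} → Inv u T → Hit trial (Repetition.Tried answer trial refresh (IsYes I) Inv Mid trialTime
          (refreshTime m) a u) trialTime a (start trial) T
      tried h {T = T} inv@(R , _) = Hit-weaken (λ { b T′ w (eq , found , dirty , els) → eq , found , λ _ →
        T , inv , dirty , els }) (h R)

      refreshed : ∀ {u T′} → Mid u T′ → Reach refresh (λ b T″ → b ≡ hasZero u × (b ≡ true →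
        Inv (increment u) T″)) (refreshTime m) T′
      refreshed {u} (T , (R , c≡ , len) , dirty , els) = Hit-weaken
        (λ { b T″ w (eq , R′ , c≡′) → eq , λ z → R′ , c≡′ , trans (length-increment u
          (trans (sym eq) z)) len })
        (refresh-reach R c≡ len dirty els)

  -- Setting up

  reach-on : ∀ {k} (ns : Vec Ix k) (ap : AllPairs Apart ns) {F : Frag k Silent} {Φ : Bool → Vec Tape k →
    Set} {τ ts T} → Reach F Φ τ ts →
    (∀ j → T ! lookup ns j ≡ lookup ts j) →
    Reach (on ns ap F) (λ b T′ → ∃[ ts′ ] Φ b ts′ × Agrees T′ (override (names ns ap) ts′ (T !_))) τ T
  reach-on ns ap h pre = lift-hit (names ns ap) {Silent} {IsQuery} (λ _ ()) answer h (λ _ → refl) pre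

  record Quiet (T : Vec Tape K) : Set where
    field
      input≡  : T ! input ≡ load encoding
      extends : ∀ j → T ! extend j ≡ load []
      shadows : ∀ j → T ! extend′ j ≡ load []

  data Reserved : Ix → Set where
    inputs  : Reserved input
    extendeds : ∀ {j} → Reserved (extend j)
    shadoweds : ∀ {j} → Reserved (extend′ j)

  quiet : ∀ {T T′} → (∀ {i} → Reserved i → T′ ! i ≡ T ! i) → Quiet T → Quiet T′
  quiet same Qt = record { input≡ = trans (same inputs) input≡ ; extends = λ j → trans (same extendeds)
    (extends j) ; shadows = λ j → trans (same shadoweds) (shadows j) }
    where open Quiet Qt

  record Common (u : List Bool) (c : ℕ) (T : Vec Tape K) : Set where
    field
      quiets    : Quiet T
      cells     : List Bool
      cells-n   : length cells ≡ size
      elements≡ : T ! elements ≡ load cells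
      query≡    : T ! query ≡ load []
      amount≡   : T ! amount ≡ load (toBits c)
      counter≡  : T ! counter ≡ load u

  Measuring : List Bool → List Bool → ℕ → Vec Tape K → Set
  Measuring w u c T = Common u c T × T ! size₂ ≡ load w

  shift : ∀ {u c T T₁ ts} → Agrees T₁ (override (names (size₂ ∷ []) ([] ∷ [])) ts (T !_)) → Common u c T →
    Common u c T₁
  shift {T = T} {T₁} ag M = record
    { quiets = quiet {T} {T₁} (λ { {i} inputs → ag i ; {i} extendeds → ag i ; {i} shadoweds → ag i }) quiets
    ; cells = cells ; cells-n = cells-n
    ; elements≡ = trans (ag elements) elements≡
    ; query≡ = trans (ag query) query≡
    ; amount≡ = trans (ag amount) amount≡
    ; counter≡ = trans (ag counter) counter≡ }
    where open Common M

  advance-reach : ∀ {w u c T} → Measuring w u c T →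
    Reach advance (λ b T′ → b ≡ true × Measuring w (drop (length w) u) (suc c) T′)
      (sweep (length (toBits c)) 0 + sweep (length w) 0) T
  advance-reach {w} {u} {c} {T} M = branch-surely {F = on (amount ∷ []) ([] ∷ []) increments} {K = const
    (on (size₂ ∷ counter ∷ []) (apart₂ refl) drain)}
    (reach-on (amount ∷ []) ([] ∷ []) (increments-runs (toBits c)) λ { 0F → amount≡ })
    λ { b T₁ (_ , (_ , refl) , ag₁) → Hit-weaken (post T₁ ag₁)
          (reach-on (size₂ ∷ counter ∷ []) (apart₂ refl) (drain-runs w u) λ { 0F →
            trans (ag₁ size₂) size≡ ; 1F → trans (ag₁ counter) counter≡ }) }
    where
    open Common (proj₁ M)
    size≡ = proj₂ M
    F₁ = names (amount ∷ []) ([] ∷ [])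
    F₂ = names (size₂ ∷ counter ∷ []) (apart₂ refl)
    post : ∀ T₁ → Agrees T₁ (override F₁ (load (toBits (suc c)) ∷ []) (T !_)) → ∀ b T₂ w′ →
      (∃[ ts ] (b ≡ true × ts ≡ load w ∷ load (drop (length w) u) ∷ []) × Agrees T₂ (override F₂ ts
        (T₁ !_))) →
      b ≡ true × Measuring w (drop (length w) u) (suc c) T₂
    post T₁ ag₁ b T₂ w′ (_ , (eq , refl) , ag₂) = eq , record
      { quiets = quiet {T} {T₂} (λ { inputs → trans (ag₂ input) (ag₁ input) ; (extendeds {j}) →
        trans (ag₂ (extend j)) (ag₁ (extend j)) ; (shadoweds {j}) → trans (ag₂ (extend′ j))
        (ag₁ (extend′ j)) }) quiets
      ; cells = cells ; cells-n = cells-n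
      ; elements≡ = trans (ag₂ elements) (trans (ag₁ elements) elements≡)
      ; query≡ = trans (ag₂ query) (trans (ag₁ query) query≡)
      ; amount≡ = trans (ag₂ amount) (ag₁ amount)
      ; counter≡ = ag₂ counter } , ag₂ size₂

  -- The loop divides the length of the numeral by q: it stops when fewer than q bits are left,
  -- which is why ρ < q is assumed. The last, incomplete removal spoils only `size₂`, about which
  -- `Common` says nothing.
  measure-reach : ∀ {ρ} ℓ {w u c T} → ρ < q → length w ≡ ρ + ℓ * q → Measuring w u c T →
    Reach measure (λ _ → Common (drop (erased q ρ ℓ) u) (c + ℓ)) (measureTime q ρ c ℓ) T
  measure-reach {ρ} zero {w} {u} {c} {T} ρ<q len M = Reach-≤ (≤-reflexive (+-identityʳ (q + 1)))
    (loop-first-surely {F = chunk} {G = advance} {ρ = 0}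
      (reach-on (size₂ ∷ []) ([] ∷ []) {F = eraseBits q} {Φ = λ b _ → b ≡ true} (eraseBits-stops q w
        (≤-trans (≤-reflexive (cong suc (trans len (+-identityʳ ρ)))) ρ<q)) λ { 0F → proj₂ M })
      λ { b T₁ (ts , refl , ag) → done (subst (λ x → Common u x T₁) (sym (+-identityʳ c))
        (shift {T = T} {T₁} {ts} ag (proj₁ M))) })
  measure-reach {ρ} (suc ℓ) {w} {u} {c} {T} ρ<q len M = loop-first-surely {F = chunk} {G = advance}
    (reach-on (size₂ ∷ []) ([] ∷ []) {F = eraseBits q} (eraseBits-runs q w q≤) λ { 0F → proj₂ M })
    λ { b T₁ (_ , (refl , refl) , ag) → running (loop-second-surely {F = chunk} {G = advance}
          (Reach-≤ (≤-reflexive (cong (λ x → sweep (length (toBits c)) 0 + sweep x 0) len′))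
            (advance-reach (shift {T = T} {T₁} {load (drop q w) ∷ []} ag (proj₁ M) , ag size₂)))
          again) }
    where
    q≤ : q ≤ length w
    q≤ = ≤-trans (≤-trans (m≤m+n q (ℓ * q)) (m≤n+m _ ρ)) (≤-reflexive (sym len))
    len′ : length (drop q w) ≡ ρ + ℓ * q
    len′ = trans (length-drop q w) (trans (cong (_∸ q) (trans len (trans (sym (+-assoc ρ q _))
      (trans (cong (_+ ℓ * q) (+-comm ρ q)) (+-assoc q ρ _))))) (m+n∸m≡n q _))
    again : ∀ b T₂ → b ≡ true × Measuring (drop q w) (drop (length (drop q w)) u) (suc c) T₂ →
      After measure (Surely λ _ → Common (drop (erased q ρ (suc ℓ)) u) (c + suc ℓ)) (measureTime q ρ
        (suc c) ℓ) 0
        ((if b then inj₁ (inj₁ (start chunk)) else inj₂ false) , T₂)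
    again b T₂ (refl , M₂) = running (Hit-weaken (λ _ T′ _ → subst₂ (λ x y → Common x y T′)
      (trans (drop-drop (length (drop q w)) (erased q ρ ℓ) u) (cong (λ x → drop (x + erased q ρ ℓ) u) len′))
        (sym (+-suc c ℓ)))
      (measure-reach ℓ ρ<q len′ M₂))

  Strings : List (List Bool) → Vec Tape K → Set
  Strings ws T = ∃[ u ] ∃[ v ] T ! ground 0F ≡ tape u v × prefix v ≡ encodeStrings ws

  record Tallying (n c : ℕ) (T : Vec Tape K) : Set where
    field
      quiets    : Quiet T
      marked    : Marked n (T ! query) (T ! ground′ 0F)
      cells     : List Bool
      cells-n   : length cells ≡ c
      elements≡ : T ! elements ≡ bits cells []
      counter≡  : T ! counter ≡ bits (replicate c false) []
      size≡     : T ! size₂ ≡ load (toBits c)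
      amount≡   : T ! amount ≡ load []

  numbering-reach : ∀ {n c T ws m} → Strings ws T → Quiet T → Marked n (T ! query) (T ! ground′ 0F) →
    length m ≡ c →
    T ! elements ≡ bits (true ∷ m) [] → T ! counter ≡ bits (false ∷ replicate c false) [] →
    T ! size₂ ≡ load (toBits c) → T ! amount ≡ load [] →
    Reach numbering (λ b T′ → b ≡ true × Strings ws T′ × Tallying n (suc c) T′) (sweep (length (toBits c)) 0
      + 1) T
  numbering-reach {n} {c} {T} {ws} {m} (u , v , out≡ , pre) Qt mk m≡ el≡ cn≡ sz≡ am≡ =
    branch-surely {F = on (size₂ ∷ []) ([] ∷ []) increments} {K = const (exit true)}
      (reach-on (size₂ ∷ []) ([] ∷ []) (increments-runs (toBits c)) λ { 0F → sz≡ })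
      λ { b T₁ (_ , (_ , refl) , ag) → Hit-weaken (λ { _ _ _ (refl , refl) → refl ,
        (u , v , trans (ag (ground 0F)) out≡ , pre) , post T₁ ag })
            (exit-runs true T₁) }
    where
    post : ∀ T₁ → Agrees T₁ (override (names (size₂ ∷ []) ([] ∷ [])) (load (toBits (suc c)) ∷ []) (T !_)) →
      Tallying n (suc c) T₁
    post T₁ ag = record
      { quiets = quiet {T} {T₁} (λ { {i} inputs → ag i ; {i} extendeds → ag i ; {i} shadoweds → ag i }) Qt
      ; marked = subst₂ (Marked n) (sym (ag query)) (sym (ag (ground′ 0F))) mk
      ; cells = true ∷ m ; cells-n = cong suc m≡
      ; elements≡ = trans (ag elements) el≡ ; counter≡ = trans (ag counter) cn≡ ; size≡ =
        ag size₂ ; amount≡ = trans (ag amount) am≡ }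

  tally-reach : ∀ {n} ws {c T} → Strings ws T → Tallying n c T →
    Reach tally (λ _ → Tallying n (c + length ws)) (tallyTime c ws) T
  tally-reach {n} [] {c} {T} (u , v , out≡ , pre) M =
    loop-first-surely {F = parsing} {G = numbering} {ρ = 0}
      (reach-on (ground 0F ∷ elements ∷ counter ∷ []) (apart₃ refl refl refl) (parse-stops cells
        (replicate c false) pre)
        λ { 0F → out≡ ; 1F → elements≡ ; 2F → counter≡ })
      λ { b T₁ (_ , (refl , t , refl) , ag) → done (subst (λ x → Tallying n x T₁) (sym (+-identityʳ c))
        (post T₁ t ag)) }
    where
    open Tallying M
    post : ∀ T₁ t → Agrees T₁ (override (names (ground 0F ∷ elements ∷ counter ∷ []) (apart₃ refl refl refl))
                        (t ∷ bits cells [] ∷ bits (replicate c false) [] ∷ []) (T !_)) → Tallying n c T₁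
    post T₁ t ag = record
      { quiets = quiet {T} {T₁} (λ { {i} inputs → ag i ; {i} extendeds → ag i ; {i} shadoweds → ag i }) quiets
      ; marked = subst₂ (Marked n) (sym (ag query)) (sym (ag (ground′ 0F))) marked
      ; cells = cells ; cells-n = cells-n
      ; elements≡ = ag elements ; counter≡ = ag counter ; size≡ = trans (ag size₂) size≡ ; amount≡ = trans
        (ag amount) amount≡ }
  tally-reach {n} (w ∷ ws) {c} {T} (u , v , out≡ , pre) M =
    loop-first-surely {F = parsing} {G = numbering}
      (reach-on (ground 0F ∷ elements ∷ counter ∷ []) (apart₃ refl refl refl) (parse-hit w {v′ = ws} pre)
        λ { 0F → out≡ ; 1F → elements≡ ; 2F → counter≡ })
      λ { b T₁ (_ , (refl , u′ , v′ , pre′ , refl) , ag) → running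
            (loop-second-surely {F = parsing} {G = numbering} (second T₁ u′ v′ pre′ ag)
              λ { b T₂ (refl , S₂ , M₂) → running
              (Hit-weaken (λ _ T′ _ → subst (λ x → Tallying n x T′) (sym (+-suc c (length ws))))
                (tally-reach ws S₂ M₂)) }) }
    where
    open Tallying M
    second : ∀ T₁ u′ v′ → prefix v′ ≡ encodeStrings ws →
      Agrees T₁ (override (names (ground 0F ∷ elements ∷ counter ∷ []) (apart₃ refl refl refl))
                   (tape u′ v′ ∷ bits (true ∷ cells) [] ∷ bits (false ∷ replicate c false) [] ∷ []) (T !_)) →
      Reach numbering (λ b T′ → b ≡ true × Strings ws T′ × Tallying n (suc c) T′)
        (sweep (length (toBits c)) 0 + 1) T₁
    second T₁ u′ v′ pre′ ag = numbering-reach {ws = ws} {m = cells} (u′ , v′ , ag (ground 0F) , pre′)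
      (quiet {T} {T₁} (λ { {i} inputs → ag i ; {i} extendeds → ag i ; {i} shadoweds → ag i }) quiets)
      (subst₂ (Marked n) (sym (ag query)) (sym (ag (ground′ 0F))) marked) cells-n
      (ag elements) (ag counter) (trans (ag size₂) size≡) (trans (ag amount) amount≡)

  replicate-ʳ++ : ∀ c k → replicate c false ʳ++ replicate k false ≡ replicate (c + k) false
  replicate-ʳ++ zero    k = refl
  replicate-ʳ++ (suc c) k = trans (replicate-ʳ++ c (suc k)) (cong (λ x → replicate x false) (+-suc c k))

  record Rewound (n : ℕ) (T : Vec Tape K) : Set where
    field
      quiets    : Quiet T
      marked    : Marked n (T ! query) (T ! ground′ 0F)
      cells     : List Bool
      cells-n   : length cells ≡ size
      elements≡ : T ! elements ≡ load cells
      counter≡  : T ! counter ≡ load (replicate (2 + size) false)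
      size≡     : T ! size₂ ≡ load (toBits size)
      amount≡   : T ! amount ≡ load []

  finish-reach : ∀ {n T} → Tallying n size T → Reach finishing (λ _ → Rewound n) (3 + size) T
  finish-reach {n} {T} M = Reach-≤ (≤-reflexive (cong (3 +_) (length-replicate size)))
    (Hit-weaken (λ { b T₁ w (_ , (refl , refl) , ag) → post T₁ ag })
    (reach-on (elements ∷ counter ∷ []) (apart₂ refl) (finish-runs cells (replicate size false)
      (trans cells-n (sym (length-replicate size))))
      λ { 0F → elements≡ ; 1F → counter≡ }))
    where
    open Tallying M
    post : ∀ T₁ → Agrees T₁ (override (names (elements ∷ counter ∷ []) (apart₂ refl))
             (load (cells ʳ++ []) ∷ load (false ∷ false ∷ (replicate size false ʳ++ [])) ∷ []) (T !_)) →
               Rewound n T₁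
    post T₁ ag = record
      { quiets = quiet {T} {T₁} (λ { {i} inputs → ag i ; {i} extendeds → ag i ; {i} shadoweds → ag i }) quiets
      ; marked = subst₂ (Marked n) (sym (ag query)) (sym (ag (ground′ 0F))) marked
      ; cells = cells ʳ++ [] ; cells-n = trans (length-ʳ++ cells) (trans (+-identityʳ _) cells-n)
      ; elements≡ = ag elements
      ; counter≡ = trans (ag counter) (cong (λ w → load (false ∷ false ∷ w)) (trans (replicate-ʳ++ size 0)
        (cong (λ x → replicate x false) (+-identityʳ size))))
      ; size≡ = trans (ag size₂) size≡ ; amount≡ = trans (ag amount) amount≡ }

  -- Of the tapes used by the machine for the ground set only the query tape is needed again, so the
  -- others need not be cleaned.
  clean-query : ∀ {n T} → Rewound n T → Reach cleaningQuery
    (λ _ → Measuring (toBits size) (replicate (2 + size) false) 0) (2 + 2 * n) T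
  clean-query {n} {T} M = Hit-weaken (λ { b T₁ w (_ , (refl , refl) , ag) → post T₁ ag })
    (reach-on (query ∷ ground′ 0F ∷ []) (apart₂ refl) (clean-runs marked) λ { 0F → refl ; 1F → refl })
    where
    open Rewound M
    post : ∀ T₁ → Agrees T₁ (override (names (query ∷ ground′ 0F ∷ []) (apart₂ refl)) (load [] ∷ load []
      ∷ []) (T !_)) →
           Measuring (toBits size) (replicate (2 + size) false) 0 T₁
    post T₁ ag = record
      { quiets = quiet {T} {T₁} (λ { {i} inputs → ag i ; {i} extendeds → ag i ; {i} shadoweds → ag i }) quiets
      ; cells = cells ; cells-n = cells-n ; elements≡ = trans (ag elements) elements≡ ; query≡ = ag query
      ; amount≡ = trans (ag amount) amount≡ ; counter≡ = trans (ag counter) counter≡ } ,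
        trans (ag size₂) size≡

  module Starting (TG : ℕ) where
    open Block groundBlock using (main; shadow; which; focus; retract′; allowed)

    groundArgs : Vec Tape (3 + Machine.work G)
    groundArgs = load [] ∷ load [] ∷ load encoding ∷ Vec.replicate _ (load [])

    groundArgs-shadowed : ∀ j → Shadowed (length encoding) (lookup groundArgs j) (lookup groundArgs j)
    groundArgs-shadowed 0F = shadowed-load [] z≤n
    groundArgs-shadowed 1F = shadowed-load [] z≤n
    groundArgs-shadowed 2F = shadowed-load encoding ≤-refl
    groundArgs-shadowed (suc (suc (suc j))) rewrite lookup-replicate {n = Machine.work G} j (load []) =
      shadowed-load [] z≤n

    record Copied (T : Vec Tape K) : Set where
      field
        quiets    : Quiet T
        holds     : ∀ j → T ! main j ≡ lookup groundArgs j × T ! shadow j ≡ lookup groundArgs j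
        elements≡ : T ! elements ≡ load []
        counter≡  : T ! counter ≡ load []
        size≡     : T ! size₂ ≡ load []
        amount≡   : T ! amount ≡ load []

    Fresh : Vec Tape K → Set
    Fresh T = T ! input ≡ load encoding × (∀ i → i ≢ input → T ! i ≡ load [])

    copy-reach : ∀ {T} → Fresh T → Reach copyInput (λ _ → Copied) (sweep (length encoding) 0) T
    copy-reach {T} (in≡ , blank) = Hit-weaken (λ { b T₁ w (_ , (refl , refl) , ag) → post T₁ ag })
      (reach-on (input ∷ ground 1F ∷ ground′ 2F ∷ []) (apart₃ refl refl refl) (copy-runs encoding)
        λ { 0F → in≡ ; 1F → blank (ground 1F) (λ ()) ; 2F → blank (ground′ 2F) (λ ()) })
      where
      post : ∀ T₁ → Agrees T₁ (override (names (input ∷ ground 1F ∷ ground′ 2F ∷ []) (apart₃ refl refl refl))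
                                 (load encoding ∷ load encoding ∷ load encoding ∷ []) (T !_)) → Copied T₁
      post T₁ ag = record
        { quiets = record { input≡ = ag input ; extends = λ j → trans (ag (extend j)) (blank (extend j)
          λ ()) ; shadows = λ j → trans (ag (extend′ j)) (blank (extend′ j) λ ()) }
        ; holds = λ { 0F → trans (ag query) (blank query λ ()) , trans (ag (ground′ 0F)) (blank (ground′ 0F)
          λ ())
                    ; 1F → trans (ag (ground 0F)) (blank (ground 0F) λ ()) , trans (ag (ground′ 1F))
                      (blank (ground′ 1F) λ ())
                    ; 2F → ag (ground 1F) , ag (ground′ 2F)
                    ; (suc (suc (suc j))) → trans (ag (ground (suc (suc j))))
                      (trans (blank (ground (suc (suc j))) λ ()) (sym (lookup-replicate j (load []))))
                                          , trans (ag (ground′ (suc (suc (suc j)))))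
                                            (trans (blank (ground′ (suc (suc (suc j)))) λ ()) (sym
                                            (lookup-replicate j (load [])))) }
        ; elements≡ = trans (ag elements) (blank elements λ ()) ; counter≡ = trans (ag counter)
          (blank counter λ ())
        ; size≡ = trans (ag size₂) (blank size₂ λ ()) ; amount≡ = trans (ag amount) (blank amount λ ()) }

    module _ (computes : GroundWithin I G TG) where

      marks : ℕ
      marks = suc (TG + length encoding)

      Final : Bool → Vec Tape (3 + Machine.work G) → Set
      Final _ a = contents (Vec.head (Vec.tail a)) ≡ encodeStrings strings

      ground-reach : ∀ {T} → Copied T → Reach callGround (λ _ T′ → Strings strings T′ × Tallying marks 0 T′)
        (suc TG) T
      ground-reach {T} C = Hit-weaken (λ { b T₁ w (_ , (a , a′ , refl , fin , mk , _) , ag) →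
        post T₁ a a′ fin mk ag })
        (Hit-lower z≤n (lift-hit focus {_≡ zero} {IsQuery} allowed answer
          (Calling.call-hit G {Q = _≡ zero} refl answer {Final} TG {a = groundArgs} {groundArgs}
            groundArgs-shadowed
            (λ coins → true , proj₁ (computes coins) , proj₂ (computes coins))) (λ _ → refl) pre))
        where
        open Copied C
        pre : ∀ p → T ! ι focus p ≡ lookup (groundArgs Vec.++ groundArgs) p
        pre p rewrite lookup-splitAt (3 + Machine.work G) groundArgs groundArgs p with splitAt
          (3 + Machine.work G) p
        ... | inj₁ j = proj₁ (holds j)
        ... | inj₂ j = proj₂ (holds j)
        post : ∀ T₁ a a′ → contents (Vec.head (Vec.tail a)) ≡ encodeStrings strings →
          (∀ j → Marked marks (lookup a j) (lookup a′ j)) →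
          Agrees T₁ (override focus (a Vec.++ a′) (T !_)) → Strings strings T₁ × Tallying marks 0 T₁
        post T₁ a@(_ ∷ _ ∷ _) a′ fin mk ag = (_ , _ , at (inj₁ 1F) , fin) , record
          { quiets = quiet {T} {T₁} (λ { {i} inputs → ag i ; {i} extendeds → ag i ; {i} shadoweds →
            ag i }) quiets
          ; marked = subst₂ (Marked marks) (sym (at (inj₁ 0F)))
            (sym (trans (at (inj₂ 0F)) (lookup-++ʳ a a′ 0F))) (mk 0F)
          ; cells = [] ; cells-n = refl
          ; elements≡ = trans (ag elements) elements≡ ; counter≡ = trans (ag counter) counter≡
          ; size≡ = trans (ag size₂) size≡ ; amount≡ = trans (ag amount) amount≡ }
          where
          at : ∀ x → T₁ ! Sum.[ main , shadow ]′ x ≡ lookup (a Vec.++ a′) (join _ _ x)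
          at x = trans (ag _) (cong (maybe′ (lookup (a Vec.++ a′)) (T ! Sum.[ main , shadow ]′ x))
            (cong (Maybe.map (join _ _)) (retract′ x)))

      chain : ∀ {k Q} {F₁ F₂ F₃ F₄ F₅ F₆ : Frag k Q} {Φ₁ Φ₂ Φ₃ Φ₄ Φ₅ Φ₆ τ₁ τ₂ τ₃ τ₄ τ₅ τ₆ ts} →
        Reach F₁ Φ₁ τ₁ ts →
        (∀ b ts → Φ₁ b ts → Reach F₂ Φ₂ τ₂ ts) → (∀ b ts → Φ₂ b ts → Reach F₃ Φ₃ τ₃ ts) →
          (∀ b ts → Φ₃ b ts → Reach F₄ Φ₄ τ₄ ts) →
        (∀ b ts → Φ₄ b ts → Reach F₅ Φ₅ τ₅ ts) → (∀ b ts → Φ₅ b ts → Reach F₆ Φ₆ τ₆ ts) →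
        Reach (F₁ ⨾ F₂ ⨾ F₃ ⨾ F₄ ⨾ F₅ ⨾ F₆) Φ₆ (τ₁ + (τ₂ + (τ₃ + (τ₄ + (τ₅ + τ₆))))) ts
      chain h₁ h₂ h₃ h₄ h₅ h₆ = ⨾-surely h₁ λ b₁ t₁ p₁ → ⨾-surely (h₂ b₁ t₁ p₁) λ b₂ t₂ p₂ →
        ⨾-surely (h₃ b₂ t₂ p₂) λ b₃ t₃ p₃ →
        ⨾-surely (h₄ b₃ t₃ p₃) λ b₄ t₄ p₄ → ⨾-surely (h₅ b₄ t₄ p₄) h₆

      setupTime : ℕ → ℕ → ℕ
      setupTime ρ ℓ = sweep (length encoding) 0 + (suc TG + (tallyTime 0 strings
        + ((3 + size) + ((2 + 2 * marks) + measureTime q ρ 0 ℓ))))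

      setup-reach : ∀ {ρ ℓ T} → ρ < q → length (toBits size) ≡ ρ + ℓ * q → Fresh T →
        Reach setup (λ _ → Common (drop (erased q ρ ℓ) (replicate (2 + size) false)) ℓ) (setupTime ρ ℓ) T
      setup-reach {ρ} {ℓ} ρ<q len fr =
        chain {F₁ = copyInput} {callGround} {tally} {finishing} {cleaningQuery} {measure} (copy-reach fr)
          (λ _ _ C → ground-reach C)
              (λ _ _ (S , M) → tally-reach strings S M) (λ _ _ M → finish-reach M) (λ _ _ M → clean-query M)
                (λ _ _ M → measure-reach ℓ ρ<q len M)

-- Polynomial bounds

IsPoly : (ℕ → ℕ) → Set
IsPoly f = ∃[ c ] ∀ x → f x ≤ poly c x

1≤[1+x]^ : ∀ x c → 1 ≤ suc x ^ c
1≤[1+x]^ x c = m^n>0 (suc x) c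

const-poly : ∀ k → IsPoly (λ _ → k)
const-poly k = k , λ x → ≤-trans (≤-reflexive (sym (*-identityʳ k))) (*-monoʳ-≤ k (1≤[1+x]^ x k))

id-poly : IsPoly (λ x → x)
id-poly = 1 , λ x → ≤-trans (n≤1+n x) (≤-reflexive (sym (trans (*-identityˡ _) (*-identityʳ _))))

poly-poly : ∀ c → IsPoly (poly c)
poly-poly c = c , λ x → ≤-refl

infixl 6 _⊕_
infixl 7 _⊗_

_⊕_ : ∀ {f g} → IsPoly f → IsPoly g → IsPoly (λ x → f x + g x)
_⊕_ {f} {g} (c , p) (d , q) = c + d , λ x → begin
  f x + g x                                       ≤⟨ +-mono-≤ (p x) (q x) ⟩
  c * suc x ^ c + d * suc x ^ d                   ≤⟨ +-mono-≤ (*-monoʳ-≤ c (^-monoʳ-≤ (suc x) (m≤m+n c d)))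
    (*-monoʳ-≤ d (^-monoʳ-≤ (suc x) (m≤n+m d c))) ⟩
  c * suc x ^ (c + d) + d * suc x ^ (c + d)       ≡⟨ *-distribʳ-+ _ c d ⟨
  (c + d) * suc x ^ (c + d)                       ∎
  where open ≤-Reasoning

-- In `poly` one number is both coefficient and exponent, so it has to dominate the product c d and
-- the sum c + d.
_⊗_ : ∀ {f g} → IsPoly f → IsPoly g → IsPoly (λ x → f x * g x)
_⊗_ {f} {g} (c , p) (d , q) = c * d + (c + d) , λ x → begin
  f x * g x                                       ≤⟨ *-mono-≤ (p x) (q x) ⟩
  c * suc x ^ c * (d * suc x ^ d)                 ≡⟨ lemma c (suc x ^ c) d (suc x ^ d) ⟩
  c * d * (suc x ^ c * suc x ^ d)                 ≡⟨ cong (c * d *_) (^-distribˡ-+-* (suc x) c d) ⟨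
  c * d * suc x ^ (c + d)                         ≤⟨ *-mono-≤ (m≤m+n (c * d) (c + d)) (^-monoʳ-≤ (suc x)
    (m≤n+m (c + d) (c * d))) ⟩
  poly (c * d + (c + d)) x                        ∎
  where
  open ≤-Reasoning
  lemma : ∀ a b c d → a * b * (c * d) ≡ a * c * (b * d)
  lemma = solve-∀

guessTime-linear : ∀ n l → guessTime n l ≡ 5 * n + l + 2
guessTime-linear zero    l = +-comm 2 l
guessTime-linear (suc n) l rewrite guessTime-linear n (suc l) = lemma n l
  where
  lemma : ∀ n l → 4 + (5 * n + suc l + 2) ≡ 5 * suc n + l + 2
  lemma = solve-∀

-- The bounds that follow from numbers of elements, bits and strings being at most N.
roundPoly : ℕ → ℕ → ℕ → ℕ → ℕ
roundPoly k N x p = 1 + ((2 + 2 * N) + ((5 * N + 2) + ((2 + 2 * x) + (1 + p))))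
                  + (k * (2 + 2 * (1 + (p + (x + N + N)))) + 1 + (2 + 2 * (2 + N)))

-- The exponential factor e occurs only in the time of the call and in the cleaning after it, but as
-- e ≥ 1 it can be taken out of the whole round.
round≤ : ∀ k N x p e {n b m} → 1 ≤ e → n ≤ N → b ≤ N → m ≤ 2 + N →
  suc (sweep b 0 + (guessTime n 0 + (sweep x 0 + suc (e * p)))) + (k * (2 + 2 * suc (e * p + (x + n + b)))
    + 1 + sweep m 0)
  ≤ e * roundPoly k N x p
round≤ k N x p (suc c) {n} {b} {m} _ n≤ b≤ m≤ = begin
  suc (sweep b 0 + (guessTime n 0 + (sweep x 0 + suc (suc c * p))))
    + (k * (2 + 2 * suc (suc c * p + (x + n + b))) + 1 + sweep m 0)
    ≤⟨ +-mono-≤ (s≤s (+-mono-≤ (sweep≤ b≤) (+-mono-≤ guess≤ (+-monoˡ-≤ _ (sweep≤ {x} ≤-refl)))))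
                (+-mono-≤ (+-monoˡ-≤ 1 (*-monoʳ-≤ k
                  (+-monoʳ-≤ 2 (*-monoʳ-≤ 2 (s≤s (+-monoʳ-≤ (suc c * p) (+-mono-≤ (+-monoʳ-≤ x n≤) b≤)))))))
                  (sweep≤ m≤)) ⟩
  suc ((2 + 2 * N) + ((5 * N + 2) + ((2 + 2 * x) + suc (suc c * p))))
    + (k * (2 + 2 * suc (suc c * p + (x + N + N))) + 1 + (2 + 2 * (2 + N)))
    ≤⟨ m≤m+n _ (c * (1 + ((2 + 2 * N) + ((5 * N + 2) + ((2 + 2 * x) + 1)))
      + (k * (2 + 2 * (1 + (x + N + N))) + 1 + (2 + 2 * (2 + N))))) ⟩
  suc ((2 + 2 * N) + ((5 * N + 2) + ((2 + 2 * x) + suc (suc c * p))))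
    + (k * (2 + 2 * suc (suc c * p + (x + N + N))) + 1 + (2 + 2 * (2 + N)))
    + c * (1 + ((2 + 2 * N) + ((5 * N + 2) + ((2 + 2 * x) + 1))) + (k * (2 + 2 * (1 + (x + N + N))) + 1
      + (2 + 2 * (2 + N))))
    ≡⟨ lemma c k N x p ⟩
  suc c * roundPoly k N x p ∎
  where
  open ≤-Reasoning
  guess≤ : guessTime n 0 ≤ 5 * N + 2
  guess≤ = ≤-trans (≤-reflexive (trans (guessTime-linear n 0) (cong (_+ 2) (+-identityʳ (5 * n)))))
    (+-monoˡ-≤ 2 (*-monoʳ-≤ 5 n≤))
  lemma : ∀ c k N x p →
    suc ((2 + 2 * N) + ((5 * N + 2) + ((2 + 2 * x) + suc (suc c * p))))
      + (k * (2 + 2 * suc (suc c * p + (x + N + N))) + 1 + (2 + 2 * (2 + N)))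
    + c * (1 + ((2 + 2 * N) + ((5 * N + 2) + ((2 + 2 * x) + 1))) + (k * (2 + 2 * (1 + (x + N + N))) + 1
      + (2 + 2 * (2 + N))))
    ≡ suc c * (1 + ((2 + 2 * N) + ((5 * N + 2) + ((2 + 2 * x) + (1 + p))))
      + (k * (2 + 2 * (1 + (p + (x + N + N)))) + 1 + (2 + 2 * (2 + N))))
  lemma = solve-∀

setupPoly : ℕ → ℕ → ℕ → ℕ → ℕ
setupPoly q N x t = (2 + 2 * x) + ((1 + t) + ((N + N * (3 + 2 * N) + 1) + ((3 + N) + ((2 + 2 * (1 + (t + x)))
                  + (1 + N) * (q + 1 + ((2 + 2 * N) + (2 + 2 * N)))))))

setup≤ : ∀ q N x t ρ ℓ ws → length (encodeStrings ws) ≤ N → ℓ ≤ N → ρ + ℓ * q ≤ N →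
  sweep x 0 + (suc t + (tallyTime 0 ws + ((3 + length ws) + ((2 + 2 * suc (t + x)) + measureTime q ρ 0 ℓ))))
    ≤ setupPoly q N x t
setup≤ q N x t ρ ℓ ws enc≤ ℓ≤ len≤ = +-mono-≤ (sweep≤ {x} ≤-refl) (+-monoʳ-≤ (suc t) (+-mono-≤
  (≤-trans (tallyTime≤ 0 ws ws≤) (+-monoˡ-≤ 1 (+-mono-≤ enc≤ (*-monoˡ-≤ (3 + 2 * N) ws≤))))
  (+-mono-≤ (+-monoʳ-≤ 3 ws≤) (+-monoʳ-≤ (2 + 2 * suc (t + x))
    (≤-trans (measureTime≤ q ρ 0 ℓ ℓ≤ len≤) (*-monoˡ-≤ (q + 1 + ((2 + 2 * N) + (2 + 2 * N))) (s≤s ℓ≤)))))))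
  where
  ws≤ : length ws ≤ N
  ws≤ = ≤-trans (length≤encode ws) enc≤

roundPoly-poly : ∀ {N p} → IsPoly N → IsPoly p → ∀ k → IsPoly (λ x → roundPoly k (N x) x (p x))
roundPoly-poly N p k =
    K 1 ⊕ ((K 2 ⊕ K 2 ⊗ N) ⊕ ((K 5 ⊗ N ⊕ K 2) ⊕ ((K 2 ⊕ K 2 ⊗ id-poly) ⊕ (K 1 ⊕ p))))
  ⊕ (K k ⊗ (K 2 ⊕ K 2 ⊗ (K 1 ⊕ (p ⊕ (id-poly ⊕ N ⊕ N)))) ⊕ K 1 ⊕ (K 2 ⊕ K 2 ⊗ (K 2 ⊕ N)))
  where K = const-poly

setupPoly-poly : ∀ {N t} → IsPoly N → IsPoly t → ∀ q → IsPoly (λ x → setupPoly q (N x) x (t x))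
setupPoly-poly N t q =
  (K 2 ⊕ K 2 ⊗ id-poly) ⊕ ((K 1 ⊕ t) ⊕ ((N ⊕ N ⊗ (K 3 ⊕ K 2 ⊗ N) ⊕ K 1) ⊕ ((K 3 ⊕ N) ⊕
  ((K 2 ⊕ K 2 ⊗ (K 1 ⊕ (t ⊕ id-poly))) ⊕
  (K 1 ⊕ N) ⊗ (K (q + 1) ⊕ ((K 2 ⊕ K 2 ⊗ N) ⊕ (K 2 ⊕ K 2 ⊗ N)))))))
  where K = const-poly

-- This is why a = a′ + 1: in a ℓ² ≤ erased + a, the part a′ ℓ² pays for the extension call and the
-- remaining ℓ² is the saving. The time of the setup is multiplied by 2 ^ (ℓ²) too, which is
-- harmless because ℓ² ≤ n + a.
savings : ∀ a′ n ρ ℓ {setup round s r} → length (toBits n) ≡ ρ + ℓ * (4 * suc a′) →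
  setup ≤ s → round ≤ 2 ^ (a′ * ℓ ^ 2) * r →
  (setup + 2 ^ (2 + n ∸ erased (4 * suc a′) ρ ℓ) * round) * 2 ^ ℓ ^ 2 ≤ 2 ^ n * (2 ^ suc a′ * s
    + 2 ^ (2 + suc a′) * r)
savings a′ n ρ ℓ {setup} {round} {s} {r} len s≤ r≤ = begin
  (setup + 2 ^ m * round) * 2 ^ ℓ ^ 2
    ≤⟨ *-monoˡ-≤ (2 ^ ℓ ^ 2) (+-mono-≤ s≤ (*-monoʳ-≤ (2 ^ m) r≤)) ⟩
  (s + 2 ^ m * (2 ^ (a′ * ℓ ^ 2) * r)) * 2 ^ ℓ ^ 2
    ≡⟨ lemma s (2 ^ m) (2 ^ (a′ * ℓ ^ 2)) r (2 ^ ℓ ^ 2) ⟩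
  2 ^ ℓ ^ 2 * s + 2 ^ m * (2 ^ ℓ ^ 2 * 2 ^ (a′ * ℓ ^ 2)) * r
    ≡⟨ cong (λ z → 2 ^ ℓ ^ 2 * s + 2 ^ m * z * r) (^-distribˡ-+-* 2 (ℓ ^ 2) (a′ * ℓ ^ 2)) ⟨
  2 ^ ℓ ^ 2 * s + 2 ^ m * 2 ^ (a * ℓ ^ 2) * r
    ≡⟨ cong (λ z → 2 ^ ℓ ^ 2 * s + z * r) (^-distribˡ-+-* 2 m (a * ℓ ^ 2)) ⟨
  2 ^ ℓ ^ 2 * s + 2 ^ (m + a * ℓ ^ 2) * r
    ≤⟨ +-mono-≤ (*-monoˡ-≤ s (^-monoʳ-≤ 2 first≤)) (*-monoˡ-≤ r (^-monoʳ-≤ 2 second≤)) ⟩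
  2 ^ (n + a) * s + 2 ^ (n + (2 + a)) * r
    ≡⟨ cong₂ (λ y z → y * s + z * r) (^-distribˡ-+-* 2 n a) (^-distribˡ-+-* 2 n (2 + a)) ⟩
  2 ^ n * 2 ^ a * s + 2 ^ n * 2 ^ (2 + a) * r
    ≡⟨ lemma′ (2 ^ n) (2 ^ a) s (2 ^ (2 + a)) r ⟩
  2 ^ n * (2 ^ a * s + 2 ^ (2 + a) * r) ∎
  where
  open ≤-Reasoning
  a = suc a′
  hc = erased (4 * a) ρ ℓ
  m = 2 + n ∸ hc
  hc≤ : hc ≤ n
  hc≤ = erased≤ a′ n ρ ℓ len
  first≤ : ℓ ^ 2 ≤ n + a
  first≤ = ≤-trans (m≤m+n (ℓ ^ 2) (a′ * ℓ ^ 2)) (≤-trans (square≤erased a ρ ℓ) (+-monoˡ-≤ a hc≤))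
  second≤ : m + a * ℓ ^ 2 ≤ n + (2 + a)
  second≤ = ≤-trans (+-monoʳ-≤ m (square≤erased a ρ ℓ)) (≤-reflexive (begin-equality
    m + (hc + a)   ≡⟨ +-assoc m hc a ⟨
    m + hc + a     ≡⟨ cong (_+ a) (m∸n+n≡m (≤-trans hc≤ (m≤n+m n 2))) ⟩
    2 + n + a      ≡⟨ cong (_+ a) (+-comm 2 n) ⟩
    n + 2 + a      ≡⟨ +-assoc n 2 a ⟩
    n + (2 + a)    ∎))
  lemma : ∀ s m e r h → (s + m * (e * r)) * h ≡ h * s + m * (h * e) * r
  lemma = solve-∀
  lemma′ : ∀ n a s b r → n * a * s + n * b * r ≡ n * (a * s + b * r)
  lemma′ = solve-∀

-- The output of a machine

extent : Tape → ℕ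
extent (tape l r) = length l + length r

extent-write : ∀ s t → extent (write s t) ≤ suc (extent t)
extent-write s (tape l r) = ≤-trans (+-monoʳ-≤ (length l) (≤-trans (length-∷ᵇ s (rest r)) (s≤s (shorter r))))
                              (≤-reflexive (+-suc (length l) (length r)))
  where
  shorter : ∀ r → length (rest r) ≤ length r
  shorter []      = z≤n
  shorter (_ ∷ r) = n≤1+n _

extent-move : ∀ d t → extent (move d t) ≤ suc (extent t)
extent-move left  (tape [] r)      = length-∷ᵇ nothing r
extent-move left  (tape (s ∷ l) r) = ≤-trans (+-monoʳ-≤ (length l) (length-∷ᵇ s r))
  (≤-trans (≤-reflexive (+-suc (length l) (length r))) (n≤1+n _))
extent-move stay  t                = n≤1+n _
extent-move right (tape l [])      = ≤-trans (+-monoˡ-≤ 0 (length-∷ᵇ nothing l)) ≤-refl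
extent-move right (tape l (s ∷ r)) = ≤-trans (+-monoˡ-≤ (length r) (length-∷ᵇ s l))
  (≤-trans (≤-reflexive (sym (+-suc (length l) (length r)))) (n≤1+n _))

length-prefix : ∀ w → length (prefix w) ≤ length w
length-prefix []            = z≤n
length-prefix (nothing ∷ w) = z≤n
length-prefix (just b ∷ w)  = s≤s (length-prefix w)

module _ {i} (M : Machine i) (answer : List Bool → Bool) where
  open Machine M using (program; work)
  open Execution M answer

  extent-actions : ∀ {n} (as : Vec _ n) ts j → extent (lookup (applyActions as ts) j) ≤ 2 + extent
    (lookup ts j)
  extent-actions ((s , d) ∷ as) (t ∷ ts) zero    = ≤-trans (extent-move d (write s t))
    (s≤s (extent-write s t))
  extent-actions (_ ∷ as)       (t ∷ ts) (suc j) = extent-actions as ts j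

  extent-execute : ∀ ins c q ts j → extent (lookup (proj₂ (execute ins c (q , ts))) j) ≤ 2 + extent
    (lookup ts j)
  extent-execute (halt b) c q ts j = m≤n+m _ 2
  extent-execute (act δ)  c q ts j = extent-actions (proj₂ (δ (Vec.map scan ts))) ts j
  extent-execute (ask f)  c q ts j = m≤n+m _ 2
  extent-execute (flip f) c q ts j = m≤n+m _ 2

  extent-run : ∀ {T} (coins : Vec Bool T) x j → extent (lookup (proj₂ (run coins x)) j) ≤ 2 * T + extent
    (lookup (proj₂ x) j)
  extent-run []            x j = ≤-refl
  extent-run {suc T} (c ∷ coins) (q , ts) j = ≤-trans (extent-run coins _ j)
    (≤-trans (+-monoʳ-≤ (2 * T) (extent-execute (program q) c q ts j))
      (≤-reflexive (lemma T (extent (lookup ts j)))))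
    where
    lemma : ∀ t x → 2 * t + (2 + x) ≡ 2 * suc t + x
    lemma = solve-∀

  -- A step adds at most one listed cell by writing and one by moving. Applied to the machine for
  -- the ground set, this bounds the lengths of the strings and their number, that is |E|, by a
  -- polynomial in |B|.
  length-output : ∀ {T} inputs (coins : Vec Bool T) → length (output inputs coins) ≤ 2 * T
  length-output {T} inputs coins = ≤-trans (bound (proj₂ (run coins (initial inputs))))
    (≤-trans (extent-run coins (initial inputs) (suc zero)) (≤-reflexive (+-identityʳ (2 * T))))
    where
    bound : ∀ {n} (ts : Vec Tape (2 + n)) → length (contents (Vec.head (Vec.tail ts))) ≤ extent
      (lookup ts (suc zero))
    bound (_ ∷ tape l r ∷ _) = ≤-trans (length-prefix r) (m≤n+m _ (length l))

-- The machine

-- Unfolding the machine makes conversion checking intractable.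
abstract
  machine : Machine 1 → Machine 3 → ℕ → Machine 1
  machine G E q = compile {1} (Assembly.algorithm G E q)

  machine-decides : ∀ G E q I {T} →
    let F = Assembly.algorithm G E q
        Accepted = Semantics.Hit (answerQuery (Instance.size I) (Instance.oracle I)) F (Verdict (IsYes I)) T
    in
    (∃[ a ] Accepted a (start F) (initialTapes F I)) →
    (IsYes I → ∃[ a ] Accepted a (start F) (initialTapes F I) × 2 ^ T ≤ 2 * a) →
    Decision.CorrectWithin I (machine G E q) T
  machine-decides G E q = compile-decides (Assembly.algorithm G E q)

module Deciding (G : Machine 1) (E : Machine 3) (a′ : ℕ) (I : Instance) (t p : ℕ) (time : ℕ → ℕ)
  (computes : GroundWithin I G t)
  (correct : ∀ X ℓ → Extension.CorrectWithin I E X ℓ (time ℓ))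
  (time≤ : ∀ ℓ → time ℓ ≤ 2 ^ (a′ * ℓ ^ 2) * p) where

  q : ℕ
  q = 4 * suc a′

  open Search G E q I
  open Starting t
  open Instance I renaming (ground to strings)

  ρ ℓ Γ m : ℕ
  ρ = length (toBits size) % q
  ℓ = length (toBits size) / q
  Γ = 2 ^ (a′ * ℓ ^ 2) * p
  m = 2 + size ∸ erased q ρ ℓ

  length≡ : length (toBits size) ≡ ρ + ℓ * q
  length≡ = m≡m%n+[m/n]*n (length (toBits size)) q

  time-l≤ : time ℓ ≤ Γ
  time-l≤ = time≤ ℓ

  time-0≤ : time 0 ≤ Γ
  time-0≤ = ≤-trans (time≤ 0) (*-monoˡ-≤ p (^-monoʳ-≤ 2 (*-monoʳ-≤ a′ {0} z≤n)))

  open Times ℓ Γ using (trialTime; refreshTime)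

  totalTime : ℕ
  totalTime = setupTime computes ρ ℓ + 2 ^ m * (trialTime + refreshTime m)

  tapes₀ : Vec Tape K
  tapes₀ = initialTapes algorithm I

  tapes₀-fresh : Fresh tapes₀
  tapes₀-fresh = cong (lookup tapes₀) pos-input , λ i i≢ → blank (pos i) λ eq → i≢ (trans (sym (name-pos i))
    (trans (cong name (trans eq (sym pos-input))) (name-pos input)))
    where
    blank : ∀ j → j ≢ suc (suc zero) → lookup tapes₀ j ≡ load []
    blank zero                _ = refl
    blank (suc zero)          _ = refl
    blank (suc (suc zero))    j≢ with () ← j≢ refl
    blank (suc (suc (suc j))) _ = lookup-replicate j (load [])

  module _ (claim : ℕ → Subset size → Bool) (sound : ∀ ℓ X → claim ℓ X ≡ true → ∃ (IsExtension I X ℓ)) where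
    open Extending ℓ Γ time correct claim sound using
      (Ready; trialWeight; trial-hit; trial-ratio; successWeight; module Rounds)
    open Rounds time-l≤ time-0≤ m using (Inv; Mid; tried; refreshed)
    private
      module R = Repetition answer trial refresh (IsYes I) Inv Mid trialTime (refreshTime m) trialWeight

    drop-replicate : ∀ k n → drop k (replicate n false) ≡ replicate (n ∸ k) false
    drop-replicate zero    n       = refl
    drop-replicate (suc k) zero    = refl
    drop-replicate (suc k) (suc n) = drop-replicate k n

    common-inv : ∀ {T} → Common (drop (erased q ρ ℓ) (replicate (2 + size) false)) ℓ T →
      Inv (replicate m false) T
    common-inv C = record { cells = cells ; cells-n = cells-n ; elements≡ = elements≡ ; input≡ =
      input≡ ; amount≡ = amount≡
                          ; blank = λ { zero → query≡ , shadows zero ; (suc j) → extends j ,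
                            shadows (suc j) } }
      , trans counter≡ (cong load (drop-replicate (erased q ρ ℓ) (2 + size))) , length-replicate m
      where
      open Common C
      open Quiet quiets

    try : ∀ {u T} → Inv u T → Hit trial (R.Tried u) trialTime trialWeight (start trial) T
    try = tried (trial-hit time-l≤ time-0≤)

    weight : ℕ
    weight = 2 ^ setupTime computes ρ ℓ * R.loopWeight try refreshed (2 ^ m)

    algorithm-hit : Hit algorithm (Verdict (IsYes I)) totalTime weight (start algorithm) tapes₀
    algorithm-hit = subst (λ z → Hit algorithm (Verdict (IsYes I)) (setupTime computes ρ ℓ + z) weight
      (start algorithm) tapes₀)
      (R.loopTime≡ try refreshed (2 ^ m))
      (branch-reach {F = setup} {K = const search} (setup-reach computes {ρ} {ℓ}
        (m%n<n (length (toBits size)) q) length≡ tapes₀-fresh)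
        λ b T C → R.loop-hit try refreshed (R.weight-bounded try refreshed (common-inv C)) (2 ^ m)
          (common-inv C) (remaining-zeros m))

    weight-half : 4 * 4 ^ size ≤ 2 ^ m * successWeight → 2 ^ totalTime ≤ 2 * weight
    weight-half le = begin
      2 ^ totalTime                                             ≡⟨ cong (λ z → 2 ^ (s + z))
        (R.loopTime≡ try refreshed (2 ^ m)) ⟨
      2 ^ (s + R.loopTime try refreshed (2 ^ m))                ≡⟨ ^-distribˡ-+-* 2 s _ ⟩
      2 ^ s * 2 ^ R.loopTime try refreshed (2 ^ m)              ≤⟨ *-monoʳ-≤ (2 ^ s) half ⟩
      2 ^ s * (2 * R.loopWeight try refreshed (2 ^ m))          ≡⟨ swap (2 ^ s) 2 _ ⟩
      2 * weight                                                ∎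
      where
      open ≤-Reasoning
      s = setupTime computes ρ ℓ
      swap : ∀ a b c → a * (b * c) ≡ b * (a * c)
      swap = solve-∀
      positive : ∀ x → 4 * 4 ^ size ≤ 2 ^ m * x → 1 ≤ x
      positive zero    le = case ≤-trans (*-mono-≤ (s≤s (z≤n {3})) (m^n>0 4 size))
        (≤-trans le (≤-reflexive (*-zeroʳ (2 ^ m)))) of λ ()
      positive (suc x) le = s≤s z≤n
      chance : 2 ^ trialTime ≤ 2 ^ m * trialWeight
      chance = *-cancelˡ-≤ successWeight {{>-nonZero (positive successWeight le)}} (begin
        successWeight * 2 ^ trialTime        ≤⟨ trial-ratio ⟩
        4 * 4 ^ size * trialWeight           ≤⟨ *-monoˡ-≤ trialWeight le ⟩
        2 ^ m * successWeight * trialWeight  ≡⟨ rotate (2 ^ m) successWeight trialWeight ⟩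
        successWeight * (2 ^ m * trialWeight) ∎)
        where
        rotate : ∀ a b c → a * b * c ≡ b * (a * c)
        rotate = solve-∀
      -- That the weight of a trial is at most 2 ^ τ is derived from an actual trial, for which
      -- tapes satisfying the invariant are needed; the setup supplies them.
      ready = exit-exists (setup-reach computes {ρ} {ℓ} {tapes₀} (m%n<n (length (toBits size)) q) length≡
        tapes₀-fresh)
      half : 2 ^ R.loopTime try refreshed (2 ^ m) ≤ 2 * R.loopWeight try refreshed (2 ^ m)
      half = subst (λ z → 2 ^ R.loopTime try refreshed z ≤ 2 * R.loopWeight try refreshed z) suc-e
        (R.loopWeight-half try refreshed (R.weight-bounded try refreshed
          (common-inv (proj₂ (proj₂ (proj₂ ready))))) (pred (2 ^ m)) (subst (λ z → 2 ^ trialTime ≤ z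
          * trialWeight) (sym suc-e) chance))
        where
        suc-e : suc (pred (2 ^ m)) ≡ 2 ^ m
        suc-e = suc-pred (2 ^ m) {{m^n≢0 2 m}}

  decides : Decision.CorrectWithin I (machine G E q) totalTime
  -- With nothing claimed, the derivation proves halting and soundness on any instance.
  decides = machine-decides G E q I (_ , algorithm-hit (λ _ _ → false) λ _ _ ()) yes-case
    where
    yes-case : IsYes I → ∃[ a ] Hit algorithm (Verdict (IsYes I)) totalTime a (start algorithm) tapes₀
      × 2 ^ totalTime ≤ 2 * a
    yes-case (S , S∈𝓕) = weight claim sound , algorithm-hit claim sound , weight-half claim sound
      (rounds-suffice a′ ρ ℓ length≡ S)
      where
      claim : ℕ → Subset size → Bool
      claim ℓ X = removes S X ℓ
      sound : ∀ ℓ X → claim ℓ X ≡ true → ∃ (IsExtension I X ℓ)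
      sound ℓ X e with removes-extension ℓ S X e
      ... | D , D⊆ , eq , card = D , D⊆ , subst 𝓕 (sym eq) S∈𝓕 , card

  module _ (N : ℕ) (enc≤ : length (encodeStrings strings) ≤ N) where
    private
      k : ℕ
      k = length (allFin (5 + Machine.work E))
      ℓ≤L : ℓ ≤ length (toBits size)
      ℓ≤L = ≤-trans (≤-trans (m≤m*n ℓ q) (m≤n+m (ℓ * q) ρ)) (≤-reflexive (sym length≡))
      size≤ : size ≤ N
      size≤ = ≤-trans (length≤encode strings) enc≤
      L≤ : length (toBits size) ≤ N
      L≤ = ≤-trans (length-toBits≤ size) size≤

    totalTime≤ : totalTime * 2 ^ ℓ ^ 2 ≤ 2 ^ size *
      (2 ^ suc a′ * setupPoly q N (length encoding) t + 2 ^ (2 + suc a′) * roundPoly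
        (length (allFin (5 + Machine.work E))) N (length encoding) p)
    totalTime≤ = savings a′ size ρ ℓ length≡
      (setup≤ q N (length encoding) t ρ ℓ strings enc≤ (≤-trans ℓ≤L L≤)
        (≤-trans (≤-reflexive (sym length≡)) L≤))
      (round≤ k N (length encoding) p (2 ^ (a′ * ℓ ^ 2)) (m^n>0 2 (a′ * ℓ ^ 2)) size≤
        (≤-trans (length-toBits≤ ℓ) (≤-trans ℓ≤L L≤))
          (≤-trans (m∸n≤m (2 + size) (erased q ρ ℓ)) (+-monoʳ-≤ 2 size≤)))

-- The saving and the theorem

savedBits : ℕ → ℕ → ℕ
savedBits a′ n = (length (toBits n) / (4 * suc a′)) ^ 2

-- The length L of the numeral is an upper bound for log n. For n ≥ 2 ^ q it is at least q, so ℓ ≥ 1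
-- and L ≤ q + ℓ q ≤ 2 q ℓ; squaring gives the constant 4 q².
savedBits-Ω : ∀ a′ → IsΩlog² (savedBits a′)
savedBits-Ω a′ = 4 * (q * q) , 2 ^ q , bound
  where
  open ≤-Reasoning
  q = 4 * suc a′
  bound : ∀ n → n ≥ 2 ^ q → log² n ≤ (4 * (q * q) * savedBits a′ n)
  bound n n≥ a b le = begin
    a * a                                ≤⟨ *-mono-≤ a≤ a≤ ⟩
    L * b * (L * b)                      ≤⟨ *-mono-≤ (*-monoˡ-≤ b L≤) (*-monoˡ-≤ b L≤) ⟩
    2 * q * ℓ * b * (2 * q * ℓ * b)      ≡⟨ lemma q ℓ b ⟩
    4 * (q * q) * (ℓ ^ 2) * (b * b)      ∎
    where
    L = length (toBits n)
    ℓ = L / q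
    lemma : ∀ q l b → 2 * q * l * b * (2 * q * l * b) ≡ 4 * (q * q) * (l * (l * 1)) * (b * b)
    lemma = solve-∀
    a≤ : a ≤ L * b
    a≤ = ≮⇒≥ λ lt → <⇒≱ (^-monoʳ-< 2 (s≤s (s≤s z≤n)) lt) (≤-trans le
           (≤-trans (^-monoˡ-≤ b (<⇒≤ (n<2^length n))) (≤-reflexive (^-*-assoc 2 L b))))
    q≤L : q ≤ L
    q≤L = ≮⇒≥ λ lt → <⇒≱ (n<2^length n) (≤-trans (^-monoʳ-≤ 2 (<⇒≤ lt)) n≥)
    L≤ : L ≤ 2 * q * ℓ
    L≤ = begin
      L                ≡⟨ m≡m%n+[m/n]*n L q ⟩
      L % q + ℓ * q    ≤⟨ +-monoˡ-≤ (ℓ * q) (≤-trans (<⇒≤ (m%n<n L q))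
        (m≤n*m q ℓ {{>-nonZero (m≥n⇒m/n>0 q≤L)}})) ⟩
      ℓ * q + ℓ * q    ≡⟨ double ℓ q ⟩
      2 * q * ℓ        ∎
      where
      double : ∀ l q → l * q + l * q ≡ 2 * q * l
      double = solve-∀

≤-power : ∀ {n b} k → n ^ suc k ≤ b → n ≤ b
≤-power {zero}  k le = z≤n
≤-power {suc n} k le = ≤-trans (≤-trans (≤-reflexive (sym (*-identityʳ (suc n)))) (*-monoʳ-≤ (suc n)
  (m^n>0 (suc n) k))) le

lemma5p9 : (α : ℝ) → Positiveᴿ α →
    (g : ℕ → ℕ) → (∀ ℓ → g ℓ ≡⌊2^ α · ℓ ^ 2 ⌋) →
    (P : ImplicitSetProblem) →
    PolynomialTimeComputable P →
    RandomExtensionAlgorithm P g →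
    ∃[ h ] IsΩlog² h × ∃[ c ] RandomizedAlgorithm P (Savings h c)
lemma5p9 α _ g g≡ P ((G , _ , cG , computes) , _) (E , cE , extends) =
  savedBits a′ , savedBits-Ω a′ , proj₁ bound-poly , machine G E q , decide
  where
  u : ℚ
  u = proj₁ (ℝ.upper-inhabited α)
  a′ q k : ℕ
  a′ = ℤ.∣ ↥ u ∣
  q  = 4 * suc a′
  k  = length (allFin (5 + Machine.work E))

  -- For a rational u above α, the power of g ℓ by the denominator is at most 2 ^ (numerator · ℓ²).
  -- Bounding g ℓ by that power shows that the numerator can serve as an integer in place of α.
  g≤ : ∀ ℓ → g ℓ ≤ 2 ^ (a′ * ℓ ^ 2)
  g≤ ℓ = ≤-power (ℚ.denominator-1 u) (proj₁ (g≡ ℓ) u (proj₂ (ℝ.upper-inhabited α)))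

  N bound : ℕ → ℕ
  N x     = 2 * poly cG x
  bound x = 2 ^ suc a′ * setupPoly q (N x) x (poly cG x) + 2 ^ (2 + suc a′) * roundPoly k (N x) x (poly cE x)

  N-poly : IsPoly N
  N-poly = const-poly 2 ⊗ poly-poly cG

  bound-poly : IsPoly bound
  bound-poly = const-poly (2 ^ suc a′) ⊗ setupPoly-poly N-poly (poly-poly cG) q
             ⊕ const-poly (2 ^ (2 + suc a′)) ⊗ roundPoly-poly N-poly (poly-poly cE) k

  decide : ∀ I → P I → ∃[ T ] Savings (savedBits a′) (proj₁ bound-poly) I T × Decision.CorrectWithin I
    (machine G E q) T
  decide I I∈P = D.totalTime
    , ≤-trans (D.totalTime≤ (N x) enc≤) (*-monoʳ-≤ (2 ^ size) (proj₂ bound-poly x))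
    , D.decides
    where
    open Instance I
    x = length encoding
    module D = Deciding G E a′ I (poly cG x) (poly cE x) (λ ℓ → g ℓ * poly cE x) (computes I I∈P)
                 (extends I I∈P) (λ ℓ → *-monoˡ-≤ (poly cE x) (g≤ ℓ))
    enc≤ : length (encodeStrings ground) ≤ N x
    enc≤ = subst (λ w → length w ≤ N x) (proj₂ (computes I I∈P (Vec.replicate _ false)))
             (length-output G (answerQuery size oracle) (encoding ∷ []) (Vec.replicate (poly cG x) false))
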